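{- Let $p$ be an odd prime, let $q$ be a power of $p$, let $N, l, i$ be positive integers, let $f \in \mathbb{F}_q[T_1,\ldots,T_N]$, and let $F \in \mathbb{Z}_q[T_1,\ldots,T_N]$ be a lift of $f$ (i.e. the coefficientwise reduction of $F$ modulo $p$ is $f$). Let $X$ be the double cover of the torus $\mathbb{G}_{m,\mathbb{F}_q}^N$ given by $w^2 = f$. Let $b$ be an odd integer such that $b(q-1)/2 \geq l$, and put $A^{(l)}_{b,k} := \big(\big(P_b^{(l)}\big)^{ -1}\big)_{1,k}$ for $k=1,\ldots,l$. Then $$\Phi := \sum_{k=1}^l A^{(l)}_{b,k} \cdot N_{\mathbb{Z}_{q^i}/\mathbb{Z}_q}F^{(b+2k-2)(q-1)/2}$$ is an Eulerian function for $X(\mathbb{F}_{q^i})$ modulo $p^l$.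
   Context: For $i \geq 1$, $\mu_{q^i-1}$ denotes the group of $(q^i-1)$-th roots of unity (in an algebraic closure of $\mathbb{Q}_p$), $\mathbb{Z}_{q^i}$ is the ring of integers of the unramified extension $\mathbb{Q}_p(\mu_{q^i-1})$ of $\mathbb{Q}_p$, with residue field $\mathbb{F}_{q^i}$, and $\pi\colon \mathbb{Z}_{q^i} \to \mathbb{F}_{q^i}$ is the residue map, which maps $\mu_{q^i-1}$ bijectively onto $\mathbb{F}_{q^i}^*$. One has $\mathbb{Z}_q \subseteq \mathbb{Z}_{q^i}$. For a polynomial $g$ and $n \geq 1$, the quasi power is $g^{(n)}(T_1,\ldots,T_N) := g(T_1^n,\ldots,T_N^n)$. For $g \in \mathbb{Z}_q[T_1,\ldots,T_N]$, the quasi norm is $$N_{\mathbb{Z}_{q^i}/\mathbb{Z}_q} g := g \cdot g^{(q)} \cdot g^{(q^2)} \cdots g^{(q^{i-1})} \in \mathbb{Z}_q[T_1,\ldots,T_N].$$ The notation $N_{\mathbb{Z}_{q^i}/\mathbb{Z}_q}F^{m}$ means the quasi norm of $F^m$ (equivalently the $m$-th power of the quasi norm of $F$). For $(z_1,\ldots,z_N) \in \mu_{q^i-1}^N$, the value $N_{\mathbb{Z}_{q^i}/\mathbb{Z}_q} g(z_1,\ldots,z_N)$ lies in $\mathbb{Z}_q$, so such polynomials define functions $\mu_{q^i-1}^N \to \mathbb{Z}_q$ by evaluation. For integers $l>0$ and $b$, $P_b^{(l)} \in M_{l \times l}(\mathbb{Q})$ is the matrix whose entry in row $j$ and column $k$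 ($1 \le j,k \le l$) is the binomial coefficient $\binom{b+2(j-1)}{k-1}$. It is invertible, and the entries of its inverse are $p$-adic integers for $p$ odd. A function $\Phi\colon \mu_{q^i-1}^N \to \mathbb{Z}_q$ is called an Eulerian function for $X(\mathbb{F}_{q^i})$ modulo $p^l$ if, for every $(z_1,\ldots,z_N) \in \mu_{q^i-1}^N$: $\Phi(z_1,\ldots,z_N) \equiv 1 \pmod{p^l}$ if $f(\pi(z_1),\ldots,\pi(z_N))$ is a square in $\mathbb{F}_{q^i}^*$; $\Phi(z_1,\ldots,z_N) \equiv -1 \pmod{p^l}$ if $f(\pi(z_1),\ldots,\pi(z_N))$ is a non-square in $\mathbb{F}_{q^i}^*$; and $\Phi(z_1,\ldots,z_N) \equiv 0 \pmod{p^l}$ if $f(\pi(z_1),\ldots,\pi(z_N)) = 0$. -}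

module Defs where

open import Algebra.Apartness.Bundles using (HeytingField; HeytingCommutativeRing)
open import Algebra.Bundles using (CommutativeRing; RawRing)
open import Algebra.Core using (Op₁; Op₂)
open import Algebra.Morphism.Structures using (IsRingHomomorphism)
open import Algebra.Structures using (IsCommutativeRing)
open import Data.Bool.Base using (if_then_else_)
open import Data.Fin.Base using (Fin; zero; suc; toℕ; fromℕ<; punchIn; combine; remQuot)
open import Data.Fin.Properties using (_≟_; punchIn-injective; remQuot-combine; toℕ-fromℕ<; toℕ<n)
open import Data.Integer.Base as ℤ using (ℤ; +_)
open import Data.List.Base as List using (List; []; _∷_)
open import Data.Nat.Base as ℕ using (ℕ; zero; suc)
open import Data.Nat.Primality using (Prime; euclidsLemma; prime⇒nonTrivial)
open import Data.Product.Base using (∃; _×_; _,_; proj₁; proj₂; map₁; map₂)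
open import Data.Rational.Base as ℚ using (ℚ)
open import Data.Sum.Base using (inj₁; inj₂)
open import Data.Vec.Base as Vec using (Vec; []; _∷_)
open import Data.Vec.Functional using (Vector)
open import Function.Base using (_∘_; id)
open import Level using (Level; _⊔_; 0ℓ) renaming (suc to lsuc)
open import Relation.Binary.PropositionalEquality as ≡ using (_≡_; _≢_)
open import Relation.Binary.Bundles using (Setoid)
open import Relation.Binary.Core using (Rel)
open import Relation.Binary.Structures using (IsEquivalence)
open import Relation.Nullary using (¬_; yes; no; ⌊_⌋; contradiction)
import Algebra.Consequences.Setoid as Consequences
import Algebra.Definitions as AlgDefs
import Algebra.Definitions.RawMagma as RawMagmaOps
import Algebra.Definitions.RawSemiring as RawSemiringOps
import Algebra.Morphism.Construct.Composition as Composition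
import Algebra.Morphism.RingMonomorphism as RingMono
import Algebra.Properties.CommutativeMonoid.Sum as CMSum
import Algebra.Properties.Ring as RingProps
import Algebra.Properties.Semiring.Exp as Exp
import Algebra.Properties.Semiring.Sum as Sum
import Algebra.Solver.Ring.NaturalCoefficients.Default as Solver
import Data.Integer.Divisibility.Signed as ℤ∣
import Data.Integer.Properties as ℤₚᵣ
import Data.Integer.Tactic.RingSolver as ℤSolver
import Data.Nat.Divisibility as ℕ∣
import Data.Nat.DivMod as DivMod
import Data.Nat.Properties as ℕₚ
import Data.Rational.Properties as ℚₚᵣ
import Data.Vec.Properties as Vecₚ
import Relation.Binary.Reasoning.Setoid as SetoidReasoning

private variable c ℓ c₁ ℓ₁ c₂ ℓ₂ c₃ ℓ₃ : Level

module Ops (R : CommutativeRing c₁ ℓ₁) where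
  open RawSemiringOps (RawRing.rawSemiring (CommutativeRing.rawRing R)) public
    using (_^_; sum; product; _∣_) renaming (_×_ to _·_)

RingHom : CommutativeRing c₁ ℓ₁ → CommutativeRing c₂ ℓ₂ → Set (c₁ ⊔ ℓ₁ ⊔ c₂ ⊔ ℓ₂)
RingHom A B = ∃ λ φ → IsRingHomomorphism (CommutativeRing.rawRing A) (CommutativeRing.rawRing B) φ

module MonicRoots (A : CommutativeRing c₁ ℓ₁) (B : CommutativeRing c₂ ℓ₂)
                  (φ : CommutativeRing.Carrier A → CommutativeRing.Carrier B) where
  private module A = CommutativeRing A
  open CommutativeRing B
  open Ops B

  -- φ(a₀) + φ(a₁) x + ⋯ + φ(aₙ₋₁) xⁿ⁻¹ + xⁿ.
  monicValue : ∀ {n} → Vector A.Carrier n → Carrier → Carrier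
  monicValue {n} a x = x ^ n + sum (λ j → φ (a j) * x ^ toℕ j)

  IsMonicRoot : Carrier → Set (c₁ ⊔ ℓ₂)
  IsMonicRoot x = ∃ λ n → ∃ λ (a : Vector A.Carrier n) → monicValue a x ≈ 0#

module IntegralClosure (A : CommutativeRing c₁ ℓ₁) (B : CommutativeRing c₂ ℓ₂)
                       (hom : RingHom A B) where
  private module A = CommutativeRing A
  private φ = proj₁ hom
  open CommutativeRing B hiding (zero)
  open IsRingHomomorphism (proj₂ hom)
  open Ops B
  open MonicRoots A B φ
  open RingProps ring using (-1*x≈-x; -‿distribˡ-*; -‿involutive)
  open SetoidReasoning setoid
  open Solver commutativeSemiring using (solve; _:+_; _:*_; _:=_; con)
  private
    module Ex = Exp semiring
    module S = Sum semiring
    module MS = CMSum +-commutativeMonoid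

  Σ-cong : ∀ n (f g : Fin n → Carrier) → (∀ k → f k ≈ g k) → sum f ≈ sum g
  Σ-cong n f g p = MS.sum-cong-≋ {n} {f} {g} p

  Σ-0 : ∀ n (f : Fin n → Carrier) → (∀ k → f k ≈ 0#) → sum f ≈ 0#
  Σ-0 n f p = trans (Σ-cong n f (λ _ → 0#) p) (MS.sum-replicate-zero n)

  Σ-+ : ∀ n (f g : Fin n → Carrier) → sum (λ k → f k + g k) ≈ sum f + sum g
  Σ-+ n f g = MS.∑-distrib-+ {n} f g

  Σ-*ˡ : ∀ n s (f : Fin n → Carrier) → s * sum f ≈ sum (λ k → s * f k)
  Σ-*ˡ n s f = S.*-distribˡ-sum {n} s f

  Σ-*ʳ : ∀ n s (f : Fin n → Carrier) → sum f * s ≈ sum (λ k → f k * s)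
  Σ-*ʳ n s f = S.*-distribʳ-sum {n} s f

  -- Values at x of polynomials of degree < d, and of monic ones of degree d.
  module Degrees (x : Carrier) where
    Low : ℕ → Carrier → Set (c₁ ⊔ c₂ ⊔ ℓ₂)
    Low zero    v = ∃ λ (_ : A.Carrier) → ∃ λ (_ : Carrier) → v ≈ 0#
    Low (suc d) v = ∃ λ a → ∃ λ w → Low d w × v ≈ φ a + x * w

    Monic : ℕ → Carrier → Set (c₁ ⊔ c₂ ⊔ ℓ₂)
    Monic d v = ∃ λ w → Low d w × v ≈ x ^ d + w

    low-cong : ∀ d {v w} → v ≈ w → Low d v → Low d w
    low-cong zero    e (a , w , p)     = a , w , trans (sym e) p
    low-cong (suc d) e (a , w , l , p) = a , w , l , trans (sym e) p

    low-0 : ∀ d → Low d 0#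
    low-0 zero    = A.0# , 0# , refl
    low-0 (suc d) = A.0# , 0# , low-0 d ,
      sym (trans (+-cong 0#-homo (zeroʳ x)) (+-identityˡ 0#))

    low-+ : ∀ d {v w} → Low d v → Low d w → Low d (v + w)
    low-+ zero    (a , u , p) (_ , _ , q) = a , u , trans (+-cong p q) (+-identityˡ 0#)
    low-+ (suc d) (a , v , l , p) (b , w , m , q) = a A.+ b , v + w , low-+ d l m ,
      trans (+-cong p q) (trans
        (solve 5 (λ a b x v w → (a :+ x :* v) :+ (b :+ x :* w) := (a :+ b) :+ x :* (v :+ w))
               refl (φ a) (φ b) x v w)
        (+-congʳ (sym (+-homo a b))))

    low-scale : ∀ d a {v} → Low d v → Low d (φ a * v)
    low-scale zero    a (b , u , p) = b , u , trans (*-congˡ p) (zeroʳ _)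
    low-scale (suc d) a (b , v , l , p) = a A.* b , φ a * v , low-scale d a l ,
      trans (*-congˡ p) (trans
        (solve 4 (λ a b x v → a :* (b :+ x :* v) := a :* b :+ x :* (a :* v)) refl (φ a) (φ b) x v)
        (+-congʳ (sym (*-homo a b))))

    φ-1 : ∀ v → φ (A.- A.1#) * v ≈ - v
    φ-1 v = trans (*-congʳ (trans (-‿homo A.1#) (-‿cong 1#-homo))) (-1*x≈-x v)

    low-neg : ∀ d {v} → Low d v → Low d (- v)
    low-neg d {v} l = low-cong d (φ-1 v) (low-scale d (A.- A.1#) l)

    low-x : ∀ d {v} → Low d v → Low (suc d) (x * v)
    low-x d {v} l = A.0# , v , l , sym (trans (+-congʳ 0#-homo) (+-identityˡ _))

    low-weaken : ∀ d {v} → Low d v → Low (suc d) v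
    low-weaken zero    (_ , _ , p) = low-cong 1 (sym p) (low-0 1)
    low-weaken (suc d) (a , w , l , p) = a , w , low-weaken d l , p

    low-mono : ∀ e d {v} → Low d v → Low (e ℕ.+ d) v
    low-mono zero    d l = l
    low-mono (suc e) d l = low-weaken (e ℕ.+ d) (low-mono e d l)

    low-* : ∀ d e {v w} → Low d v → Low e w → Low (d ℕ.+ e) (v * w)
    low-* zero    e (_ , _ , p) m = low-cong e (sym (trans (*-congʳ p) (zeroˡ _))) (low-0 e)
    low-* (suc d) e {v} {w} (a , u , l , p) m =
      low-cong (suc (d ℕ.+ e))
        (sym (trans (*-congʳ p)
          (solve 4 (λ a x u w → (a :+ x :* u) :* w := a :* w :+ x :* (u :* w)) refl (φ a) x u w)))
        (low-+ (suc (d ℕ.+ e))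
          (low-mono (suc d) e (low-scale e a m))
          (low-x (d ℕ.+ e) (low-* d e l m)))

    low-x^ : ∀ d e {w} → Low e w → Low (d ℕ.+ e) (x ^ d * w)
    low-x^ zero    e l = low-cong e (sym (*-identityˡ _)) l
    low-x^ (suc d) e l = low-cong (suc (d ℕ.+ e)) (sym (*-assoc x _ _)) (low-x (d ℕ.+ e) (low-x^ d e l))

    monic-* : ∀ d e {v w} → Monic d v → Monic e w → Monic (d ℕ.+ e) (v * w)
    monic-* d e (v , l , p) (w , m , q) =
      x ^ d * w + x ^ e * v + v * w ,
      low-+ (d ℕ.+ e)
        (low-+ (d ℕ.+ e) (low-x^ d e m)
          (≡.subst (λ k → Low k (x ^ e * v)) (ℕₚ.+-comm e d) (low-x^ e d l)))
        (low-* d e l m) ,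
      trans (*-cong p q) (trans
        (solve 4 (λ xd xe v w → (xd :+ v) :* (xe :+ w) :=
                   xd :* xe :+ (xd :* w :+ xe :* v :+ v :* w)) refl (x ^ d) (x ^ e) v w)
        (+-congʳ (sym (Ex.^-homo-* x d e))))

    monic-*-low : ∀ d e {v w} → Monic d v → Low e w → Low (d ℕ.+ e) (v * w)
    monic-*-low d e {w = u} (v , l , p) m =
      low-cong (d ℕ.+ e) (sym (trans (*-congʳ p) (distribʳ u _ v)))
        (low-+ (d ℕ.+ e) (low-x^ d e m) (low-* d e l m))

    monic-+-low : ∀ d {v w} → Monic d v → Low d w → Monic d (v + w)
    monic-+-low d (v , l , p) m = v + _ , low-+ d l m , trans (+-congʳ p) (+-assoc _ _ _)

    low→vector : ∀ d {v} → Low d v → ∃ λ (a : Vector A.Carrier d) → v ≈ sum (λ j → φ (a j) * x ^ toℕ j)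
    low→vector zero    (_ , _ , p) = (λ ()) , p
    low→vector (suc d) {v} (a , w , l , p) with low→vector d l
    ... | b , q = (λ { zero → a ; (suc j) → b j }) , (begin
      v                                                      ≈⟨ p ⟩
      φ a + x * w                                            ≈⟨ +-cong (sym (*-identityʳ _)) (*-congˡ q) ⟩
      φ a * 1# + x * sum (λ j → φ (b j) * x ^ toℕ j)         ≈⟨ +-congˡ (Σ-*ˡ d x (λ j → φ (b j) * x ^ toℕ j)) ⟩
      φ a * 1# + sum (λ j → x * (φ (b j) * x ^ toℕ j))       ≈⟨ +-congˡ (Σ-cong d _ _ (λ j →
          solve 3 (λ x b y → x :* (b :* y) := b :* (x :* y)) refl x (φ (b j)) (x ^ toℕ j))) ⟩
      φ a * 1# + sum (λ j → φ (b j) * (x * x ^ toℕ j))       ∎)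

    monic→root : ∀ d {v} → Monic d v → v ≈ 0# → IsMonicRoot x
    monic→root d (w , l , p) e with low→vector d l
    ... | a , q = d , a , trans (+-congˡ (sym q)) (trans (sym p) e)

    -- Gaussian elimination: the diagonal stays monic of larger degree than
    -- the off-diagonal entries, so no determinants are needed.
    eliminate : ∀ n d (N : Fin (suc n) → Fin (suc n) → Carrier) (m : Fin (suc n) → Carrier) →
                (∀ j → Monic d (N j j)) → (∀ j k → j ≢ k → Low d (N j k)) →
                (∀ j → sum (λ k → N j k * m k) ≈ 0#) →
                ∃ λ D → ∃ λ v → Monic D v × v * m zero ≈ 0#
    eliminate zero    d N m diag off eq = d , N zero zero , diag zero ,
      trans (sym (+-identityʳ _)) (eq zero)
    eliminate (suc n) d N m diag off eq =
      eliminate n (d ℕ.+ d) N′ (m ∘ keep) diag′ off′ eq′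
      where
      one : Fin (suc (suc n))
      one = suc zero
      keep : Fin (suc n) → Fin (suc (suc n))
      keep = punchIn one
      keep≢one : ∀ j → keep j ≢ one
      keep≢one zero    ()
      keep≢one (suc j) ()
      N′ : Fin (suc n) → Fin (suc n) → Carrier
      N′ j k = N one one * N (keep j) (keep k) + (- N (keep j) one) * N one (keep k)
      diag′ : ∀ j → Monic (d ℕ.+ d) (N′ j j)
      diag′ j = monic-+-low (d ℕ.+ d) (monic-* d d (diag one) (diag (keep j)))
        (low-* d d (low-neg d (off _ _ (keep≢one j))) (off _ _ (keep≢one j ∘ ≡.sym)))
      off′ : ∀ j k → j ≢ k → Low (d ℕ.+ d) (N′ j k)
      off′ j k j≢k = low-+ (d ℕ.+ d)
        (monic-*-low d d (diag one) (off _ _ (j≢k ∘ punchIn-injective one j k)))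
        (low-* d d (low-neg d (off _ _ (keep≢one j))) (off _ _ (keep≢one k ∘ ≡.sym)))
      split : ∀ (f : Fin (suc (suc n)) → Carrier) → sum f ≈ f one + sum (f ∘ keep)
      split f = solve 3 (λ a b c → a :+ (b :+ c) := b :+ (a :+ c)) refl (f zero) (f one) _
      eq′ : ∀ j → sum (λ k → N′ j k * m (keep k)) ≈ 0#
      eq′ j = begin
        sum (λ k → N′ j k * m (keep k))
          ≈⟨ Σ-cong (suc n) _ _ (λ k → solve 5 (λ P a r b m → (P :* a :+ r :* b) :* m := P :* (a :* m) :+ r :* (b :* m))
                refl P (N (keep j) (keep k)) r (N one (keep k)) (m (keep k))) ⟩
        sum (λ k → P * (N (keep j) (keep k) * m (keep k)) + r * (N one (keep k) * m (keep k)))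
          ≈⟨ Σ-+ (suc n) (λ k → P * (N (keep j) (keep k) * m (keep k))) (λ k → r * (N one (keep k) * m (keep k))) ⟩
        sum (λ k → P * (N (keep j) (keep k) * m (keep k))) + sum (λ k → r * (N one (keep k) * m (keep k)))
          ≈⟨ +-cong (Σ-*ˡ (suc n) P (λ k → N (keep j) (keep k) * m (keep k))) (Σ-*ˡ (suc n) r (λ k → N one (keep k) * m (keep k))) ⟨
        P * T + r * U
          ≈⟨ +-identityˡ _ ⟨
        0# + (P * T + r * U)
          ≈⟨ +-congʳ (trans (*-congʳ (-‿inverseʳ (N (keep j) one))) (zeroˡ _)) ⟨
        (N (keep j) one + r) * (P * m one) + (P * T + r * U)
          ≈⟨ solve 6 (λ P T r U b m → (b :+ r) :* (P :* m) :+ (P :* T :+ r :* U) :=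
                 P :* (b :* m :+ T) :+ r :* (P :* m :+ U)) refl P T r U (N (keep j) one) (m one) ⟩
        P * (N (keep j) one * m one + T) + r * (P * m one + U)
          ≈⟨ +-cong (*-congˡ (split (λ k → N (keep j) k * m k))) (*-congˡ (split (λ k → N one k * m k))) ⟨
        P * sum (λ k → N (keep j) k * m k) + r * sum (λ k → N one k * m k)
          ≈⟨ +-cong (*-congˡ (eq (keep j))) (*-congˡ (eq one)) ⟩
        P * 0# + r * 0#
          ≈⟨ trans (+-cong (zeroʳ _) (zeroʳ _)) (+-identityˡ 0#) ⟩
        0# ∎
        where
        P = N one one
        r = - N (keep j) one
        T = sum (λ k → N (keep j) (keep k) * m (keep k))
        U = sum (λ k → N one (keep k) * m (keep k))

    δ : ∀ {n} → Fin n → Fin n → Carrier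
    δ zero    zero    = 1#
    δ zero    (suc k) = 0#
    δ (suc j) zero    = 0#
    δ (suc j) (suc k) = δ j k

    δ-diag : ∀ {n} (j : Fin n) → δ j j ≡ 1#
    δ-diag zero    = ≡.refl
    δ-diag (suc j) = δ-diag j

    δ-off : ∀ {n} (j k : Fin n) → j ≢ k → δ j k ≡ 0#
    δ-off zero    zero    j≢k with () ← j≢k ≡.refl
    δ-off zero    (suc k) j≢k = ≡.refl
    δ-off (suc j) zero    j≢k = ≡.refl
    δ-off (suc j) (suc k) j≢k = δ-off j k (j≢k ∘ ≡.cong suc)

    sum-δ : ∀ {n} (j : Fin n) (f : Fin n → Carrier) → sum (λ k → δ j k * f k) ≈ f j
    sum-δ {suc n} zero f = trans (+-cong (*-identityˡ _) (Σ-0 n (λ k → 0# * f (suc k)) (λ k → zeroˡ _))) (+-identityʳ _)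
    sum-δ (suc j) f = trans (+-cong (zeroˡ _) (sum-δ j (f ∘ suc))) (+-identityˡ _)

    eigenvalue : ∀ {n} (e : Fin (suc n) → Carrier) → e zero ≈ 1# →
                 (a : Fin (suc n) → Fin (suc n) → A.Carrier) →
                 (∀ j → x * e j ≈ sum (λ k → φ (a j k) * e k)) → IsMonicRoot x
    eigenvalue {n} e e0 a rel
      with eliminate n 1 (λ j k → δ j k * x + - φ (a j k)) e diag off eq
      where
      const : ∀ b → Low 1 (- φ b)
      const b = A.- b , 0# , low-0 0 ,
        sym (trans (+-cong (-‿homo b) (zeroʳ x)) (+-identityʳ _))
      diag : ∀ j → Monic 1 (δ j j * x + - φ (a j j))
      diag j = - φ (a j j) , const (a j j) ,
        +-congʳ (trans (*-congʳ (reflexive (δ-diag j))) (trans (*-identityˡ x) (sym (*-identityʳ x))))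
      off : ∀ j k → j ≢ k → Low 1 (δ j k * x + - φ (a j k))
      off j k j≢k = low-cong 1
        (sym (trans (+-congʳ (trans (*-congʳ (reflexive (δ-off j k j≢k))) (zeroˡ x))) (+-identityˡ _)))
        (const (a j k))
      eq : ∀ j → sum (λ k → (δ j k * x + - φ (a j k)) * e k) ≈ 0#
      eq j = begin
        sum (λ k → (δ j k * x + - φ (a j k)) * e k)
          ≈⟨ Σ-cong (suc n) _ _ (λ k → trans
               (solve 4 (λ d x b e → (d :* x :+ b) :* e := d :* (x :* e) :+ b :* e)
                  refl (δ j k) x (- φ (a j k)) (e k))
               (+-congˡ (sym (-‿distribˡ-* _ _)))) ⟩
        sum (λ k → δ j k * (x * e k) + - (φ (a j k) * e k))
          ≈⟨ Σ-+ (suc n) (λ k → δ j k * (x * e k)) (λ k → - (φ (a j k) * e k)) ⟩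
        sum (λ k → δ j k * (x * e k)) + sum (λ k → - (φ (a j k) * e k))
          ≈⟨ +-cong (sum-δ j (λ k → x * e k)) (Σ-cong (suc n) _ (λ k → - 1# * (φ (a j k) * e k)) (λ k → sym (-1*x≈-x (φ (a j k) * e k)))) ⟩
        x * e j + sum (λ k → - 1# * (φ (a j k) * e k))
          ≈⟨ +-cong (rel j) (sym (Σ-*ˡ (suc n) (- 1#) (λ k → φ (a j k) * e k))) ⟩
        sum (λ k → φ (a j k) * e k) + - 1# * sum (λ k → φ (a j k) * e k)
          ≈⟨ +-congˡ (-1*x≈-x _) ⟩
        sum (λ k → φ (a j k) * e k) + - sum (λ k → φ (a j k) * e k)
          ≈⟨ -‿inverseʳ _ ⟩
        0# ∎
    ... | D , v , mon , p = monic→root D mon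
      (trans (sym (*-identityʳ v)) (trans (*-congˡ (sym e0)) p))

  module _ {n} (e : Fin n → Carrier) where
    Span : Carrier → Set (c₁ ⊔ ℓ₂)
    Span v = ∃ λ (a : Fin n → A.Carrier) → v ≈ sum (λ k → φ (a k) * e k)

    span-cong : ∀ {v w} → v ≈ w → Span v → Span w
    span-cong p (a , q) = a , trans (sym p) q

    span-0 : Span 0#
    span-0 = (λ _ → A.0#) , sym (Σ-0 n (λ k → φ A.0# * e k) (λ k → trans (*-congʳ 0#-homo) (zeroˡ _)))

    span-+ : ∀ {v w} → Span v → Span w → Span (v + w)
    span-+ {v} {w} (a , p) (b , q) = (λ k → a k A.+ b k) , (begin
      v + w                                                       ≈⟨ +-cong p q ⟩
      sum (λ k → φ (a k) * e k) + sum (λ k → φ (b k) * e k)       ≈⟨ Σ-+ n (λ k → φ (a k) * e k) (λ k → φ (b k) * e k) ⟨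
      sum (λ k → φ (a k) * e k + φ (b k) * e k)                   ≈⟨ Σ-cong n _ _ (λ k →
         trans (sym (distribʳ _ _ _)) (*-congʳ (sym (+-homo (a k) (b k))))) ⟩
      sum (λ k → φ (a k A.+ b k) * e k)                           ∎)

    span-scale : ∀ b {v} → Span v → Span (φ b * v)
    span-scale b {v} (a , p) = (λ k → b A.* a k) , (begin
      φ b * v                                  ≈⟨ *-congˡ p ⟩
      φ b * sum (λ k → φ (a k) * e k)          ≈⟨ Σ-*ˡ n (φ b) (λ k → φ (a k) * e k) ⟩
      sum (λ k → φ b * (φ (a k) * e k))        ≈⟨ Σ-cong n _ _ (λ k →
         trans (sym (*-assoc _ _ _)) (*-congʳ (sym (*-homo b (a k))))) ⟩
      sum (λ k → φ (b A.* a k) * e k)          ∎)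

    span-sum : ∀ {m} (f : Fin m → Carrier) → (∀ j → Span (f j)) → Span (sum f)
    span-sum {zero}  f p = span-0
    span-sum {suc m} f p = span-+ (p zero) (span-sum (f ∘ suc) (p ∘ suc))

  span-gen : ∀ {n} (e : Fin n → Carrier) j → Span e (e j)
  span-gen {suc n} e zero = (λ { zero → A.1# ; (suc _) → A.0# }) ,
    sym (trans (+-cong (trans (*-congʳ 1#-homo) (*-identityˡ _))
                       (Σ-0 n (λ k → φ A.0# * e (suc k)) (λ k → trans (*-congʳ 0#-homo) (zeroˡ _))))
               (+-identityʳ _))
  span-gen e (suc j) with span-gen (e ∘ suc) j
  ... | a , p = (λ { zero → A.0# ; (suc k) → a k }) ,
    trans p (sym (trans (+-congʳ (trans (*-congʳ 0#-homo) (zeroˡ _))) (+-identityˡ _)))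

  span-linear : ∀ {n} (e : Fin n → Carrier) s → (∀ t → Span e (s * e t)) → ∀ {v} → Span e v → Span e (s * v)
  span-linear {n} e s h {v} (a , p) = span-cong e
    (sym (trans (*-congˡ p) (trans (Σ-*ˡ n s (λ k → φ (a k) * e k))
      (Σ-cong n _ _ (λ k → solve 3 (λ s a e → s :* (a :* e) := a :* (s :* e)) refl s (φ (a k)) (e k))))))
    (span-sum e (λ k → φ (a k) * (s * e k)) (λ k → span-scale e (a k) (h k)))

  stable→root : ∀ {n} (e : Fin (suc n) → Carrier) → e zero ≈ 1# → ∀ s →
                (∀ t → Span e (s * e t)) → IsMonicRoot s
  stable→root e e0 s h = Degrees.eigenvalue s e e0 (λ j → proj₁ (h j)) (λ j → proj₂ (h j))

  root-power : ∀ {n} (a : Vector A.Carrier n) x → monicValue a x ≈ 0# →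
               x ^ n ≈ sum (λ j → φ (A.- a j) * x ^ toℕ j)
  root-power {n} a x p = begin
    x ^ n                                       ≈⟨ +-identityʳ _ ⟨
    x ^ n + 0#                                  ≈⟨ +-congˡ (-‿inverseʳ T) ⟨
    x ^ n + (T + - T)                           ≈⟨ +-assoc _ _ _ ⟨
    (x ^ n + T) + - T                           ≈⟨ +-congʳ p ⟩
    0# + - T                                    ≈⟨ +-identityˡ _ ⟩
    - T                                         ≈⟨ -1*x≈-x T ⟨
    - 1# * T                                    ≈⟨ Σ-*ˡ n (- 1#) (λ j → φ (a j) * x ^ toℕ j) ⟩
    sum (λ j → - 1# * (φ (a j) * x ^ toℕ j))    ≈⟨ Σ-cong n _ _ (λ j →
       trans (-1*x≈-x _) (trans (-‿distribˡ-* _ _) (*-congʳ (sym (-‿homo (a j)))))) ⟩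
    sum (λ j → φ (A.- a j) * x ^ toℕ j)         ∎
    where T = sum (λ j → φ (a j) * x ^ toℕ j)

  module Pair {m n} (a : Vector A.Carrier (suc m)) (b : Vector A.Carrier (suc n))
              (x y : Carrier) (p : monicValue a x ≈ 0#) (q : monicValue b y ≈ 0#) where

    e : Fin (suc m ℕ.* suc n) → Carrier
    e t = x ^ toℕ (proj₁ (remQuot {suc m} (suc n) t)) * y ^ toℕ (proj₂ (remQuot {suc m} (suc n) t))

    mono∈ : ∀ (i : Fin (suc m)) (j : Fin (suc n)) → Span e (x ^ toℕ i * y ^ toℕ j)
    mono∈ i j = span-cong e
      (reflexive (≡.cong (λ r → x ^ toℕ (proj₁ r) * y ^ toℕ (proj₂ r)) (remQuot-combine i j)))
      (span-gen e (combine i j))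

    below : ∀ {d} k → k ℕ.< suc d → ∃ λ (i : Fin (suc d)) → toℕ i ≡ k
    below k k<d = fromℕ< k<d , toℕ-fromℕ< k<d

    step-x : ∀ (i : Fin (suc m)) (j : Fin (suc n)) → Span e (x ^ suc (toℕ i) * y ^ toℕ j)
    step-x i j with ℕₚ.m≤n⇒m<n∨m≡n (toℕ<n i)
    ... | inj₁ lt with below _ lt
    ...   | i′ , eq = ≡.subst (λ k → Span e (x ^ k * y ^ toℕ j)) eq (mono∈ i′ j)
    step-x i j | inj₂ eq = ≡.subst (λ k → Span e (x ^ k * y ^ toℕ j)) (≡.sym eq)
      (span-cong e
        (sym (trans (*-congʳ (root-power a x p))
          (trans (Σ-*ʳ (suc m) (y ^ toℕ j) (λ k → φ (A.- a k) * x ^ toℕ k))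
            (Σ-cong (suc m) _ _ (λ k → *-assoc (φ (A.- a k)) (x ^ toℕ k) (y ^ toℕ j))))))
        (span-sum e (λ k → φ (A.- a k) * (x ^ toℕ k * y ^ toℕ j))
          (λ k → span-scale e (A.- a k) (mono∈ k j))))

    step-y : ∀ (i : Fin (suc m)) (j : Fin (suc n)) → Span e (x ^ toℕ i * y ^ suc (toℕ j))
    step-y i j with ℕₚ.m≤n⇒m<n∨m≡n (toℕ<n j)
    ... | inj₁ lt with below _ lt
    ...   | j′ , eq = ≡.subst (λ k → Span e (x ^ toℕ i * y ^ k)) eq (mono∈ i j′)
    step-y i j | inj₂ eq = ≡.subst (λ k → Span e (x ^ toℕ i * y ^ k)) (≡.sym eq)
      (span-cong e
        (sym (trans (*-congˡ (root-power b y q))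
          (trans (Σ-*ˡ (suc n) (x ^ toℕ i) (λ k → φ (A.- b k) * y ^ toℕ k))
            (Σ-cong (suc n) _ _ (λ k → solve 3 (λ u c v → u :* (c :* v) := c :* (u :* v)) refl
               (x ^ toℕ i) (φ (A.- b k)) (y ^ toℕ k))))))
        (span-sum e (λ k → φ (A.- b k) * (x ^ toℕ i * y ^ toℕ k))
          (λ k → span-scale e (A.- b k) (mono∈ i k))))

    x-stable : ∀ t → Span e (x * e t)
    x-stable t = span-cong e (*-assoc x _ _) (step-x (proj₁ (remQuot {suc m} (suc n) t)) (proj₂ (remQuot {suc m} (suc n) t)))

    y-stable : ∀ t → Span e (y * e t)
    y-stable t = span-cong e
      (solve 3 (λ u y v → u :* (y :* v) := y :* (u :* v)) refl _ y _)
      (step-y (proj₁ (remQuot {suc m} (suc n) t)) (proj₂ (remQuot {suc m} (suc n) t)))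

    e0 : e zero ≈ 1#
    e0 = *-identityˡ 1#

    +-root : IsMonicRoot (x + y)
    +-root = stable→root e e0 (x + y) (λ t →
      span-cong e (sym (distribʳ (e t) x y)) (span-+ e (x-stable t) (y-stable t)))

    *-root : IsMonicRoot (x * y)
    *-root = stable→root e e0 (x * y) (λ t →
      span-cong e (sym (*-assoc x y (e t))) (span-linear e x x-stable (y-stable t)))

  trivial-root : ∀ {x} (a : Vector A.Carrier 0) → monicValue a x ≈ 0# → ∀ y → IsMonicRoot y
  trivial-root a p y = 0 , a , p

  abstract
    monicRoot-+ : ∀ {x y} → IsMonicRoot x → IsMonicRoot y → IsMonicRoot (x + y)
    monicRoot-+ {x} {y} (zero  , a , p) _ = trivial-root {x} a p _
    monicRoot-+ {x} {y} (suc m , a , p) (zero  , b , q) = trivial-root {y} b q _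
    monicRoot-+ (suc m , a , p) (suc n , b , q) = Pair.+-root a b _ _ p q

    monicRoot-* : ∀ {x y} → IsMonicRoot x → IsMonicRoot y → IsMonicRoot (x * y)
    monicRoot-* {x} {y} (zero  , a , p) _ = trivial-root {x} a p _
    monicRoot-* {x} {y} (suc m , a , p) (zero  , b , q) = trivial-root {y} b q _
    monicRoot-* (suc m , a , p) (suc n , b , q) = Pair.*-root a b _ _ p q

    monicRoot-φ : ∀ a → IsMonicRoot (φ a)
    monicRoot-φ a = 1 , (λ _ → A.- a) , (begin
      φ a * 1# + (φ (A.- a) * 1# + 0#)   ≈⟨ +-cong (*-identityʳ _) (trans (+-identityʳ _) (*-identityʳ _)) ⟩
      φ a + φ (A.- a)                    ≈⟨ +-congˡ (-‿homo a) ⟩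
      φ a + - φ a                        ≈⟨ -‿inverseʳ _ ⟩
      0#                                 ∎)

    monicRoot-cong : ∀ {x y} → x ≈ y → IsMonicRoot x → IsMonicRoot y
    monicRoot-cong {x} {y} e (n , a , p) = n , a ,
      trans (sym (+-cong (Ex.^-congˡ n e) (Σ-cong n (λ j → φ (a j) * x ^ toℕ j) (λ j → φ (a j) * y ^ toℕ j)
        (λ j → *-congˡ (Ex.^-congˡ (toℕ j) e))))) p

    monicRoot-neg : ∀ {x} → IsMonicRoot x → IsMonicRoot (- x)
    monicRoot-neg {x} r = monicRoot-cong (Degrees.φ-1 x x) (monicRoot-* (monicRoot-φ (A.- A.1#)) r)

    monicRoot-unity : ∀ m {x} → x ^ suc m ≈ 1# → IsMonicRoot x
    monicRoot-unity m {x} p = suc m , (λ { zero → A.- A.1# ; (suc _) → A.0# }) , (begin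
      x ^ suc m + (φ (A.- A.1#) * 1# + sum (λ (j : Fin m) → φ A.0# * (x ^ toℕ (suc j))))
        ≈⟨ +-cong p (+-cong (Degrees.φ-1 x 1#)
             (Σ-0 m (λ j → φ A.0# * (x ^ toℕ (suc j))) (λ k → trans (*-congʳ 0#-homo) (zeroˡ _)))) ⟩
      1# + (- 1# + 0#)   ≈⟨ +-congˡ (+-identityʳ _) ⟩
      1# + - 1#          ≈⟨ -‿inverseʳ _ ⟩
      0#                 ∎)

module BuildRing {c ℓ} {A : Set c} (_≈_ : Rel A ℓ) (_+_ _*_ : Op₂ A) (-_ : Op₁ A) (0# 1# : A)
                 (isEquivalence : IsEquivalence _≈_) where
  open AlgDefs _≈_
  abstract
    isCommutativeRing :
      Congruent₂ _+_ → Congruent₂ _*_ → Congruent₁ -_ →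
      Associative _+_ → Commutative _+_ → LeftIdentity 0# _+_ → LeftInverse 0# -_ _+_ →
      Associative _*_ → Commutative _*_ → LeftIdentity 1# _*_ → _*_ DistributesOverˡ _+_ →
      IsCommutativeRing _≈_ _+_ _*_ -_ 0# 1#
    isCommutativeRing +-cong *-cong -‿cong +-assoc +-comm +-idˡ -‿invˡ *-assoc *-comm *-idˡ distˡ = record
      { isRing = record
        { +-isAbelianGroup = record
          { isGroup = record
            { isMonoid = record
              { isSemigroup = record
                { isMagma = record { isEquivalence = isEquivalence ; ∙-cong = +-cong }
                ; assoc = +-assoc }
              ; identity = C.comm∧idˡ⇒id +-comm +-idˡ }
            ; inverse = C.comm∧invˡ⇒inv +-comm -‿invˡ
            ; ⁻¹-cong = -‿cong }
          ; comm = +-comm }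
        ; *-cong = *-cong
        ; *-assoc = *-assoc
        ; *-identity = C.comm∧idˡ⇒id *-comm *-idˡ
        ; distrib = C.comm∧distrˡ⇒distr +-cong *-comm distˡ }
      ; *-comm = *-comm }
      where
      ≈-setoid : Setoid c ℓ
      ≈-setoid = record { isEquivalence = isEquivalence }
      module C = Consequences ≈-setoid

module Congruence (R : CommutativeRing c ℓ) where
  open CommutativeRing R hiding (zero)
  open Ops R

  infix 4 _≋_[mod_]
  record _≋_[mod_] (x y a : Carrier) : Set (c ⊔ ℓ) where
    constructor mod
    field divides : a ∣ (x - y)

module CongruenceLaws (R : CommutativeRing c ℓ) where
  open CommutativeRing R hiding (zero)
  open Congruence R
  open RingProps ring using (-‿distribˡ-*; -‿+-comm)
  open Solver commutativeSemiring using (solve; _:+_; _:*_; _:=_)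
  open SetoidReasoning setoid

  private
    intro : ∀ {a x y} k → x ≈ y + k * a → x ≋ y [mod a ]
    intro {a} {x} {y} k e = mod record { quotient = k ; equality = sym (begin
      x + - y            ≈⟨ +-congʳ e ⟩
      y + k * a + - y    ≈⟨ solve 3 (λ y z n → y :+ z :+ n := z :+ (y :+ n)) refl y (k * a) (- y) ⟩
      k * a + (y + - y)  ≈⟨ +-congˡ (-‿inverseʳ y) ⟩
      k * a + 0#         ≈⟨ +-identityʳ _ ⟩
      k * a              ∎) }

    elim : ∀ {a x y} → x ≋ y [mod a ] → ∃ λ k → x ≈ y + k * a
    elim {a} {x} {y} (mod d) = _∣ʳ_.quotient d , (begin
      x              ≈⟨ +-identityʳ x ⟨
      x + 0#         ≈⟨ +-congˡ (-‿inverseˡ y) ⟨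
      x + (- y + y)  ≈⟨ solve 3 (λ x n y → x :+ (n :+ y) := y :+ (x :+ n)) refl x (- y) y ⟩
      y + (x + - y)  ≈⟨ +-congˡ (sym (_∣ʳ_.equality d)) ⟩
      y + _∣ʳ_.quotient d * a ∎)
      where open RawMagmaOps *-rawMagma using (_∣ʳ_)

  ≈⇒≋ : ∀ {a x y} → x ≈ y → x ≋ y [mod a ]
  ≈⇒≋ {a} e = intro 0# (trans e (sym (trans (+-congˡ (zeroˡ a)) (+-identityʳ _))))

  ≋-sym : ∀ {a x y} → x ≋ y [mod a ] → y ≋ x [mod a ]
  ≋-sym {a} {x} {y} p with elim p
  ... | k , e = intro (- k) (sym (begin
    x + - k * a              ≈⟨ +-cong e (sym (-‿distribˡ-* k a)) ⟩
    y + k * a + - (k * a)    ≈⟨ +-assoc _ _ _ ⟩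
    y + (k * a + - (k * a))  ≈⟨ +-congˡ (-‿inverseʳ _) ⟩
    y + 0#                   ≈⟨ +-identityʳ y ⟩
    y                        ∎))

  ≋-trans : ∀ {a x y z} → x ≋ y [mod a ] → y ≋ z [mod a ] → x ≋ z [mod a ]
  ≋-trans {a} {z = z} p q with elim p | elim q
  ... | k , e | m , f = intro (m + k) (trans e (trans (+-congʳ f)
    (solve 4 (λ z m k a → z :+ m :* a :+ k :* a := z :+ (m :+ k) :* a) refl z m k a)))

  ≋-+ : ∀ {a x y u v} → x ≋ y [mod a ] → u ≋ v [mod a ] → (x + u) ≋ (y + v) [mod a ]
  ≋-+ {a} {y = y} {v = v} p q with elim p | elim q
  ... | k , e | m , f = intro (k + m) (trans (+-cong e f)
    (solve 5 (λ y k v m a → (y :+ k :* a) :+ (v :+ m :* a) := y :+ v :+ (k :+ m) :* a) refl y k v m a))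

  ≋-* : ∀ {a x y u v} → x ≋ y [mod a ] → u ≋ v [mod a ] → (x * u) ≋ (y * v) [mod a ]
  ≋-* {a} {y = y} {v = v} p q with elim p | elim q
  ... | k , e | m , f = intro (y * m + k * (v + m * a)) (trans (*-cong e f)
    (solve 5 (λ y k v m a → (y :+ k :* a) :* (v :+ m :* a) :=
        y :* v :+ (y :* m :+ k :* (v :+ m :* a)) :* a) refl y k v m a))

  ≋-neg : ∀ {a x y} → x ≋ y [mod a ] → (- x) ≋ (- y) [mod a ]
  ≋-neg {a} {x} {y} p with elim p
  ... | k , e = intro (- k) (trans (-‿cong e) (trans (sym (-‿+-comm y (k * a)))
    (+-congˡ (-‿distribˡ-* k a))))

Quotient : (R : CommutativeRing c ℓ) → CommutativeRing.Carrier R → CommutativeRing c (c ⊔ ℓ)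
Quotient R a = record
  { _≈_ = _≋_[mod a ] ; _+_ = _+_ ; _*_ = _*_ ; -_ = -_ ; 0# = 0# ; 1# = 1#
  ; isCommutativeRing = BuildRing.isCommutativeRing _≋_[mod a ] _+_ _*_ -_ 0# 1#
      (record { refl = L.≈⇒≋ refl ; sym = L.≋-sym ; trans = L.≋-trans })
      L.≋-+ L.≋-* L.≋-neg
      (λ x y z → L.≈⇒≋ (+-assoc x y z)) (λ x y → L.≈⇒≋ (+-comm x y))
      (λ x → L.≈⇒≋ (+-identityˡ x)) (λ x → L.≈⇒≋ (-‿inverseˡ x))
      (λ x y z → L.≈⇒≋ (*-assoc x y z)) (λ x y → L.≈⇒≋ (*-comm x y))
      (λ x → L.≈⇒≋ (*-identityˡ x)) (λ x y z → L.≈⇒≋ (distribˡ x y z)) }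
  where
  open CommutativeRing R
  open Congruence R
  module L = CongruenceLaws R

module Polynomials (R : CommutativeRing c ℓ) where
  open CommutativeRing R hiding (zero)
  open Ops R

  -- A list of terms c·T₁^α₁⋯T_N^α_N; exponents may repeat, so the polynomial
  -- denoted by a list is determined by `coeff`, not by the list itself.
  Poly : ℕ → Set c
  Poly N = List (Carrier × Vec ℕ N)

  coeff : ∀ {N} → Poly N → Vec ℕ N → Carrier
  coeff []            β = 0#
  coeff ((a , α) ∷ f) β = (if ⌊ Vecₚ.≡-dec ℕₚ._≟_ α β ⌋ then a else 0#) + coeff f β

  oneₚ : ∀ {N} → Poly N
  oneₚ = (1# , Vec.replicate _ 0) ∷ []

  infixl 7 _*ₚ_
  _*ₚ_ : ∀ {N} → Poly N → Poly N → Poly N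
  f *ₚ g = List.cartesianProductWith (λ s t → proj₁ s * proj₁ t , Vec.zipWith ℕ._+_ (proj₂ s) (proj₂ t)) f g

  infixr 8 _^ₚ_
  _^ₚ_ : ∀ {N} → Poly N → ℕ → Poly N
  f ^ₚ zero  = oneₚ
  f ^ₚ suc m = f *ₚ f ^ₚ m

  -- g(T₁ⁿ, …, T_Nⁿ).
  quasiPower : ∀ {N} → Poly N → ℕ → Poly N
  quasiPower f n = List.map (map₂ (Vec.map (n ℕ.*_))) f

  -- g · g^{(q)} ⋯ g^{(q^{i-1})}.
  quasiNorm : ∀ {N} (q i : ℕ) → Poly N → Poly N
  quasiNorm q i g = List.foldr (λ j h → quasiPower g (q ℕ.^ j) *ₚ h) oneₚ (List.upTo i)

  monomial : ∀ {N} → Vec ℕ N → Vec Carrier N → Carrier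
  monomial []      []      = 1#
  monomial (a ∷ α) (z ∷ zs) = z ^ a * monomial α zs

  eval : ∀ {N} → Poly N → Vec Carrier N → Carrier
  eval []            z = 0#
  eval ((a , α) ∷ f) z = a * monomial α z + eval f z

mapCoeffs : ∀ {A : Set c₁} {B : Set c₂} {N : ℕ} → (A → B) → List (A × Vec ℕ N) → List (B × Vec ℕ N)
mapCoeffs φ = List.map (map₁ φ)

module _ (R : CommutativeRing c ℓ) where
  open CommutativeRing R
  open Ops R

  IsUnit IsUnitSquare IsUnitNonsquare : Carrier → Set (c ⊔ ℓ)
  IsUnit x          = x ∣ 1#
  IsUnitSquare x    = ∃ λ y → IsUnit y × (y * y ≈ x)
  IsUnitNonsquare x = IsUnit x × ¬ IsUnitSquare x

Matrix : ℕ → Set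
Matrix l = Fin l → Fin l → ℚ

-- x(x-1)⋯(x-k+1)/k! for an arbitrary integer x.
binomial : ℤ → ℕ → ℚ
binomial x zero    = ℚ.1ℚ
binomial x (suc k) = binomial x k ℚ.* ((x ℤ.- + k) ℚ./ suc k)

P : ℤ → (l : ℕ) → Matrix l
P b l j k = binomial (b ℤ.+ + (2 ℕ.* toℕ j)) (toℕ k)

identity : ∀ {l} → Matrix l
identity j k = if ⌊ j ≟ k ⌋ then ℚ.1ℚ else ℚ.0ℚ

infixl 7 _⊗_
_⊗_ : ∀ {l} → Matrix l → Matrix l → Matrix l
(M ⊗ M′) j k = Ops.sum ℚₚᵣ.+-*-commutativeRing (λ m → M j m ℚ.* M′ m k)

IsInverse : ∀ {l} → Matrix l → Matrix l → Set
IsInverse M M′ = (∀ j k → (M ⊗ M′) j k ≡ identity j k) × (∀ j k → (M′ ⊗ M) j k ≡ identity j k)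

firstRow : ∀ {l} → 1 ℕ.≤ l → Matrix l → Fin l → ℚ
firstRow {suc l} _ M k = M zero k

-- Localisation of a ring at the (cancellable) images of the positive integers.
module Fractions (A : CommutativeRing c ℓ) (⟦_⟧ : ℕ → CommutativeRing.Carrier A)
                 (one-homo : CommutativeRing._≈_ A ⟦ 1 ⟧ (CommutativeRing.1# A))
                 (den-homo : ∀ m n → CommutativeRing._≈_ A ⟦ m ℕ.* n ⟧ (CommutativeRing._*_ A ⟦ m ⟧ ⟦ n ⟧))
                 (cancel : ∀ d .{{_ : ℕ.NonZero d}} {x y} →
                   CommutativeRing._≈_ A (CommutativeRing._*_ A x ⟦ d ⟧) (CommutativeRing._*_ A y ⟦ d ⟧) →
                   CommutativeRing._≈_ A x y) where
  private module Z = CommutativeRing A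

  record Frac : Set c where
    constructor _/1+_
    field
      num   : Z.Carrier
      den-1 : ℕ
    den : ℕ
    den = suc den-1
  open Frac public

  infix 4 _≈ᶠ_
  record _≈ᶠ_ (x y : Frac) : Set ℓ where
    constructor cross
    field eq : num x Z.* ⟦ den y ⟧ Z.≈ num y Z.* ⟦ den x ⟧

  private
    open Solver Z.commutativeSemiring using (solve; _:+_; _:*_; _:=_)
    open SetoidReasoning Z.setoid

    δ : Frac → Z.Carrier
    δ x = ⟦ den x ⟧

    infixl 7 _⊛_
    infixl 6 _⊕_
    _⊕_ _⊛_ : Frac → Frac → Frac
    x ⊕ y = (num x Z.* δ y Z.+ num y Z.* δ x) /1+ ℕ.pred (den x ℕ.* den y)
    x ⊛ y = (num x Z.* num y) /1+ ℕ.pred (den x ℕ.* den y)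
    ⊝_ : Frac → Frac
    ⊝ x = (Z.- num x) /1+ den-1 x

    0ᶠ 1ᶠ : Frac
    0ᶠ = Z.0# /1+ 0
    1ᶠ = Z.1# /1+ 0

    δ-⊛ : ∀ x y → δ (x ⊛ y) Z.≈ δ x Z.* δ y
    δ-⊛ x y = den-homo (den x) (den y)

    equal : ∀ x y {a b} → δ x Z.≈ a → δ y Z.≈ b → num x Z.* b Z.≈ num y Z.* a → x ≈ᶠ y
    equal x y p q h = cross (Z.trans (Z.*-congˡ q) (Z.trans h (Z.*-congˡ (Z.sym p))))

    trans′ : ∀ {x y z} → x ≈ᶠ y → y ≈ᶠ z → x ≈ᶠ z
    trans′ {x} {y} {z} (cross e) (cross f) = cross (cancel (den y) (begin
      num x Z.* δ z Z.* δ y   ≈⟨ swap (num x) (δ z) (δ y) ⟩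
      num x Z.* δ y Z.* δ z   ≈⟨ Z.*-congʳ e ⟩
      num y Z.* δ x Z.* δ z   ≈⟨ swap (num y) (δ x) (δ z) ⟩
      num y Z.* δ z Z.* δ x   ≈⟨ Z.*-congʳ f ⟩
      num z Z.* δ y Z.* δ x   ≈⟨ swap (num z) (δ y) (δ x) ⟩
      num z Z.* δ x Z.* δ y   ∎))
      where
      swap : ∀ a b c → a Z.* b Z.* c Z.≈ a Z.* c Z.* b
      swap = solve 3 (λ a b c → a :* b :* c := a :* c :* b) Z.refl

  ring : CommutativeRing c ℓ
  ring = record
    { Carrier = Frac ; _≈_ = _≈ᶠ_ ; _+_ = _⊕_ ; _*_ = _⊛_ ; -_ = ⊝_ ; 0# = 0ᶠ ; 1# = 1ᶠ
    ; isCommutativeRing = BuildRing.isCommutativeRing _≈ᶠ_ _⊕_ _⊛_ ⊝_ 0ᶠ 1ᶠ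
        (record { refl = cross Z.refl ; sym = λ { (cross e) → cross (Z.sym e) } ; trans = trans′ })
        (λ {x} {y} {u} {v} (cross e) (cross f) → equal (x ⊕ u) (y ⊕ v) (δ-⊛ x u) (δ-⊛ y v) (begin
          (num x Z.* δ u Z.+ num u Z.* δ x) Z.* (δ y Z.* δ v)
            ≈⟨ solve 6 (λ nx dx dy nu du dv → (nx :* du :+ nu :* dx) :* (dy :* dv) :=
                 (nx :* dy) :* (du :* dv) :+ (nu :* dv) :* (dx :* dy)) Z.refl
                 (num x) (δ x) (δ y) (num u) (δ u) (δ v) ⟩
          (num x Z.* δ y) Z.* (δ u Z.* δ v) Z.+ (num u Z.* δ v) Z.* (δ x Z.* δ y)
            ≈⟨ Z.+-cong (Z.*-congʳ e) (Z.*-congʳ f) ⟩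
          (num y Z.* δ x) Z.* (δ u Z.* δ v) Z.+ (num v Z.* δ u) Z.* (δ x Z.* δ y)
            ≈⟨ solve 6 (λ ny dx dy nv du dv → (ny :* dx) :* (du :* dv) :+ (nv :* du) :* (dx :* dy) :=
                 (ny :* dv :+ nv :* dy) :* (dx :* du)) Z.refl
                 (num y) (δ x) (δ y) (num v) (δ u) (δ v) ⟩
          (num y Z.* δ v Z.+ num v Z.* δ y) Z.* (δ x Z.* δ u) ∎))
        (λ {x} {y} {u} {v} (cross e) (cross f) → equal (x ⊛ u) (y ⊛ v) (δ-⊛ x u) (δ-⊛ y v) (begin
          (num x Z.* num u) Z.* (δ y Z.* δ v)   ≈⟨ interchange (num x) (num u) (δ y) (δ v) ⟩
          (num x Z.* δ y) Z.* (num u Z.* δ v)   ≈⟨ Z.*-cong e f ⟩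
          (num y Z.* δ x) Z.* (num v Z.* δ u)   ≈⟨ interchange (num y) (δ x) (num v) (δ u) ⟩
          (num y Z.* num v) Z.* (δ x Z.* δ u)   ∎))
        (λ {x} {y} (cross e) → cross (begin
          (Z.- num x) Z.* δ y     ≈⟨ ZP.-‿distribˡ-* (num x) (δ y) ⟨
          Z.- (num x Z.* δ y)     ≈⟨ Z.-‿cong e ⟩
          Z.- (num y Z.* δ x)     ≈⟨ ZP.-‿distribˡ-* (num y) (δ x) ⟩
          (Z.- num y) Z.* δ x     ∎))
        (λ x y z → equal ((x ⊕ y) ⊕ z) (x ⊕ (y ⊕ z))
          (Z.trans (δ-⊛ (x ⊛ y) z) (Z.*-congʳ (δ-⊛ x y)))
          (Z.trans (δ-⊛ x (y ⊛ z)) (Z.*-congˡ (δ-⊛ y z)))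
          (Z.*-cong
            (Z.trans (Z.+-congˡ (Z.*-congˡ (δ-⊛ x y)))
            (Z.trans (solve 6 (λ nx dx ny dy nz dz →
                (nx :* dy :+ ny :* dx) :* dz :+ nz :* (dx :* dy) :=
                nx :* (dy :* dz) :+ (ny :* dz :+ nz :* dy) :* dx) Z.refl
                (num x) (δ x) (num y) (δ y) (num z) (δ z))
              (Z.+-congʳ (Z.*-congˡ (Z.sym (δ-⊛ y z))))))
            (Z.sym (Z.*-assoc (δ x) (δ y) (δ z)))))
        (λ x y → equal (x ⊕ y) (y ⊕ x) (δ-⊛ x y) (δ-⊛ y x)
          (Z.*-cong (Z.+-comm _ _) (Z.*-comm (δ y) (δ x))))
        (λ x → equal (0ᶠ ⊕ x) x (Z.trans (δ-⊛ 0ᶠ x) (Z.trans (Z.*-congʳ one-homo) (Z.*-identityˡ (δ x)))) Z.refl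
          (Z.*-congʳ (Z.trans (Z.+-cong (Z.zeroˡ (δ x)) (Z.trans (Z.*-congˡ one-homo) (Z.*-identityʳ (num x)))) (Z.+-identityˡ (num x)))))
        (λ x → equal ((⊝ x) ⊕ x) 0ᶠ Z.refl one-homo (begin
          ((Z.- num x) Z.* δ x Z.+ num x Z.* δ x) Z.* Z.1#
            ≈⟨ Z.*-identityʳ _ ⟩
          (Z.- num x) Z.* δ x Z.+ num x Z.* δ x
            ≈⟨ Z.distribʳ (δ x) (Z.- num x) (num x) ⟨
          (Z.- num x Z.+ num x) Z.* δ x
            ≈⟨ Z.trans (Z.*-congʳ (Z.-‿inverseˡ (num x))) (Z.zeroˡ (δ x)) ⟩
          Z.0#
            ≈⟨ Z.zeroˡ (δ ((⊝ x) ⊕ x)) ⟨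
          Z.0# Z.* δ ((⊝ x) ⊕ x) ∎))
        (λ x y z → equal ((x ⊛ y) ⊛ z) (x ⊛ (y ⊛ z))
          (Z.trans (δ-⊛ (x ⊛ y) z) (Z.*-congʳ (δ-⊛ x y)))
          (Z.trans (δ-⊛ x (y ⊛ z)) (Z.*-congˡ (δ-⊛ y z)))
          (Z.*-cong (Z.*-assoc (num x) (num y) (num z)) (Z.sym (Z.*-assoc (δ x) (δ y) (δ z)))))
        (λ x y → equal (x ⊛ y) (y ⊛ x) (δ-⊛ x y) (δ-⊛ y x)
          (Z.*-cong (Z.*-comm (num x) (num y)) (Z.*-comm (δ y) (δ x))))
        (λ x → equal (1ᶠ ⊛ x) x (Z.trans (δ-⊛ 1ᶠ x) (Z.trans (Z.*-congʳ one-homo) (Z.*-identityˡ (δ x)))) Z.refl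
          (Z.*-congʳ (Z.*-identityˡ (num x))))
        (λ x y z → equal (x ⊛ (y ⊕ z)) ((x ⊛ y) ⊕ (x ⊛ z))
          (Z.trans (δ-⊛ x (y ⊛ z)) (Z.*-congˡ (δ-⊛ y z)))
          (Z.trans (δ-⊛ (x ⊛ y) (x ⊛ z)) (Z.*-cong (δ-⊛ x y) (δ-⊛ x z)))
          (Z.trans
            (solve 6 (λ nx dx ny dy nz dz →
                (nx :* (ny :* dz :+ nz :* dy)) :* ((dx :* dy) :* (dx :* dz)) :=
                ((nx :* ny) :* (dx :* dz) :+ (nx :* nz) :* (dx :* dy)) :* (dx :* (dy :* dz))) Z.refl
                (num x) (δ x) (num y) (δ y) (num z) (δ z))
            (Z.*-congʳ (Z.+-cong (Z.*-congˡ (Z.sym (δ-⊛ x z))) (Z.*-congˡ (Z.sym (δ-⊛ x y))))))) }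
    where
    module ZP = RingProps Z.ring
    interchange : ∀ a b c d → (a Z.* b) Z.* (c Z.* d) Z.≈ (a Z.* c) Z.* (b Z.* d)
    interchange = solve 4 (λ a b c d → (a :* b) :* (c :* d) := (a :* c) :* (b :* d)) Z.refl

  fraction : RingHom A ring
  fraction = (_/1+ 0) , record
    { isSemiringHomomorphism = record
      { isNearSemiringHomomorphism = record
        { +-isMonoidHomomorphism = record
          { isMagmaHomomorphism = record
            { isRelHomomorphism = record { cong = λ e → cross (Z.*-congʳ e) }
            ; homo = λ x y → cross (Z.*-congʳ (Z.sym (Z.+-cong (unit x) (unit y)))) }
          ; ε-homo = cross Z.refl }
        ; *-homo = λ x y → cross Z.refl }
      ; 1#-homo = cross Z.refl }
    ; -‿homo = λ x → cross Z.refl }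

    where
    unit : ∀ x → x Z.* ⟦ 1 ⟧ Z.≈ x
    unit x = Z.trans (Z.*-congˡ one-homo) (Z.*-identityʳ x)

module PAdic (p : ℕ) (p-prime : Prime p) where

  -- The inverse limit of the ℤ/pⁿ: seq n is an integer representative mod pⁿ.
  record ℤₚ : Set where
    constructor mkℤₚ
    field
      seq      : ℕ → ℤ
      coherent : ∀ n → + (p ℕ.^ n) ℤ∣.∣ seq (suc n) ℤ.- seq n
  open ℤₚ public

  infix 4 _≈ₚ_
  record _≈ₚ_ (x y : ℤₚ) : Set where
    constructor mk≈ₚ
    field at : ∀ n → + (p ℕ.^ n) ℤ∣.∣ seq x n ℤ.- seq y n
  open _≈ₚ_ public

  private
    cast : ∀ {d x y} → x ≡ y → d ℤ∣.∣ x → d ℤ∣.∣ y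
    cast ≡.refl h = h

    zero-diff : ∀ {d x y} → x ≡ y → d ℤ∣.∣ x ℤ.- y
    zero-diff {x = x} ≡.refl = cast (≡.sym (ℤₚᵣ.+-inverseʳ x)) (ℤ∣.divides (+ 0) ≡.refl)

    +-diff : ∀ {d} x x′ y y′ → d ℤ∣.∣ x ℤ.- x′ → d ℤ∣.∣ y ℤ.- y′ → d ℤ∣.∣ (x ℤ.+ y) ℤ.- (x′ ℤ.+ y′)
    +-diff x x′ y y′ h k = cast (lemma x x′ y y′) (ℤ∣.∣m∣n⇒∣m+n h k)
      where lemma : ∀ x x′ y y′ → (x ℤ.- x′) ℤ.+ (y ℤ.- y′) ≡ (x ℤ.+ y) ℤ.- (x′ ℤ.+ y′)
            lemma = ℤSolver.solve-∀

    *-diff : ∀ {d} x x′ y y′ → d ℤ∣.∣ x ℤ.- x′ → d ℤ∣.∣ y ℤ.- y′ → d ℤ∣.∣ (x ℤ.* y) ℤ.- (x′ ℤ.* y′)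
    *-diff x x′ y y′ h k = cast (lemma x x′ y y′) (ℤ∣.∣m∣n⇒∣m+n (ℤ∣.∣n⇒∣m*n x k) (ℤ∣.∣m⇒∣m*n y′ h))
      where lemma : ∀ x x′ y y′ → x ℤ.* (y ℤ.- y′) ℤ.+ (x ℤ.- x′) ℤ.* y′ ≡ (x ℤ.* y) ℤ.- (x′ ℤ.* y′)
            lemma = ℤSolver.solve-∀

    neg-diff : ∀ {d} x x′ → d ℤ∣.∣ x ℤ.- x′ → d ℤ∣.∣ (ℤ.- x) ℤ.- (ℤ.- x′)
    neg-diff x x′ h = cast (lemma x x′) (ℤ∣.∣m⇒∣-m h)
      where lemma : ∀ x x′ → ℤ.- (x ℤ.- x′) ≡ (ℤ.- x) ℤ.- (ℤ.- x′)
            lemma = ℤSolver.solve-∀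

    sym-diff : ∀ {d} x y → d ℤ∣.∣ x ℤ.- y → d ℤ∣.∣ y ℤ.- x
    sym-diff x y h = cast (lemma x y) (ℤ∣.∣m⇒∣-m h)
      where lemma : ∀ x y → ℤ.- (x ℤ.- y) ≡ y ℤ.- x
            lemma = ℤSolver.solve-∀

    trans-diff : ∀ {d} x y z → d ℤ∣.∣ x ℤ.- y → d ℤ∣.∣ y ℤ.- z → d ℤ∣.∣ x ℤ.- z
    trans-diff x y z h k = cast (lemma x y z) (ℤ∣.∣m∣n⇒∣m+n h k)
      where lemma : ∀ x y z → (x ℤ.- y) ℤ.+ (y ℤ.- z) ≡ x ℤ.- z
            lemma = ℤSolver.solve-∀

  fromℤ : ℤ → ℤₚ
  fromℤ x = mkℤₚ (λ _ → x) (λ _ → zero-diff {x = x} ≡.refl)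

  ℤₚ-ring : CommutativeRing 0ℓ 0ℓ
  ℤₚ-ring = record
    { Carrier = ℤₚ ; _≈_ = _≈ₚ_ ; _+_ = add ; _*_ = mul ; -_ = neg ; 0# = fromℤ (+ 0) ; 1# = fromℤ (+ 1)
    ; isCommutativeRing = BuildRing.isCommutativeRing _≈ₚ_ add mul neg (fromℤ (+ 0)) (fromℤ (+ 1))
        (record
          { refl  = pointwise (λ _ → ≡.refl)
          ; sym   = λ {x} {y} e → mk≈ₚ λ n → sym-diff (seq x n) (seq y n) (at e n)
          ; trans = λ {x} {y} {z} e f → mk≈ₚ λ n → trans-diff (seq x n) (seq y n) (seq z n) (at e n) (at f n) })
        (λ {x} {y} {u} {v} e f → mk≈ₚ λ n → +-diff (seq x n) (seq y n) (seq u n) (seq v n) (at e n) (at f n))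
        (λ {x} {y} {u} {v} e f → mk≈ₚ λ n → *-diff (seq x n) (seq y n) (seq u n) (seq v n) (at e n) (at f n))
        (λ {x} {y} e → mk≈ₚ λ n → neg-diff (seq x n) (seq y n) (at e n))
        (λ x y z → pointwise (λ n → ℤₚᵣ.+-assoc (seq x n) (seq y n) (seq z n)))
        (λ x y → pointwise (λ n → ℤₚᵣ.+-comm (seq x n) (seq y n)))
        (λ x → pointwise (λ n → ℤₚᵣ.+-identityˡ (seq x n)))
        (λ x → pointwise (λ n → ℤₚᵣ.+-inverseˡ (seq x n)))
        (λ x y z → pointwise (λ n → ℤₚᵣ.*-assoc (seq x n) (seq y n) (seq z n)))
        (λ x y → pointwise (λ n → ℤₚᵣ.*-comm (seq x n) (seq y n)))
        (λ x → pointwise (λ n → ℤₚᵣ.*-identityˡ (seq x n)))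
        (λ x y z → pointwise (λ n → ℤₚᵣ.*-distribˡ-+ (seq x n) (seq y n) (seq z n))) }
    where
    pointwise : ∀ {x y} → (∀ n → seq x n ≡ seq y n) → x ≈ₚ y
    pointwise e = mk≈ₚ λ n → zero-diff (e n)
    add mul : ℤₚ → ℤₚ → ℤₚ
    add x y = mkℤₚ (λ n → seq x n ℤ.+ seq y n)
      (λ n → +-diff (seq x (suc n)) (seq x n) (seq y (suc n)) (seq y n) (coherent x n) (coherent y n))
    mul x y = mkℤₚ (λ n → seq x n ℤ.* seq y n)
      (λ n → *-diff (seq x (suc n)) (seq x n) (seq y (suc n)) (seq y n) (coherent x n) (coherent y n))
    neg : ℤₚ → ℤₚ
    neg x = mkℤₚ (λ n → ℤ.- seq x n) (λ n → neg-diff (seq x (suc n)) (seq x n) (coherent x n))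

  private
    module Z = CommutativeRing ℤₚ-ring

    1<p : 1 ℕ.< p
    1<p = ℕ.nonTrivial⇒n>1 p {{prime⇒nonTrivial p-prime}}

    instance
      p≢0 : ℕ.NonZero p
      p≢0 = ℕ.>-nonZero (ℕₚ.<-trans (ℕ.s≤s ℕ.z≤n) 1<p)

    coprime-cancel : ∀ k d z → ¬ (p ℕ∣.∣ d) → p ℕ.^ k ℕ∣.∣ d ℕ.* z → p ℕ.^ k ℕ∣.∣ z
    coprime-cancel zero    d z p∤d h = ℕ∣.1∣ z
    coprime-cancel (suc k) d z p∤d h
      with coprime-cancel k d z p∤d (ℕ∣.∣-trans (ℕ∣.n∣m*n p) h)
    ... | ℕ∣.divides w ≡.refl
      with euclidsLemma d w p-prime (ℕ∣.*-cancelʳ-∣ (p ℕ.^ k) {{ℕₚ.m^n≢0 p k}}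
             (≡.subst (p ℕ.* p ℕ.^ k ℕ∣.∣_) (≡.sym (ℕₚ.*-assoc d w (p ℕ.^ k))) h))
    ... | inj₁ p∣d = contradiction p∣d p∤d
    ... | inj₂ p∣w = ℕ∣.*-monoˡ-∣ (p ℕ.^ k) p∣w

    strip : ∀ e n d z .{{_ : ℕ.NonZero d}} → d ℕ.< p ℕ.^ e → p ℕ.^ (e ℕ.+ n) ℕ∣.∣ d ℕ.* z → p ℕ.^ n ℕ∣.∣ z
    strip zero    n (suc d) z (ℕ.s≤s ()) h
    strip (suc e) n d z d< h with p ℕ∣.∣? d
    ... | no  p∤d = ℕ∣.∣-trans
      (≡.subst (p ℕ.^ n ℕ∣.∣_) (≡.sym (ℕₚ.^-distribˡ-+-* p (suc e) n)) (ℕ∣.n∣m*n (p ℕ.^ suc e)))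
      (coprime-cancel (suc e ℕ.+ n) d z p∤d h)
    ... | yes (ℕ∣.divides zero ≡.refl) = contradiction ≡.refl (ℕ.≢-nonZero⁻¹ 0)
    ... | yes (ℕ∣.divides d′@(suc _) ≡.refl) = strip e n d′ z
      (ℕₚ.*-cancelˡ-< p d′ (p ℕ.^ e) (≡.subst (ℕ._< p ℕ.^ suc e) (ℕₚ.*-comm d′ p) d<))
      (ℕ∣.*-cancelˡ-∣ p (≡.subst (p ℕ.* p ℕ.^ (e ℕ.+ n) ℕ∣.∣_)
        (≡.trans (≡.cong (ℕ._* z) (ℕₚ.*-comm d′ p)) (ℕₚ.*-assoc p d′ z)) h))

    n<p^n : ∀ n → n ℕ.< p ℕ.^ n
    n<p^n zero    = ℕ.s≤s ℕ.z≤n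
    n<p^n (suc n) = ℕₚ.≤-trans (ℕ.s≤s (n<p^n n)) (ℕₚ.^-monoʳ-< p 1<p (ℕₚ.n<1+n n))

    coherent+ : ∀ x e n → + (p ℕ.^ n) ℤ∣.∣ seq x (e ℕ.+ n) ℤ.- seq x n
    coherent+ x zero    n = zero-diff {x = seq x n} ≡.refl
    coherent+ x (suc e) n = trans-diff (seq x (suc (e ℕ.+ n))) (seq x (e ℕ.+ n)) (seq x n)
      (ℤ∣.∣-trans (ℤ∣.∣ᵤ⇒∣ (≡.subst (p ℕ.^ n ℕ∣.∣_) (≡.sym (ℕₚ.^-distribˡ-+-* p e n)) (ℕ∣.n∣m*n (p ℕ.^ e))))
                  (coherent x (e ℕ.+ n)))
      (coherent+ x e n)

    cancel : ∀ d .{{_ : ℕ.NonZero d}} {x y} → x Z.* fromℤ (+ d) ≈ₚ y Z.* fromℤ (+ d) → x ≈ₚ y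
    cancel d {x} {y} h = mk≈ₚ λ n →
      let m = d ℕ.+ n
          xm = seq x m
          ym = seq y m
          step : + (p ℕ.^ n) ℤ∣.∣ xm ℤ.- ym
          step = ℤ∣.∣ᵤ⇒∣ (strip d n d ℤ.∣ xm ℤ.- ym ∣ (n<p^n d)
            (≡.subst (p ℕ.^ m ℕ∣.∣_) (ℤₚᵣ.abs-* (+ d) (xm ℤ.- ym))
              (ℤ∣.∣⇒∣ᵤ (cast (lemma xm ym (+ d)) (at h m)))))
      in trans-diff (seq x n) xm (seq y n) (sym-diff xm (seq x n) (coherent+ x d n))
           (trans-diff xm ym (seq y n) step (coherent+ y d n))
      where lemma : ∀ x y d → x ℤ.* d ℤ.- y ℤ.* d ≡ d ℤ.* (x ℤ.- y)
            lemma = ℤSolver.solve-∀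

    den-homo : ∀ m n → fromℤ (+ (m ℕ.* n)) ≈ₚ fromℤ (+ m) Z.* fromℤ (+ n)
    den-homo m n = mk≈ₚ λ _ → zero-diff (ℤₚᵣ.pos-* m n)

  -- Every nonzero p-adic integer divides a positive integer, so inverting the
  -- positive integers already gives the fraction field of ℤₚ.
  ℚₚ-ring : CommutativeRing 0ℓ 0ℓ
  ℚₚ-ring = Fractions.ring ℤₚ-ring (λ d → fromℤ (+ d)) Z.refl den-homo cancel

  ℤₚ→ℚₚ : RingHom ℤₚ-ring ℚₚ-ring
  ℤₚ→ℚₚ = Fractions.fraction ℤₚ-ring (λ d → fromℤ (+ d)) Z.refl den-homo cancel

  ℚ→ℚₚ : ℚ → CommutativeRing.Carrier ℚₚ-ring
  ℚ→ℚₚ x = fromℤ (ℚ.numerator x) Fractions./1+ ℚ.denominator-1 x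

-- Classically a Heyting field is a field, with _#_ as _≉_. K is meant to be a
-- field, so integral over K is the same as algebraic over K.
record AlgebraicClosure (K : CommutativeRing c₁ ℓ₁) c ℓ ℓ′ : Set (c₁ ⊔ ℓ₁ ⊔ lsuc (c ⊔ ℓ ⊔ ℓ′)) where
  field
    heytingField : HeytingField c ℓ ℓ′
  commutativeRing : CommutativeRing c ℓ
  commutativeRing = HeytingCommutativeRing.commutativeRing (HeytingField.heytingCommutativeRing heytingField)
  open CommutativeRing commutativeRing using (Carrier; _≈_; 0#)
  field
    embedding           : RingHom K commutativeRing
    algebraic           : ∀ x → MonicRoots.IsMonicRoot K commutativeRing (proj₁ embedding) x
    algebraicallyClosed : ∀ {n} (a : Vector Carrier (suc n)) →
      ∃ λ x → MonicRoots.monicValue commutativeRing commutativeRing id a x ≈ 0#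

compose : {A : CommutativeRing c₁ ℓ₁} {B : CommutativeRing c₂ ℓ₂} {C : CommutativeRing c₃ ℓ₃} →
          RingHom A B → RingHom B C → RingHom A C
compose {C = C} (φ , φ-hom) (ψ , ψ-hom) =
  ψ ∘ φ , Composition.isRingHomomorphism (CommutativeRing.trans C) φ-hom ψ-hom

module RingOfIntegers (A : CommutativeRing c₁ ℓ₁) (K : CommutativeRing c₂ ℓ₂) (L : CommutativeRing c ℓ)
                      (A→K : RingHom A K) (K→L : RingHom K L) where
  private
    A→L : RingHom A L
    A→L = compose {A = A} {K} {L} A→K K→L
    module A = CommutativeRing A
    module K = CommutativeRing K
  open CommutativeRing L hiding (zero)
  open MonicRoots A L (proj₁ A→L) using () renaming (IsMonicRoot to IsIntegral) public
  open IsRingHomomorphism (proj₂ K→L)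

  -- The subfield K(S) of the field L.
  data Adjoin {s} (S : Carrier → Set s) : Carrier → Set (c ⊔ ℓ ⊔ c₂ ⊔ s) where
    base : ∀ a → Adjoin S (proj₁ K→L a)
    gen  : ∀ {x} → S x → Adjoin S x
    add  : ∀ {x y} → Adjoin S x → Adjoin S y → Adjoin S (x + y)
    mul  : ∀ {x y} → Adjoin S x → Adjoin S y → Adjoin S (x * y)
    inv  : ∀ {x y} → Adjoin S x → x * y ≈ 1# → Adjoin S y
    resp : ∀ {x y} → x ≈ y → Adjoin S x → Adjoin S y

  adjoin-mono : ∀ {s} {S T : Carrier → Set s} → (∀ {x} → S x → T x) → ∀ {x} → Adjoin S x → Adjoin T x
  adjoin-mono h (base a)   = base a
  adjoin-mono h (gen s)    = gen (h s)
  adjoin-mono h (add u v)  = add (adjoin-mono h u) (adjoin-mono h v)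
  adjoin-mono h (mul u v)  = mul (adjoin-mono h u) (adjoin-mono h v)
  adjoin-mono h (inv u e)  = inv (adjoin-mono h u) e
  adjoin-mono h (resp e u) = resp e (adjoin-mono h u)

  Integer : ∀ {s} → (Carrier → Set s) → Set (c ⊔ ℓ ⊔ c₁ ⊔ c₂ ⊔ s)
  Integer S = ∃ λ x → Adjoin S x × IsIntegral x

  integerRing : ∀ {s} → (Carrier → Set s) → CommutativeRing (c ⊔ ℓ ⊔ c₁ ⊔ c₂ ⊔ s) ℓ
  integerRing {s} S = record
    { isCommutativeRing = laws }
    where
    raw : RawRing (c ⊔ ℓ ⊔ c₁ ⊔ c₂ ⊔ s) ℓ
    raw = record
      { Carrier = Integer S
      ; _≈_ = λ x y → proj₁ x ≈ proj₁ y
      ; _+_ = λ { (x , s , r) (y , t , u) → x + y , add s t , IntegralClosure.monicRoot-+ A L A→L r u }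
      ; _*_ = λ { (x , s , r) (y , t , u) → x * y , mul s t , IntegralClosure.monicRoot-* A L A→L r u }
      ; -_  = λ { (x , s , r) → - x ,
                 resp (trans (*-congʳ (trans (-‿homo K.1#) (-‿cong 1#-homo))) (RingProps.-1*x≈-x ring x))
                   (mul (base (K.- K.1#)) s) ,
                 IntegralClosure.monicRoot-neg A L A→L r }
      ; 0#  = 0# , resp 0#-homo (base K.0#) ,
              IntegralClosure.monicRoot-cong A L A→L (IsRingHomomorphism.0#-homo (proj₂ A→L)) (IntegralClosure.monicRoot-φ A L A→L A.0#)
      ; 1#  = 1# , resp 1#-homo (base K.1#) ,
              IntegralClosure.monicRoot-cong A L A→L (IsRingHomomorphism.1#-homo (proj₂ A→L)) (IntegralClosure.monicRoot-φ A L A→L A.1#) }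
    hom : IsRingHomomorphism raw rawRing proj₁
    hom = record
      { isSemiringHomomorphism = record
        { isNearSemiringHomomorphism = record
          { +-isMonoidHomomorphism = record
            { isMagmaHomomorphism = record
              { isRelHomomorphism = record { cong = id } ; homo = λ _ _ → refl }
            ; ε-homo = refl }
          ; *-homo = λ _ _ → refl }
        ; 1#-homo = refl }
      ; -‿homo = λ _ → refl }
    open RawRing raw renaming (_≈_ to _≈′_; _+_ to _+′_; _*_ to _*′_; -_ to -′_; 0# to 0′; 1# to 1′)
    abstract
      laws : IsCommutativeRing _≈′_ _+′_ _*′_ -′_ 0′ 1′
      laws = RingMono.isCommutativeRing
        (record { isRingHomomorphism = hom ; injective = id }) isCommutativeRing

  unity-integral : ∀ m {x} → Ops._^_ L x (suc m) ≈ 1# → IsIntegral x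
  unity-integral = IntegralClosure.monicRoot-unity A L A→L

  inclusion : ∀ {s} {S T : Carrier → Set s} → (∀ {x} → S x → T x) → RingHom (integerRing S) (integerRing T)
  inclusion h = map₂ (map₁ (adjoin-mono h)) , record
    { isSemiringHomomorphism = record
      { isNearSemiringHomomorphism = record
        { +-isMonoidHomomorphism = record
          { isMagmaHomomorphism = record
            { isRelHomomorphism = record { cong = id } ; homo = λ _ _ → refl }
          ; ε-homo = refl }
        ; *-homo = λ _ _ → refl }
      ; 1#-homo = refl }
    ; -‿homo = λ _ → refl }

-- The map R/n → S/n induced by R → S, for an integer n.
quotientMap : (R : CommutativeRing c₁ ℓ₁) (S : CommutativeRing c₂ ℓ₂) (φ : RingHom R S) (n : ℕ) →
              RingHom (Quotient R (Ops._·_ R n (CommutativeRing.1# R)))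
                      (Quotient S (Ops._·_ S n (CommutativeRing.1# S)))
quotientMap R S (φ , φ-hom) n = φ , record
  { isSemiringHomomorphism = record
    { isNearSemiringHomomorphism = record
      { +-isMonoidHomomorphism = record
        { isMagmaHomomorphism = record
          { isRelHomomorphism = record { cong = respects }
          ; homo = λ x y → ≈⇒≋ (+-homo x y) }
        ; ε-homo = ≈⇒≋ 0#-homo }
      ; *-homo = λ x y → ≈⇒≋ (*-homo x y) }
    ; 1#-homo = ≈⇒≋ 1#-homo }
  ; -‿homo = λ x → ≈⇒≋ (-‿homo x) }
  where
  module R = CommutativeRing R
  open CommutativeRing S
  open Congruence S using (_≋_[mod_]; mod)
  open CongruenceLaws S using (≈⇒≋)
  open Congruence R using () renaming (_≋_[mod_] to _≋ᴿ_[mod_]; mod to modᴿ)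
  open IsRingHomomorphism φ-hom
  multiple : ∀ m → φ (Ops._·_ R m R.1#) ≈ Ops._·_ S m 1#
  multiple 0       = 0#-homo
  multiple (suc m) = trans (+-homo _ _) (+-cong 1#-homo (multiple m))
  respects : ∀ {x y} → x ≋ᴿ y [mod Ops._·_ R n R.1# ] → φ x ≋ φ y [mod Ops._·_ S n 1# ]
  respects {x} {y} (modᴿ d) = mod record
    { quotient = φ (RawMagmaOps._∣ʳ_.quotient d)
    ; equality = trans (*-congˡ (sym (multiple n)))
        (trans (sym (*-homo _ _))
        (trans (⟦⟧-cong (RawMagmaOps._∣ʳ_.equality d))
        (trans (+-homo x (R.- y)) (+-congˡ (-‿homo y))))) }

module RootsOfUnity (R : CommutativeRing c ℓ) where
  open CommutativeRing R
  open Ops R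
  private module E = Exp semiring

  IsRootOfUnity : ℕ → Carrier → Set ℓ
  IsRootOfUnity m x = x ^ m ≈ 1#

  private
    1^ : ∀ s → 1# ^ s ≈ 1#
    1^ 0       = refl
    1^ (suc s) = trans (*-identityˡ _) (1^ s)

    power-pred : ∀ m i → ∃ λ s → suc m ℕ.^ i ≡ suc (m ℕ.* s)
    power-pred m 0       = 0 , ≡.cong suc (≡.sym (ℕₚ.*-zeroʳ m))
    power-pred m (suc i) with power-pred m i
    ... | s , e = s ℕ.+ suc (m ℕ.* s) ,
      ≡.trans (≡.cong (suc m ℕ.*_) e) (≡.cong suc (≡.sym (ℕₚ.*-distribˡ-+ m s (suc (m ℕ.* s)))))

  unity-power : ∀ q i {x} → IsRootOfUnity (q ℕ.∸ 1) x → IsRootOfUnity (q ℕ.^ i ℕ.∸ 1) x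
  unity-power 0       0       h = refl
  unity-power 0       (suc i) h = refl
  unity-power (suc m) i {x}   h with suc m ℕ.^ i | power-pred m i
  ... | _ | s , ≡.refl = trans (sym (E.^-assocʳ x m s)) (trans (E.^-congˡ s h) (1^ s))

record IsEulerianFunction (Z : CommutativeRing c₁ ℓ₁) (m : CommutativeRing.Carrier Z)
                          (F : CommutativeRing c₂ ℓ₂) {Point : Set c}
                          (f : Point → CommutativeRing.Carrier F) (Φ : Point → CommutativeRing.Carrier Z)
                          : Set (c ⊔ c₁ ⊔ ℓ₁ ⊔ c₂ ⊔ ℓ₂) where
  open Congruence Z using (_≋_[mod_])
  open CommutativeRing Z using (0#; 1#; -_)
  open CommutativeRing F using () renaming (_≈_ to _≈ᶠ_; 0# to 0ᶠ)
  field
    square    : ∀ z → IsUnitSquare F (f z) → Φ z ≋ 1# [mod m ]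
    nonsquare : ∀ z → IsUnitNonsquare F (f z) → Φ z ≋ - 1# [mod m ]
    vanishing : ∀ z → f z ≈ᶠ 0ᶠ → Φ z ≋ 0# [mod m ]

module Unramified (p : ℕ) (p-prime : Prime p)
                  {c ℓ ℓ′} (ℚ̅ₚ : AlgebraicClosure (PAdic.ℚₚ-ring p p-prime) c ℓ ℓ′) where
  open PAdic p p-prime using (ℤₚ-ring; ℚₚ-ring; ℤₚ→ℚₚ; ℚ→ℚₚ)

  Ω : CommutativeRing c ℓ
  Ω = AlgebraicClosure.commutativeRing ℚ̅ₚ

  open CommutativeRing Ω using (Carrier; _≈_)
  open RootsOfUnity Ω public
  open RingOfIntegers ℤₚ-ring ℚₚ-ring Ω ℤₚ→ℚₚ (AlgebraicClosure.embedding ℚ̅ₚ) public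

  ℚ→Ω : ℚ → Carrier
  ℚ→Ω x = proj₁ (AlgebraicClosure.embedding ℚ̅ₚ) (ℚ→ℚₚ x)

  μ : ℕ → Set (c ⊔ ℓ)
  μ m = ∃ (IsRootOfUnity m)

  -- ℤ[ q ] is the ring of integers of ℚₚ(μ_{q-1}).
  ℤ[_] : ℕ → CommutativeRing (c ⊔ ℓ) ℓ
  ℤ[ q ] = integerRing (IsRootOfUnity (q ℕ.∸ 1))

  ∣ℤ[_]∣ : ℕ → Set (c ⊔ ℓ)
  ∣ℤ[ q ]∣ = CommutativeRing.Carrier ℤ[ q ]

  p# : ∀ q → ∣ℤ[ q ]∣
  p# q = Ops._·_ ℤ[ q ] p (CommutativeRing.1# ℤ[ q ])

  p^ : ∀ q → ℕ → ∣ℤ[ q ]∣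
  p^ q k = Ops._^_ ℤ[ q ] (p# q) k

  -- The extension is unramified, so p generates the maximal ideal of ℤ[ q ].
  𝔽[_] : ℕ → CommutativeRing (c ⊔ ℓ) (c ⊔ ℓ)
  𝔽[ q ] = Quotient ℤ[ q ] (p# q)

  ∣𝔽[_]∣ : ℕ → Set (c ⊔ ℓ)
  ∣𝔽[ q ]∣ = CommutativeRing.Carrier 𝔽[ q ]

  residue : ∀ q → ∣ℤ[ q ]∣ → ∣𝔽[ q ]∣
  residue q x = x

  includeℤ : ∀ q i → RingHom ℤ[ q ] ℤ[ q ℕ.^ i ]
  includeℤ q i = inclusion (λ {x} → unity-power q i {x})

  include𝔽 : ∀ q i → RingHom 𝔽[ q ] 𝔽[ q ℕ.^ i ]
  include𝔽 q i = quotientMap ℤ[ q ] ℤ[ q ℕ.^ i ] (includeℤ q i) p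

  μ-integral : ∀ {Q} → 1 ℕ.< Q → ∀ {x} → IsRootOfUnity (Q ℕ.∸ 1) x → IsIntegral x
  μ-integral {suc (suc m)} _ h = unity-integral m h
  μ-integral {suc zero} (ℕ.s≤s ()) _

  unity : ∀ {Q} → 1 ℕ.< Q → μ (Q ℕ.∸ 1) → ∣ℤ[ Q ]∣
  unity 1<Q (x , h) = x , gen h , μ-integral 1<Q h

  π : ∀ {Q} → 1 ℕ.< Q → μ (Q ℕ.∸ 1) → ∣𝔽[ Q ]∣
  π {Q} 1<Q z = residue Q (unity 1<Q z)

  IsPower : ℕ → Set
  IsPower q = ∃ λ r → (1 ℕ.≤ r) × (q ≡ p ℕ.^ r)

  power>1 : ∀ {q i} → IsPower q → 1 ℕ.≤ i → 1 ℕ.< q ℕ.^ i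
  power>1 {i = i} (r , 1≤r , ≡.refl) 1≤i =
    ≡.subst (1 ℕ.<_) (≡.sym (ℕₚ.^-*-assoc p r i))
      (ℕₚ.^-monoʳ-< p (ℕ.nonTrivial⇒n>1 p {{prime⇒nonTrivial p-prime}}) (ℕₚ.*-mono-≤ 1≤r 1≤i))

  IsLift : ∀ {q N} → Polynomials.Poly ℤ[ q ] N → Polynomials.Poly 𝔽[ q ] N → Set (c ⊔ ℓ)
  IsLift {q} F f = ∀ α → residue q (Polynomials.coeff ℤ[ q ] F α) ≈𝔽 Polynomials.coeff 𝔽[ q ] f α
    where open CommutativeRing 𝔽[ q ] using () renaming (_≈_ to _≈𝔽_)

  evalAt-π : ∀ {q N i} → Polynomials.Poly 𝔽[ q ] N → 1 ℕ.< q ℕ.^ i → Vec (μ (q ℕ.^ i ℕ.∸ 1)) N → ∣𝔽[ q ℕ.^ i ]∣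
  evalAt-π {q} {N} {i} f 1<qⁱ z =
    Polynomials.eval 𝔽[ q ℕ.^ i ] (mapCoeffs (proj₁ (include𝔽 q i)) f) (Vec.map (π {q ℕ.^ i} 1<qⁱ) z)

  -- The double cover X : w² = f enters only through f; Φ is a function on
  -- N-tuples of (qⁱ-1)-th roots of unity.
  IsEulerian : ∀ {q N} (l i : ℕ) → 1 ℕ.< q ℕ.^ i → Polynomials.Poly 𝔽[ q ] N →
               (Vec (μ (q ℕ.^ i ℕ.∸ 1)) N → ∣ℤ[ q ]∣) → Set (c ⊔ ℓ)
  IsEulerian {q} {N} l i 1<qⁱ f Φ =
    IsEulerianFunction ℤ[ q ] (p^ q l) 𝔽[ q ℕ.^ i ] (evalAt-π {q} {N} {i} f 1<qⁱ) Φ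

  -- The sum Φ as a function with values in Ω, since the A k are a priori only
  -- rational. Here k counts from 0, so b + 2k is the exponent b + 2k - 2 of the
  -- 1-based indexing; it is positive as soon as b(q-1)/2 ≥ l ≥ 1, so the
  -- absolute value is harmless.
  eulerianSum : ∀ {l} (q N i : ℕ) (b : ℤ) (A : Fin l → ℚ) → Polynomials.Poly ℤ[ q ] N →
                Vec (μ (q ℕ.^ i ℕ.∸ 1)) N → Carrier
  eulerianSum q N i b A F z = sum λ k → ℚ→Ω (A k) * evalΩ (quasiNorm q i (F ^ₚ exponent k))
    where
    open CommutativeRing Ω using (_*_)
    open Ops Ω using (sum)
    open Polynomials ℤ[ q ] using (Poly; quasiNorm; _^ₚ_)
    exponent : Fin _ → ℕ
    exponent k = ℤ.∣ b ℤ.+ + (2 ℕ.* toℕ k) ∣ ℕ.* ((q ℕ.∸ 1) DivMod./ 2)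
    evalΩ : Poly N → Carrier
    evalΩ g = Polynomials.eval Ω (mapCoeffs proj₁ g) (Vec.map proj₁ z)

{-# OPTIONS --safe #-}
-- Write y for the quasi norm of F at z, raised to the power (q-1)/2. Modulo p
-- the quasi norm of F is the power f(π z)^(1+q+⋯+q^(i-1)), so that y is
-- congruent to f(π z)^((qⁱ-1)/2), which Euler's criterion evaluates to 1, -1
-- or 0. If y = ε + p s with ε = ±1, then for odd b
--   y^(b+2k) = ε (1 + ε p s)^(b+2k) = ε Σₘ C(b+2k, m) (ε p s)^m,
-- and the first row of the inverse of P annihilates the terms with 0 < m < l,
-- whence Σₖ Aₖ y^(b+2k) ≡ ε modulo pˡ. If f(π z) = 0, then p divides the quasi
-- norm, and pˡ divides its powers with exponents (b+2k)(q-1)/2 ≥ l.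
--
-- The quasi norm lies in ℚₚ(μ_{q-1}) because i times it is the sum of its
-- conjugates, to which every monomial contributes a trace Σⱼ ω^(q^j). That such
-- traces are ℤₚ-combinations of (q-1)-th roots of unity is seen by expanding in
-- Teichmüller digits, t = ω₀ + p ω₁ + p² ω₂ + ⋯, inside the ring of the
-- combinations of roots of unity that are invariant under ω ↦ ω^q. The same
-- digits replace the decidability of equality, which is not available in the
-- closure of ℚₚ.
module Submission where

open import Defs
open import Algebra.Apartness.Bundles using (HeytingField; HeytingCommutativeRing)
open import Algebra.Bundles using (CommutativeMonoid; CommutativeRing; RawRing)
open import Algebra.Morphism.Structures using (IsRingHomomorphism)
open import Algebra.Structures using (IsCommutativeRing)
open import Data.Bool.Base using (if_then_else_)
open import Data.Fin.Base using (Fin; zero; suc; toℕ; inject₁; fromℕ)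
open import Data.Fin.Properties as Finₚ using (toℕ-inject₁; toℕ-fromℕ; toℕ<n)
open import Data.Integer.Base as ℤ using (ℤ; +_)
open import Data.Integer.Divisibility.Signed as ℤ∣ using ()
open import Data.List.Base as List using (List; []; _∷_; _++_)
open import Data.Nat.Base as ℕ using (ℕ; zero; suc)
open import Data.Nat.Combinatorics using (_C_; nCn≡1; k>n⇒nCk≡0; nCk+nC[k+1]≡[n+1]C[k+1])
open import Data.Nat.Coprimality using (Coprime; coprime-Bézout)
open import Data.Nat.DivMod as DivMod using ()
open import Data.Nat.Divisibility as ℕ∣ using ()
open import Data.Nat.GCD using (module Bézout)
open import Data.Nat.Induction using (<-rec)
open import Data.Nat.Primality using (Prime; euclidsLemma; prime⇒nonZero; prime⇒nonTrivial; prime⇒irreducible)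
open import Data.Product.Base using (∃; _×_; _,_; proj₁; proj₂; map₁)
open import Data.Rational.Base as ℚ using (ℚ)
open import Data.Sum.Base using (inj₁; inj₂; _⊎_; [_,_]′)
open import Data.Vec.Base as Vec using (Vec; []; _∷_)
open import Data.Vec.Functional using (Vector)
open import Function.Base using (_∘_; id)
open import Level using (Level; _⊔_)
open import Relation.Binary.PropositionalEquality as ≡ using (_≡_; _≢_)
open import Relation.Nullary using (¬_; contradiction; yes; no; ⌊_⌋)
import Algebra.Construct.Pointwise as Pointwise
import Algebra.Definitions.RawMagma as RawMagmaOps
import Algebra.Morphism.RingMonomorphism as RingMono
import Algebra.Properties.CommutativeMonoid.Sum as MonoidSum
import Algebra.Properties.CommutativeSemiring.Binomial as Binomial
import Algebra.Properties.CommutativeSemiring.Exp as CExp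
import Algebra.Properties.Ring as RingProps
import Algebra.Properties.Semiring.Exp as Exp
import Algebra.Properties.Semiring.Mult as Mult
import Algebra.Properties.Semiring.Sum as Sum
import Algebra.Solver.Ring.NaturalCoefficients.Default as Solver
import Data.Integer.DivMod as ℤDivMod
import Data.Integer.Properties as ℤₚᵣ
import Data.Integer.Tactic.RingSolver as ℤSolver
import Data.Nat.Properties as ℕₚ
import Data.Nat.Tactic.RingSolver as ℕSolver
import Data.Rational.Properties as ℚₚᵣ
import Data.Rational.Unnormalised.Base as ℚᵘ
import Data.Rational.Unnormalised.Properties as ℚᵘₚ
import Data.Vec.Properties as Vecₚ
import Relation.Binary.Reasoning.Setoid as SetoidReasoning

private variable c ℓ ℓ′ c₁ ℓ₁ c₂ ℓ₂ c₃ ℓ₃ : Level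

C-absorb : ∀ n k → suc k ℕ.* (suc n C suc k) ≡ suc n ℕ.* (n C k)
C-absorb zero zero = ≡.refl
C-absorb zero (suc k)
  rewrite k>n⇒nCk≡0 {1} {suc (suc k)} (ℕ.s≤s (ℕ.s≤s ℕ.z≤n)) | k>n⇒nCk≡0 {0} {suc k} (ℕ.s≤s ℕ.z≤n) = ℕₚ.*-zeroʳ k
C-absorb (suc n) zero = ≡.trans (ℕₚ.*-identityˡ _)
  (≡.trans (≡.sym (nCk+nC[k+1]≡[n+1]C[k+1] (suc n) 0))
    (≡.cong suc (≡.trans (≡.sym (ℕₚ.*-identityˡ _)) (C-absorb n 0))))
C-absorb (suc n) (suc k) = begin
  suc (suc k) ℕ.* (suc (suc n) C suc (suc k))
    ≡⟨ ≡.cong (suc (suc k) ℕ.*_) (nCk+nC[k+1]≡[n+1]C[k+1] (suc n) (suc k)) ⟨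
  suc (suc k) ℕ.* (x ℕ.+ (suc n C suc (suc k)))
    ≡⟨ lemma k x (suc n C suc (suc k)) ⟩
  x ℕ.+ (suc k ℕ.* x ℕ.+ suc (suc k) ℕ.* (suc n C suc (suc k)))
    ≡⟨ ≡.cong₂ (λ a b → x ℕ.+ (a ℕ.+ b)) (C-absorb n k) (C-absorb n (suc k)) ⟩
  x ℕ.+ (suc n ℕ.* (n C k) ℕ.+ suc n ℕ.* (n C suc k))
    ≡⟨ ≡.cong (x ℕ.+_) (ℕₚ.*-distribˡ-+ (suc n) (n C k) (n C suc k)) ⟨
  x ℕ.+ suc n ℕ.* ((n C k) ℕ.+ (n C suc k))
    ≡⟨ ≡.cong (λ y → x ℕ.+ suc n ℕ.* y) (nCk+nC[k+1]≡[n+1]C[k+1] n k) ⟩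
  suc (suc n) ℕ.* x ∎
  where
  open ≡.≡-Reasoning
  x = suc n C suc k
  lemma : ∀ k x y → suc (suc k) ℕ.* (x ℕ.+ y) ≡ x ℕ.+ (suc k ℕ.* x ℕ.+ suc (suc k) ℕ.* y)
  lemma = ℕSolver.solve-∀

prime∣C : ∀ {n k} → Prime (suc n) → k ℕ.< n → suc n ℕ∣.∣ suc n C suc k
prime∣C {n} {k} p-prime k<n
  with euclidsLemma (suc k) (suc n C suc k) p-prime
         (≡.subst (suc n ℕ∣.∣_) (≡.sym (C-absorb n k)) (ℕ∣.m∣m*n (n C k)))
... | inj₁ d = contradiction (ℕ∣.∣⇒≤ d) (ℕₚ.<⇒≱ (ℕ.s≤s k<n))
... | inj₂ d = d

module _ (M : CommutativeMonoid c ℓ) where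
  open CommutativeMonoid M
  open MonoidSum M using (sum; sum-init-last; sum-cong-≋)

  sum-rotate : ∀ (f : ℕ → Carrier) n → f n ≈ f 0 → sum {n} (λ j → f (suc (toℕ j))) ≈ sum {n} (f ∘ toℕ)
  sum-rotate f zero    h = refl
  sum-rotate f (suc n) h = begin
    sum {suc n} (λ j → f (suc (toℕ j)))                                   ≈⟨ sum-init-last {n} (λ j → f (suc (toℕ j))) ⟩
    sum {n} (λ j → f (suc (toℕ (inject₁ j)))) ∙ f (suc (toℕ (fromℕ n)))    ≈⟨ comm _ _ ⟩
    f (suc (toℕ (fromℕ n))) ∙ sum {n} (λ j → f (suc (toℕ (inject₁ j))))
      ≈⟨ ∙-cong (trans (reflexive (≡.cong (f ∘ suc) (toℕ-fromℕ n))) h)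
           (sum-cong-≋ {n} (λ j → reflexive (≡.cong (f ∘ suc) (toℕ-inject₁ j)))) ⟩
    f 0 ∙ sum {n} (λ j → f (suc (toℕ j))) ∎
    where open SetoidReasoning setoid

module RingLemmas (R : CommutativeRing c ℓ) where
  open CommutativeRing R hiding (zero)
  open Ops R
  open SetoidReasoning setoid
  open Solver commutativeSemiring using (solve; _:+_; _:*_; _:=_)
  module Ex = Exp semiring
  module Mu = Mult semiring
  module S = Sum semiring
  open CExp commutativeSemiring public using (^-distrib-*)
  open RingProps ring using (-‿distribˡ-*; -‿distribʳ-*)

  ·≈* : ∀ n x → n · x ≈ (n · 1#) * x
  ·≈* n x = sym (trans (Mu.×-assoc-* n 1# x) (Mu.×-congʳ n (*-identityˡ x)))

  1^ : ∀ n → 1# ^ n ≈ 1#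
  1^ zero    = refl
  1^ (suc n) = trans (*-identityˡ _) (1^ n)

  0^ : ∀ n → 0# ^ suc n ≈ 0#
  0^ n = zeroˡ _

  +-swap-difference : ∀ {x y u v z} → x ≈ z + u → y ≈ z + v → x ≈ y + (u - v)
  +-swap-difference {x} {y} {u} {v} {z} p q = begin
    x                      ≈⟨ p ⟩
    z + u                  ≈⟨ +-congˡ (+-identityʳ u) ⟨
    z + (u + 0#)           ≈⟨ +-congˡ (+-congˡ (-‿inverseʳ v)) ⟨
    z + (u + (v - v))      ≈⟨ solve 4 (λ z u v n → z :+ (u :+ (v :+ n)) := z :+ v :+ (u :+ n)) refl z u v (- v) ⟩
    z + v + (u - v)        ≈⟨ +-congʳ q ⟨
    y + (u - v)            ∎

  difference⇒≈ : ∀ {x y d} → x - y ≈ d → x ≈ y + d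
  difference⇒≈ {x} {y} {d} e = begin
    x                ≈⟨ +-identityʳ x ⟨
    x + 0#           ≈⟨ +-congˡ (-‿inverseˡ y) ⟨
    x + (- y + y)    ≈⟨ solve 3 (λ x n y → x :+ (n :+ y) := y :+ (x :+ n)) refl x (- y) y ⟩
    y + (x - y)      ≈⟨ +-congˡ e ⟩
    y + d            ∎

  ≈⇒difference : ∀ {x y d} → x ≈ y + d → x - y ≈ d
  ≈⇒difference {x} {y} {d} e = begin
    x - y            ≈⟨ +-congʳ e ⟩
    y + d - y        ≈⟨ solve 3 (λ y d n → y :+ d :+ n := d :+ (y :+ n)) refl y d (- y) ⟩
    d + (y - y)      ≈⟨ +-congˡ (-‿inverseʳ y) ⟩
    d + 0#           ≈⟨ +-identityʳ d ⟩
    d                ∎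

  ^-expand : ∀ v d n → ∃ λ s → (v + d) ^ suc n ≈ v ^ suc n + d * (suc n · v ^ n + d * s)
  ^-expand v d zero = 0# , (begin
    (v + d) * 1#                             ≈⟨ distribʳ 1# v d ⟩
    v * 1# + d * 1#                          ≈⟨ +-congˡ (*-congˡ (trans (+-congˡ (zeroʳ d)) (trans (+-identityʳ _) (+-identityʳ 1#)))) ⟨
    v * 1# + d * (1# + 0# + d * 0#)          ∎)
  ^-expand v d (suc n) with ^-expand v d n
  ... | s , e = v * s + (suc n · v ^ n + d * s) , (begin
    (v + d) * (v + d) ^ suc n
      ≈⟨ *-congˡ e ⟩
    (v + d) * (v ^ suc n + d * (m + d * s))
      ≈⟨ solve 5 (λ v d w m s → (v :+ d) :* (w :+ d :* (m :+ d :* s)) :=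
           v :* w :+ d :* ((w :+ v :* m) :+ d :* (v :* s :+ (m :+ d :* s)))) refl v d (v ^ suc n) m s ⟩
    v ^ suc (suc n) + d * ((v ^ suc n + v * m) + d * (v * s + (m + d * s)))
      ≈⟨ +-congˡ (*-congˡ (+-congʳ (+-congˡ (Mu.×-comm-* (suc n) v (v ^ n))))) ⟩
    v ^ suc (suc n) + d * (suc (suc n) · v ^ suc n + d * (v * s + (m + d * s))) ∎)
    where m = suc n · v ^ n

  sum-closed : ∀ {r} (P : Carrier → Set r) → P 0# → (∀ {x y} → P x → P y → P (x + y)) →
               ∀ {n} (f : Fin n → Carrier) → (∀ k → P (f k)) → P (sum f)
  sum-closed P P0 P+ {zero}  f h = P0
  sum-closed P P0 P+ {suc n} f h = P+ (h zero) (sum-closed P P0 P+ (f ∘ suc) (h ∘ suc))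

  module CharP {p} (p-prime : Prime p) (p≈0 : p · 1# ≈ 0#) where

    private
      multiple≈0 : ∀ {m} → p ℕ∣.∣ m → ∀ x → m · x ≈ 0#
      multiple≈0 (ℕ∣.divides k ≡.refl) x = begin
        (k ℕ.* p) · x   ≈⟨ Mu.×-assocˡ x k p ⟨
        k · (p · x)     ≈⟨ Mu.×-congʳ k (trans (·≈* p x) (trans (*-congʳ p≈0) (zeroˡ x))) ⟩
        k · 0#          ≈⟨ ·≈* k 0# ⟩
        (k · 1#) * 0#   ≈⟨ zeroʳ _ ⟩
        0#              ∎

      +-frobenius′ : ∀ n → p ≡ suc n → ∀ x y → (x + y) ^ suc n ≈ x ^ suc n + y ^ suc n
      +-frobenius′ n ≡.refl x y = begin
        (x + y) ^ suc n                        ≈⟨ B.theorem (suc n) x y ⟩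
        f zero + sum (f ∘ suc)                 ≈⟨ +-congˡ (S.sum-init-last (f ∘ suc)) ⟩
        f zero + (sum middle + f (suc (fromℕ n)))  ≈⟨ +-cong first (+-cong (sum≈0 middle middle≈0) last) ⟩
        y ^ suc n + (0# + x ^ suc n)           ≈⟨ +-congˡ (+-identityˡ _) ⟩
        y ^ suc n + x ^ suc n                  ≈⟨ +-comm _ _ ⟩
        x ^ suc n + y ^ suc n                  ∎
        where
        module B = Binomial commutativeSemiring
        f : Fin (suc (suc n)) → Carrier
        f = B.binomialTerm x y (suc n)
        middle : Fin n → Carrier
        middle k = f (suc (inject₁ k))
        sum≈0 : ∀ {m} (g : Fin m → Carrier) → (∀ k → g k ≈ 0#) → sum g ≈ 0#
        sum≈0 = sum-closed (_≈ 0#) refl (λ p q → trans (+-cong p q) (+-identityˡ 0#))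
        middle≈0 : ∀ k → middle k ≈ 0#
        middle≈0 k = multiple≈0 (≡.subst (λ j → suc n ℕ∣.∣ suc n C suc j) (≡.sym (toℕ-inject₁ k))
          (prime∣C p-prime (toℕ<n k))) _
        first : f zero ≈ y ^ suc n
        first = trans (+-identityʳ _) (*-identityˡ _)
        last : f (suc (fromℕ n)) ≈ x ^ suc n
        last = begin
          (suc n C suc (toℕ (fromℕ n))) · (x ^ suc (toℕ (fromℕ n)) * y ^ (n ℕ.∸ toℕ (fromℕ n)))
            ≡⟨ ≡.cong (λ j → (suc n C suc j) · (x ^ suc j * y ^ (n ℕ.∸ j))) (toℕ-fromℕ n) ⟩
          (suc n C suc n) · (x ^ suc n * y ^ (n ℕ.∸ n))
            ≡⟨ ≡.cong₂ (λ a b → a · (x ^ suc n * y ^ b)) (nCn≡1 (suc n)) (ℕₚ.n∸n≡0 n) ⟩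
          x ^ suc n * 1# + 0#
            ≈⟨ trans (+-identityʳ _) (*-identityʳ _) ⟩
          x ^ suc n ∎

      +-frobenius : ∀ x y → (x + y) ^ p ≈ x ^ p + y ^ p
      +-frobenius x y = ≡.subst (λ m → (x + y) ^ m ≈ x ^ m + y ^ m) (≡.sym eq) (+-frobenius′ (ℕ.pred p) eq x y)
        where
        eq : p ≡ suc (ℕ.pred p)
        eq = ≡.sym (ℕₚ.suc-pred p {{prime⇒nonZero p-prime}})

    ^-distrib-+ : ∀ r x y → (x + y) ^ (p ℕ.^ r) ≈ x ^ (p ℕ.^ r) + y ^ (p ℕ.^ r)
    ^-distrib-+ zero    x y = trans (*-identityʳ _) (sym (+-cong (*-identityʳ x) (*-identityʳ y)))
    ^-distrib-+ (suc r) x y = begin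
      (x + y) ^ (p ℕ.* p ℕ.^ r)                      ≈⟨ Ex.^-assocʳ (x + y) p (p ℕ.^ r) ⟨
      ((x + y) ^ p) ^ (p ℕ.^ r)                      ≈⟨ Ex.^-congˡ (p ℕ.^ r) (+-frobenius x y) ⟩
      (x ^ p + y ^ p) ^ (p ℕ.^ r)                    ≈⟨ ^-distrib-+ r (x ^ p) (y ^ p) ⟩
      (x ^ p) ^ (p ℕ.^ r) + (y ^ p) ^ (p ℕ.^ r)      ≈⟨ +-cong (Ex.^-assocʳ x p (p ℕ.^ r)) (Ex.^-assocʳ y p (p ℕ.^ r)) ⟩
      x ^ (p ℕ.* p ℕ.^ r) + y ^ (p ℕ.* p ℕ.^ r)      ∎

    multiple-frobenius : ∀ r m → (m · 1#) ^ (p ℕ.^ r) ≈ m · 1#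
    multiple-frobenius r zero    = ≡.subst (λ n → 0# ^ n ≈ 0#)
      (ℕₚ.suc-pred (p ℕ.^ r) {{ℕₚ.m^n≢0 p r {{prime⇒nonZero p-prime}}}}) (0^ (ℕ.pred (p ℕ.^ r)))
    multiple-frobenius r (suc m) = trans (^-distrib-+ r 1# (m · 1#)) (+-cong (1^ (p ℕ.^ r)) (multiple-frobenius r m))

module _ (A : CommutativeRing c ℓ) (p : ℕ) where
  open CommutativeRing A hiding (zero)
  open Ops A
  private π = p · 1#

  -- x n is the sum y n + p y (n + 1) + p² y (n + 2) + ⋯.
  HasLimits : Set (c ⊔ ℓ)
  HasLimits = ∀ (y : ℕ → Carrier) → ∃ λ (x : ℕ → Carrier) → ∀ n → x n ≈ y n + π * x (suc n)

  Separated : Set (c ⊔ ℓ)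
  Separated = ∀ d → (∀ n → ∃ λ e → d ≈ π ^ n * e) → d ≈ 0#

  series⇒limits : (Σ : (ℕ → Carrier) → Carrier) → (∀ y → Σ y ≈ y 0 + π * Σ (y ∘ suc)) → HasLimits
  series⇒limits Σ step y = (λ n → Σ (drop n)) , λ n → trans (step (drop n)) (+-congʳ (reflexive (drop-at n 0)))
    where
    drop : ℕ → ℕ → Carrier
    drop zero    = y
    drop (suc n) = drop n ∘ suc
    drop-at : ∀ n k → drop n k ≡ y (k ℕ.+ n)
    drop-at zero    k = ≡.cong y (≡.sym (ℕₚ.+-identityʳ k))
    drop-at (suc n) k = ≡.trans (drop-at n (suc k)) (≡.cong y (≡.sym (ℕₚ.+-suc k n)))

module Complete (A : CommutativeRing c ℓ) (p : ℕ) (limit : HasLimits A p) (separated : Separated A p) where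
  open CommutativeRing A hiding (zero)
  open Ops A
  open RingLemmas A
  open SetoidReasoning setoid
  open Solver commutativeSemiring using (solve; _:+_; _:*_; _:=_)
  open RingProps ring using (-‿distribˡ-*; -‿distribʳ-*)
  private π = p · 1#

  separated-≈ : ∀ {x y} → (∀ n → ∃ λ e → x ≈ y + π ^ n * e) → x ≈ y
  separated-≈ {x} {y} h = trans (difference⇒≈ (separated (x - y) (λ n → proj₁ (h n) , ≈⇒difference (proj₂ (h n)))))
    (+-identityʳ y)

  descend : ∀ (d : ℕ → Carrier) → (∀ n → d n ≈ π * d (suc n)) → d 0 ≈ 0#
  descend d h = separated (d 0) (λ n → d n , iterate n)
    where
    iterate : ∀ n → d 0 ≈ π ^ n * d n
    iterate zero    = sym (*-identityˡ _)
    iterate (suc n) = trans (iterate n) (trans (*-congˡ (h n))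
      (solve 3 (λ a b c → a :* (b :* c) := (b :* a) :* c) refl (π ^ n) π (d (suc n))))

  geometric : ∀ s → ∃ λ x → (1# + π * s) * x ≈ 1#
  geometric s with limit (λ n → (- s) ^ n)
  ... | x , e = x 0 , (begin
    (1# + π * s) * x 0                     ≈⟨ solve 4 (λ o π s x → (o :+ π :* s) :* x := o :* x :+ π :* (s :* x)) refl 1# π s (x 0) ⟩
    1# * x 0 + π * (s * x 0)               ≈⟨ +-congʳ (trans (*-identityˡ _) (e 0)) ⟩
    1# + π * x 1 + π * (s * x 0)           ≈⟨ solve 4 (λ o π a b → o :+ π :* a :+ π :* b := o :+ π :* (a :+ b)) refl 1# π (x 1) (s * x 0) ⟩
    1# + π * d 0                           ≈⟨ +-congˡ (trans (*-congˡ (descend d step)) (zeroʳ π)) ⟩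
    1# + 0#                                ≈⟨ +-identityʳ 1# ⟩
    1#                                     ∎)
    where
    d : ℕ → Carrier
    d n = x (suc n) + s * x n
    step : ∀ n → d n ≈ π * d (suc n)
    step n = begin
      x (suc n) + s * x n
        ≈⟨ +-cong (e (suc n)) (*-congˡ (e n)) ⟩
      (- s) * (- s) ^ n + π * x (suc (suc n)) + s * ((- s) ^ n + π * x (suc n))
        ≈⟨ solve 6 (λ m y π a s b → m :* y :+ π :* a :+ s :* (y :+ π :* b) := (m :+ s) :* y :+ π :* (a :+ s :* b))
             refl (- s) ((- s) ^ n) π (x (suc (suc n))) s (x (suc n)) ⟩
      (- s + s) * (- s) ^ n + π * d (suc n)
        ≈⟨ +-congʳ (trans (*-congʳ (-‿inverseˡ s)) (zeroˡ _)) ⟩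
      0# + π * d (suc n)
        ≈⟨ +-identityˡ _ ⟩
      π * d (suc n) ∎

  module Teichmüller {q u} (q≈0 : suc q · 1# ≈ π * u)
                     (frobenius : ∀ t → ∃ λ y → t ^ suc q ≈ t + π * y) (t : Carrier) where
    private
      raise : ∀ n v y → ∃ λ z → (v + π ^ suc n * y) ^ suc q ≈ v ^ suc q + π ^ suc (suc n) * z
      raise n v y with ^-expand v (π ^ suc n * y) q
      ... | s , e = y * (u * v ^ q + π ^ n * y * s) , (begin
        (v + π ^ suc n * y) ^ suc q
          ≈⟨ e ⟩
        v ^ suc q + π ^ suc n * y * (suc q · v ^ q + π ^ suc n * y * s)
          ≈⟨ +-congˡ (*-congˡ (+-congʳ (trans (·≈* (suc q) (v ^ q)) (*-congʳ q≈0)))) ⟩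
        v ^ suc q + π ^ suc n * y * (π * u * v ^ q + π ^ suc n * y * s)
          ≈⟨ solve 7 (λ w π P y u v s → w :+ (π :* P) :* y :* (π :* u :* v :+ π :* P :* y :* s) :=
               w :+ (π :* (π :* P)) :* (y :* (u :* v :+ P :* y :* s))) refl (v ^ suc q) π (π ^ n) y u (v ^ q) s ⟩
        v ^ suc q + π ^ suc (suc n) * (y * (u * v ^ q + π ^ n * y * s)) ∎)

      t^ : ℕ → Carrier
      t^ zero    = t
      t^ (suc n) = t^ n ^ suc q

      steps : ∀ n → ∃ λ y → t^ (suc n) ≈ t^ n + π ^ suc n * y
      steps zero    = proj₁ (frobenius t) ,
        trans (proj₂ (frobenius t)) (+-congˡ (*-congʳ (sym (*-identityʳ π))))
      steps (suc n) = proj₁ next , trans (Ex.^-congˡ (suc q) (proj₂ (steps n))) (proj₂ next)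
        where
        next : ∃ λ z → (t^ n + π ^ suc n * proj₁ (steps n)) ^ suc q ≈ t^ n ^ suc q + π ^ suc (suc n) * z
        next = raise n (t^ n) (proj₁ (steps n))

      x : ℕ → Carrier
      x = proj₁ (limit (λ n → proj₁ (steps n)))

      x-step : ∀ n → x n ≈ proj₁ (steps n) + π * x (suc n)
      x-step = proj₂ (limit (λ n → proj₁ (steps n)))

    T : Carrier
    T = t + π * x 0

    private
      tail : ∀ n → T ≈ t^ n + π ^ suc n * x n
      tail zero    = +-congˡ (*-congʳ (sym (*-identityʳ π)))
      tail (suc n) = begin
        T                                               ≈⟨ tail n ⟩
        t^ n + π ^ suc n * x n                          ≈⟨ +-congˡ (*-congˡ (x-step n)) ⟩
        t^ n + π ^ suc n * (proj₁ (steps n) + π * x (suc n))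
          ≈⟨ solve 5 (λ t P y π x → t :+ P :* (y :+ π :* x) := t :+ P :* y :+ (π :* P) :* x) refl
               (t^ n) (π ^ suc n) (proj₁ (steps n)) π (x (suc n)) ⟩
        t^ n + π ^ suc n * proj₁ (steps n) + π ^ suc (suc n) * x (suc n)
          ≈⟨ +-congʳ (proj₂ (steps n)) ⟨
        t^ (suc n) + π ^ suc (suc n) * x (suc n)        ∎

    T^q≈T : T ^ suc q ≈ T
    T^q≈T = separated-≈ λ n →
      let z , e = raise n (t^ n) (x n)
          f = trans (Ex.^-congˡ (suc q) (tail n)) e
      in π * π * (z - x (suc n)) ,
         trans (+-swap-difference f (tail (suc n)))
           (+-congˡ (trans (factor (π ^ suc (suc n)) z (x (suc n)))
             (solve 3 (λ π P d → (π :* (π :* P)) :* d := P :* (π :* π :* d)) refl π (π ^ n) (z - x (suc n)))))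
      where
      factor : ∀ P a b → P * a - P * b ≈ P * (a - b)
      factor P a b = trans (+-congˡ (-‿distribʳ-* P b)) (sym (distribˡ P a (- b)))

    t≈T : ∃ λ y → t ≈ T + π * y
    t≈T = - x 0 , (begin
      t                              ≈⟨ +-identityʳ t ⟨
      t + 0#                         ≈⟨ +-congˡ (trans (*-congˡ (-‿inverseʳ (x 0))) (zeroʳ π)) ⟨
      t + π * (x 0 - x 0)            ≈⟨ solve 4 (λ t π x n → t :+ π :* (x :+ n) := t :+ π :* x :+ π :* n) refl t π (x 0) (- x 0) ⟩
      t + π * x 0 + π * - x 0        ∎)

module HomLemmas (A : CommutativeRing c₁ ℓ₁) (B : CommutativeRing c₂ ℓ₂) (hom : RingHom A B) where
  private
    module A = CommutativeRing A
    module OA = Ops A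
    φ = proj₁ hom
  open CommutativeRing B hiding (zero)
  open Ops B
  open IsRingHomomorphism (proj₂ hom)

  φ-· : ∀ n → φ (n OA.· A.1#) ≈ n · 1#
  φ-· zero    = 0#-homo
  φ-· (suc n) = trans (+-homo _ _) (+-cong 1#-homo (φ-· n))

  φ-^ : ∀ x n → φ (x OA.^ n) ≈ φ x ^ n
  φ-^ x zero    = 1#-homo
  φ-^ x (suc n) = trans (*-homo _ _) (*-congˡ (φ-^ x n))

  φ-sum : ∀ {n} (f : Fin n → A.Carrier) → φ (OA.sum f) ≈ sum (φ ∘ f)
  φ-sum {zero}  f = 0#-homo
  φ-sum {suc n} f = trans (+-homo _ _) (+-congˡ (φ-sum (f ∘ suc)))

module _ (R : CommutativeRing c ℓ) where
  open CommutativeRing R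

  Inv : Carrier → Set (c ⊔ ℓ)
  Inv x = ∃ λ y → x * y ≈ 1#

module InvLemmas (R : CommutativeRing c ℓ) where
  open CommutativeRing R hiding (zero)
  open Ops R
  open Solver commutativeSemiring using (solve; _:+_; _:*_; _:=_)

  inv-cong : ∀ {x y} → x ≈ y → Inv R x → Inv R y
  inv-cong e (z , h) = z , trans (*-congʳ (sym e)) h

  inv-factorˡ : ∀ {x y} → Inv R (x * y) → Inv R x
  inv-factorˡ {x} {y} (z , h) = y * z , trans (sym (*-assoc x y z)) h

  inv-factorʳ : ∀ {x y} → Inv R (x * y) → Inv R y
  inv-factorʳ = inv-factorˡ ∘ inv-cong (*-comm _ _)

  inv-* : ∀ {x y} → Inv R x → Inv R y → Inv R (x * y)
  inv-* {x} {y} (u , h) (v , k) = u * v ,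
    trans (solve 4 (λ x y u v → x :* y :* (u :* v) := (x :* u) :* (y :* v)) refl x y u v)
      (trans (*-cong h k) (*-identityˡ 1#))

  inv-cancelˡ : ∀ {x y z} → Inv R x → x * y ≈ x * z → y ≈ z
  inv-cancelˡ {x} {y} {z} (u , h) e = trans (expand y) (trans (*-congˡ e) (sym (expand z)))
    where
    expand : ∀ y → y ≈ u * (x * y)
    expand y = trans (sym (*-identityˡ y)) (trans (*-congʳ (sym (trans (*-comm u x) h))) (*-assoc u x y))

  inv-^ : ∀ n {x} → Inv R x → Inv R (x ^ n)
  inv-^ zero    h = 1# , *-identityˡ 1#
  inv-^ (suc n) h = inv-* h (inv-^ n h)

  unity-inv : ∀ m {x} → x ^ suc m ≈ 1# → Inv R x
  unity-inv m h = _ , h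

record HasDenominators (Z : CommutativeRing c₁ ℓ₁) (K : CommutativeRing c₂ ℓ₂) (Z→K : RingHom Z K) : Set (c₁ ⊔ c₂ ⊔ ℓ₂) where
  open CommutativeRing K
  open Ops K
  field
    fraction : ∀ a → ∃ λ D → ∃ λ z → (suc D · 1#) * a ≈ proj₁ Z→K z

record IsPAdic (p : ℕ) (Z : CommutativeRing c ℓ) : Set (c ⊔ ℓ) where
  open CommutativeRing Z
  open Ops Z
  field
    -- y 0 + p y 1 + p² y 2 + ⋯
    series      : (ℕ → Carrier) → Carrier
    series-step : ∀ y → series y ≈ y 0 + (p · 1#) * series (y ∘ suc)
    separated   : ∀ d → (∀ n → ∃ λ e → d ≈ (p · 1#) ^ n * e) → d ≈ 0#
    approximate : ∀ a → ∃ λ m → ∃ λ b → a ≈ m · 1# + (p · 1#) * b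

  limits : HasLimits Z p
  limits = series⇒limits Z p series series-step

-- The properties of ℤₚ → Ω, for an algebraic closure Ω of ℚₚ, on which the
-- arguments rely; Inv-+ and tight replace the decidability of equality in Ω.
record Setting (p : ℕ) (Z : CommutativeRing c₁ ℓ₁) (Ω : CommutativeRing c ℓ) (hom : RingHom Z Ω)
               : Set (c ⊔ ℓ ⊔ c₁ ⊔ ℓ₁) where
  private module Z = CommutativeRing Z
  open CommutativeRing Ω
  open Ops Ω
  open MonicRoots Z Ω (proj₁ hom) using () renaming (IsMonicRoot to IsIntegral)
  field
    p-prime     : Prime p
    isPAdic     : IsPAdic p Z
    Inv-+       : ∀ {x y} → Inv Ω (x + y) → Inv Ω x ⊎ Inv Ω y
    tight       : ∀ {x} → ¬ Inv Ω x → x ≈ 0#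
    1≉0         : ¬ 1# ≈ 0#
    inv-ℕ       : ∀ n → Inv Ω (suc n · 1#)
    scale       : ∀ x → ∃ λ D → IsIntegral ((suc D · 1#) * x)
    root        : ∀ {n} (a : Vector Carrier (suc n)) → ∃ λ x → MonicRoots.monicValue Ω Ω id a x ≈ 0#
  open IsPAdic isPAdic public renaming (separated to Z-separated)

module HornerLemma (A : CommutativeRing c₁ ℓ₁) (B : CommutativeRing c₂ ℓ₂) (φ : CommutativeRing.Carrier A → CommutativeRing.Carrier B) where
  open CommutativeRing B hiding (zero)
  open Ops B
  open MonicRoots A B φ
  open RingLemmas B
  open Solver commutativeSemiring using (solve; _:+_; _:*_; _:=_)
  open SetoidReasoning setoid

  horner : ∀ {n} (a : Vector (CommutativeRing.Carrier A) (suc n)) x →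
           monicValue a x ≈ φ (a zero) + x * monicValue (a ∘ suc) x
  horner {n} a x = begin
    x * x ^ n + (φ (a zero) * 1# + sum (λ j → φ (a (suc j)) * (x * x ^ toℕ j)))
      ≈⟨ +-congˡ (+-cong (*-identityʳ _) (trans (S.sum-cong-≋ {n} (λ j →
           solve 3 (λ b x y → b :* (x :* y) := x :* (b :* y)) refl (φ (a (suc j))) x (x ^ toℕ j)))
           (sym (S.*-distribˡ-sum {n} x (λ j → φ (a (suc j)) * x ^ toℕ j))))) ⟩
    x * x ^ n + (φ (a zero) + x * s)
      ≈⟨ solve 4 (λ x y b s → x :* y :+ (b :+ x :* s) := b :+ x :* (y :+ s)) refl x (x ^ n) (φ (a zero)) s ⟩
    φ (a zero) + x * (x ^ n + s) ∎
    where s = sum (λ j → φ (a (suc j)) * x ^ toℕ j)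

module FieldLemmas {p} {Z : CommutativeRing c₁ ℓ₁} {Ω : CommutativeRing c ℓ} {hom : RingHom Z Ω}
                   (setting : Setting p Z Ω hom) where
  private module Z = CommutativeRing Z
  open Setting setting
  open CommutativeRing Ω hiding (zero)
  open Ops Ω
  open MonicRoots Z Ω (proj₁ hom) public using () renaming (IsMonicRoot to IsIntegral)
  open MonicRoots Z Ω (proj₁ hom) using (monicValue)
  open IntegralClosure Z Ω hom public using ()
    renaming (monicRoot-+ to int-+; monicRoot-* to int-*; monicRoot-neg to int-neg; monicRoot-φ to int-φ;
              monicRoot-cong to int-cong; monicRoot-unity to int-unity)
  open IsRingHomomorphism (proj₂ hom)
  open RingLemmas Ω
  open InvLemmas Ω public
  open HomLemmas Z Ω hom
  open HornerLemma Z Ω (proj₁ hom)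
  open SetoidReasoning setoid
  open Solver commutativeSemiring using (solve; _:+_; _:*_; _:=_)
  open RingProps ring using (-‿distribˡ-*; -‿distribʳ-*)
  private
    φ = proj₁ hom
    πZ = Ops._·_ Z p Z.1#

  π : Carrier
  π = p · 1#

  φπ : φ πZ ≈ π
  φπ = φ-· p

  int-· : ∀ n → IsIntegral (n · 1#)
  int-· n = int-cong (φ-· n) (int-φ _)

  int-1 : IsIntegral 1#
  int-1 = int-cong 1#-homo (int-φ _)

  int-0 : IsIntegral 0#
  int-0 = int-cong 0#-homo (int-φ _)

  int-^ : ∀ n {x} → IsIntegral x → IsIntegral (x ^ n)
  int-^ zero    h = int-1
  int-^ (suc n) h = int-* h (int-^ n h)

  inv-π : Inv Ω π
  inv-π = ≡.subst (λ n → Inv Ω (n · 1#)) (ℕₚ.suc-pred p {{prime⇒nonZero p-prime}}) (inv-ℕ (ℕ.pred p))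

  -- Clearing denominators in an equation for 1/p would make a unit 1 + p b vanish.
  1/p-not-integral : ∀ {s} → IsIntegral s → ¬ π * s ≈ 1#
  1/p-not-integral {s} (n , a , e) πs≈1 = 1≉0 (begin
    1#                             ≈⟨ 1#-homo ⟨
    φ Z.1#                         ≈⟨ ⟦⟧-cong (proj₂ inverse) ⟨
    φ ((Z.1# Z.+ πZ Z.* b) Z.* g)  ≈⟨ *-homo _ g ⟩
    φ (Z.1# Z.+ πZ Z.* b) * φ g    ≈⟨ *-congʳ (proj₂ (cleared n a)) ⟨
    π ^ n * monicValue a s * φ g   ≈⟨ *-congʳ (trans (*-congˡ e) (zeroʳ _)) ⟩
    0# * φ g                       ≈⟨ zeroˡ _ ⟩
    0#                             ∎)
    where
    cleared : ∀ n (a : Vector Z.Carrier n) → ∃ λ b → π ^ n * monicValue a s ≈ φ (Z.1# Z.+ πZ Z.* b)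
    cleared zero    a = Z.0# , (begin
      1# * (1# + 0#)               ≈⟨ trans (*-identityˡ _) (+-identityʳ 1#) ⟩
      1#                           ≈⟨ 1#-homo ⟨
      φ Z.1#                       ≈⟨ ⟦⟧-cong (Z.trans (Z.+-congˡ (Z.zeroʳ πZ)) (Z.+-identityʳ Z.1#)) ⟨
      φ (Z.1# Z.+ πZ Z.* Z.0#)     ∎)
    cleared (suc n) a with cleared n (a ∘ suc)
    ... | b , e = Ops._^_ Z πZ n Z.* a zero Z.+ b , (begin
      π * π ^ n * monicValue a s
        ≈⟨ *-congˡ (horner a s) ⟩
      π * π ^ n * (φ (a zero) + s * M)
        ≈⟨ solve 5 (λ π P a s M → π :* P :* (a :+ s :* M) := π :* (P :* a) :+ (π :* s) :* (P :* M)) refl π (π ^ n) (φ (a zero)) s M ⟩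
      π * (π ^ n * φ (a zero)) + π * s * (π ^ n * M)
        ≈⟨ +-cong (*-cong φπ (*-congʳ (trans (φ-^ πZ n) (Ex.^-congˡ n φπ)))) (sym (trans (*-cong πs≈1 e) (*-identityˡ _))) ⟨
      φ πZ * (φ (Ops._^_ Z πZ n) * φ (a zero)) + φ (Z.1# Z.+ πZ Z.* b)
        ≈⟨ +-congʳ (trans (*-homo πZ _) (*-congˡ (*-homo _ (a zero)))) ⟨
      φ (πZ Z.* (Ops._^_ Z πZ n Z.* a zero)) + φ (Z.1# Z.+ πZ Z.* b)
        ≈⟨ +-homo _ _ ⟨
      φ (πZ Z.* (Ops._^_ Z πZ n Z.* a zero) Z.+ (Z.1# Z.+ πZ Z.* b))
        ≈⟨ ⟦⟧-cong (ZS.solve 4 (λ π u o b → π ZS.:* u ZS.:+ (o ZS.:+ π ZS.:* b) ZS.:= o ZS.:+ π ZS.:* (u ZS.:+ b))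
             Z.refl πZ (Ops._^_ Z πZ n Z.* a zero) Z.1# b) ⟩
      φ (Z.1# Z.+ πZ Z.* (Ops._^_ Z πZ n Z.* a zero Z.+ b)) ∎)
      where
      module ZS = Solver Z.commutativeSemiring
      M = monicValue (a ∘ suc) s
    b : Z.Carrier
    b = proj₁ (cleared n a)
    inverse : ∃ λ g → (Z.1# Z.+ πZ Z.* b) Z.* g Z.≈ Z.1#
    inverse = Complete.geometric Z p limits Z-separated b
    g : Z.Carrier
    g = proj₁ inverse

  p∤⇒π∤ : ∀ {D s} → ¬ p ℕ∣.∣ D → IsIntegral s → ¬ D · 1# ≈ π * s
  p∤⇒π∤ {D} {s} p∤D int e = 1/p-not-integral (proj₁ (proj₂ inverse)) (proj₂ (proj₂ inverse))
    where
    coprime : Coprime D p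
    coprime (d∣D , d∣p) with prime⇒irreducible p-prime d∣p
    ... | inj₁ d≡1    = d≡1
    ... | inj₂ ≡.refl = contradiction d∣D p∤D
    solution : ∀ a b → 1# + π * a ≈ π * b → π * (b - a) ≈ 1#
    solution a b h = begin
      π * (b - a)               ≈⟨ distribˡ π b (- a) ⟩
      π * b + π * - a           ≈⟨ +-congʳ h ⟨
      1# + π * a + π * - a      ≈⟨ solve 4 (λ o π a n → o :+ π :* a :+ π :* n := o :+ π :* (a :+ n)) refl 1# π a (- a) ⟩
      1# + π * (a - a)          ≈⟨ +-congˡ (trans (*-congˡ (-‿inverseʳ a)) (zeroʳ π)) ⟩
      1# + 0#                   ≈⟨ +-identityʳ 1# ⟩
      1#                        ∎
    multiples : ∀ x y m n → 1 ℕ.+ x ℕ.* m ≡ y ℕ.* n → 1# + x · 1# * (m · 1#) ≈ y · 1# * (n · 1#)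
    multiples x y m n eq = trans (+-congˡ (sym (Mu.×1-homo-* x m))) (trans (Mu.×-congˡ eq) (Mu.×1-homo-* y n))
    swap : ∀ x → x * (π * s) ≈ π * (x * s)
    swap x = solve 3 (λ x π s → x :* (π :* s) := π :* (x :* s)) refl x π s
    inverse : ∃ λ t → IsIntegral t × π * t ≈ 1#
    inverse with coprime-Bézout coprime
    ... | Bézout.+- x y eq = x · 1# * s - y · 1# , int-+ (int-* (int-· x) int) (int-neg (int-· y)) ,
      solution _ _ (trans (+-congˡ (*-comm π _)) (trans (multiples y x p D eq) (trans (*-congˡ e) (swap _))))
    ... | Bézout.-+ x y eq = y · 1# - x · 1# * s , int-+ (int-· y) (int-neg (int-* (int-· x) int)) ,
      solution _ _ (trans (+-congˡ (sym (trans (*-congˡ e) (swap _)))) (trans (multiples x y D p eq) (*-comm _ π)))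

  cancel-p : ∀ {D D₁ s t} → D ≡ D₁ ℕ.* p → D · 1# ≈ π * s * t → D₁ · 1# ≈ s * t
  cancel-p {D₁ = D₁} {s} {t} ≡.refl e = inv-cancelˡ inv-π
    (trans (*-comm π _) (trans (sym (Mu.×1-homo-* D₁ p)) (trans e (*-assoc π s t))))

  quotient-p : ∀ {D D₁} → D ≡ D₁ ℕ.* p → 0 ℕ.< D → 0 ℕ.< D₁ × D₁ ℕ.< D
  quotient-p {D₁ = zero}   ≡.refl ()
  quotient-p {D₁ = suc D₁} ≡.refl 0<D = ℕ.s≤s ℕ.z≤n ,
    ℕₚ.m<m*n (suc D₁) p (ℕ.nonTrivial⇒n>1 p {{prime⇒nonTrivial p-prime}})

  ℕ-separated : ∀ D → 0 ℕ.< D → ¬ (∀ n → ∃ λ s → IsIntegral s × D · 1# ≈ π ^ n * s)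
  ℕ-separated = <-rec _ step
    where
    step : ∀ D → (∀ {D₁} → D₁ ℕ.< D → 0 ℕ.< D₁ → ¬ (∀ n → ∃ λ s → IsIntegral s × D₁ · 1# ≈ π ^ n * s)) →
           0 ℕ.< D → ¬ (∀ n → ∃ λ s → IsIntegral s × D · 1# ≈ π ^ n * s)
    step D rec 0<D h with p ℕ∣.∣? D
    ... | no p∤D = p∤⇒π∤ p∤D (proj₁ (proj₂ (h 1))) (trans (proj₂ (proj₂ (h 1))) (*-congʳ (*-identityʳ π)))
    ... | yes (ℕ∣.divides D₁ eq) = rec {D₁} (proj₂ (quotient-p {D} {D₁} eq 0<D)) (proj₁ (quotient-p {D} {D₁} eq 0<D))
      (λ n → proj₁ (h (suc n)) , proj₁ (proj₂ (h (suc n))) , cancel-p {D} {D₁} eq (proj₂ (proj₂ (h (suc n)))))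

  separated : ∀ d → (∀ n → ∃ λ e → IsIntegral e × d ≈ π ^ n * e) → d ≈ 0#
  separated d h = tight λ { (y , dy≈1) → ℕ-separated (suc (proj₁ (scale y))) (ℕ.s≤s ℕ.z≤n) λ n →
    let D , D*y-int = scale y
        e , e-int , eq = h n
    in e * ((suc D · 1#) * y) , int-* e-int D*y-int , (begin
       suc D · 1#                            ≈⟨ *-identityʳ _ ⟨
       suc D · 1# * 1#                       ≈⟨ *-congˡ (trans (*-congʳ (sym eq)) dy≈1) ⟨
       suc D · 1# * (π ^ n * e * y)          ≈⟨ solve 4 (λ D P e y → D :* (P :* e :* y) := P :* (e :* (D :* y))) refl _ (π ^ n) e y ⟩
       π ^ n * (e * ((suc D · 1#) * y))      ∎) }

  descend : ∀ (d : ℕ → Carrier) → (∀ n → IsIntegral (d n)) → (∀ n → d n ≈ π * d (suc n)) → d 0 ≈ 0#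
  descend d int h = separated (d 0) (λ n → d n , int n , iterate n)
    where
    iterate : ∀ n → d 0 ≈ π ^ n * d n
    iterate zero    = sym (*-identityˡ _)
    iterate (suc n) = trans (iterate n) (trans (*-congˡ (h n))
      (solve 3 (λ a b c → a :* (b :* c) := (b :* a) :* c) refl (π ^ n) π (d (suc n))))

  Inv-difference : ∀ {x y} → Inv Ω (x - y) → Inv Ω x ⊎ Inv Ω y
  Inv-difference {x} {y} h with Inv-+ h
  ... | inj₁ i = inj₁ i
  ... | inj₂ i = inj₂ (inv-factorʳ (inv-cong (sym (RingProps.-1*x≈-x ring y)) i))

  -- With d = v - w, expanding v ^ m = (w + d) ^ m leaves d (m w ^ (m - 1) + d s) = 0.
  unity-≟ : ∀ m {v w} → v ^ suc m ≈ 1# → w ^ suc m ≈ 1# → v - w ≈ 0# ⊎ Inv Ω (v - w)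
  unity-≟ m {v} {w} v^m w^m with ^-expand w (v - w) m
  ... | s , e = [ (λ i → inj₁ (inv-cancelˡ i (trans (*-comm _ d) (trans vanish (sym (zeroʳ _)))))) ,
                  (λ i → inj₂ (inv-factorˡ i)) ]′
                (Inv-difference {y = d * s} (inv-cong (sym (≈⇒difference (+-comm _ _)))
                  (inv-cong (sym (·≈* (suc m) (w ^ m))) (inv-* (inv-ℕ m) (inv-^ m (unity-inv m w^m))))))
    where
    d = v - w
    vanish : d * (suc m · w ^ m + d * s) ≈ 0#
    vanish = begin
      d * (suc m · w ^ m + d * s)
        ≈⟨ ≈⇒difference (sym (trans (sym e) (trans (Ex.^-congˡ (suc m) (sym (difference⇒≈ {v} {w} refl))) v^m′))) ⟨
      w ^ suc m - w ^ suc m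
        ≈⟨ -‿inverseʳ _ ⟩
      0# ∎
      where
      v^m′ : v ^ suc m ≈ w ^ suc m
      v^m′ = trans v^m (sym w^m)

  fixed-point : ∀ q {x} → x ^ suc (suc q) ≈ x → x ≈ 0# ⊎ x ^ suc q ≈ 1#
  fixed-point q {x} e = [ (λ i → inj₂ (inv-cancelˡ i (trans (sym idem) (sym (*-identityʳ u))))) ,
                          (λ i → inj₁ (inv-cancelˡ i (trans vanish (sym (zeroʳ _))))) ]′
                        (Inv-+ (inv-cong (difference⇒≈ refl) (1# , *-identityˡ 1#)))
    where
    u = x ^ suc q
    idem : u ≈ u * u
    idem = begin
      x * x ^ q             ≈⟨ *-congʳ e ⟨
      x * u * x ^ q         ≈⟨ solve 3 (λ x u y → x :* u :* y := (x :* y) :* u) refl x u (x ^ q) ⟩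
      u * u                 ∎
    vanish : (1# - u) * x ≈ 0#
    vanish = begin
      (1# - u) * x          ≈⟨ distribʳ x 1# (- u) ⟩
      1# * x + - u * x      ≈⟨ +-cong (*-identityˡ x) (trans (sym (-‿distribˡ-* u x)) (-‿cong (trans (*-comm u x) e))) ⟩
      x - x                 ≈⟨ -‿inverseʳ x ⟩
      0#                    ∎

  private
    module M = MonicRoots Ω Ω id
    module H = HornerLemma Ω Ω id

    divide : ∀ {n} (a : Vector Carrier (suc n)) r → ∃ λ (b : Vector Carrier n) →
             ∀ x → M.monicValue a x ≈ (x - r) * M.monicValue b x + M.monicValue a r
    divide {zero} a r = (λ ()) , λ x → begin
      M.monicValue a x                     ≈⟨ H.horner a x ⟩
      a zero + x * o                       ≈⟨ +-congˡ (*-congʳ (difference⇒≈ refl)) ⟩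
      a zero + (r + (x - r)) * o           ≈⟨ solve 4 (λ a r d o → a :+ (r :+ d) :* o := d :* o :+ (a :+ r :* o)) refl (a zero) r (x - r) o ⟩
      (x - r) * o + (a zero + r * o)       ≈⟨ +-congˡ (H.horner a r) ⟨
      (x - r) * o + M.monicValue a r       ∎
      where o = 1# + 0#
    divide {suc n} a r with divide (a ∘ suc) r
    ... | b , h = b′ , λ x → begin
      M.monicValue a x
        ≈⟨ H.horner a x ⟩
      a zero + x * M.monicValue (a ∘ suc) x
        ≈⟨ +-congˡ (*-congˡ (h x)) ⟩
      a zero + x * ((x - r) * M.monicValue b x + C′)
        ≈⟨ solve 5 (λ a x d B C′ → a :+ x :* (d :* B :+ C′) := a :+ d :* (x :* B) :+ x :* C′) refl (a zero) x (x - r) (M.monicValue b x) C′ ⟩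
      a zero + (x - r) * (x * M.monicValue b x) + x * C′
        ≈⟨ +-congˡ (*-congʳ (difference⇒≈ refl)) ⟩
      a zero + (x - r) * (x * M.monicValue b x) + (r + (x - r)) * C′
        ≈⟨ solve 5 (λ a d r B C′ → a :+ d :* B :+ (r :+ d) :* C′ := d :* (C′ :+ B) :+ (a :+ r :* C′)) refl (a zero) (x - r) r (x * M.monicValue b x) C′ ⟩
      (x - r) * (C′ + x * M.monicValue b x) + (a zero + r * C′)
        ≈⟨ +-cong (*-congˡ (H.horner b′ x)) (H.horner a r) ⟨
      (x - r) * M.monicValue b′ x + M.monicValue a r ∎
      where
      C′ = M.monicValue (a ∘ suc) r
      b′ : Vector Carrier (suc n)
      b′ zero    = C′
      b′ (suc k) = b k

    factorise : ∀ {n} (a : Vector Carrier n) → ∃ λ (r : Vector Carrier n) →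
                ∀ x → M.monicValue a x ≈ product (λ k → x - r k)
    factorise {zero}  a = (λ ()) , λ x → +-identityʳ 1#
    factorise {suc n} a with root a
    ... | r₀ , e with divide a r₀
    ... | b , h with factorise b
    ... | r , h′ = (λ { zero → r₀ ; (suc k) → r k }) , λ x →
      trans (h x) (trans (+-congˡ e) (trans (+-identityʳ _) (*-congˡ (h′ x))))

    product-zero : ∀ {n} (f : Fin n → Carrier) k → f k ≈ 0# → product f ≈ 0#
    product-zero f zero    e = trans (*-congʳ e) (zeroˡ _)
    product-zero f (suc k) e = trans (*-congˡ (product-zero (f ∘ suc) k e)) (zeroʳ _)

    zero-factor : ∀ {n} (f : Fin n → Carrier) → (∀ k → f k ≈ 0# ⊎ Inv Ω (f k)) → product f ≈ 0# →
                  ∃ λ k → f k ≈ 0#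
    zero-factor {zero}  f dec e = contradiction e 1≉0
    zero-factor {suc n} f dec e with dec zero
    ... | inj₁ z = zero , z
    ... | inj₂ i with zero-factor (f ∘ suc) (dec ∘ suc) (inv-cancelˡ i (trans e (sym (zeroʳ _))))
    ... | k , z = suc k , z

  unity-enumeration : ∀ m → ∃ λ (ζ : Fin (suc m) → Carrier) →
    (∀ k → ζ k ^ suc m ≈ 1#) × (∀ {x} → x ^ suc m ≈ 1# → ∃ λ k → x ≈ ζ k)
  unity-enumeration m = r , unity , λ {x} e →
    let k , z = zero-factor (λ k → x - r k) (λ k → unity-≟ m e (unity k))
                  (trans (sym (value x)) (trans (+-congˡ e) (-‿inverseˡ 1#)))
    in k , trans (difference⇒≈ z) (+-identityʳ _)
    where
    a : Vector Carrier (suc m)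
    a zero    = - 1#
    a (suc _) = 0#
    r : Vector Carrier (suc m)
    r = proj₁ (factorise a)
    value : ∀ x → - 1# + x ^ suc m ≈ product (λ k → x - r k)
    value x = begin
      - 1# + x * x ^ m                          ≈⟨ +-congˡ (*-congˡ (+-identityʳ _)) ⟨
      - 1# + x * (x ^ m + 0#)                   ≈⟨ +-congˡ (*-congˡ (+-congˡ zeros)) ⟨
      - 1# + x * M.monicValue (a ∘ suc) x       ≈⟨ H.horner a x ⟨
      M.monicValue a x                          ≈⟨ proj₂ (factorise a) x ⟩
      product (λ k → x - r k)                   ∎
      where
      zeros : sum {m} (λ k → 0# * x ^ toℕ k) ≈ 0#
      zeros = sum-closed (_≈ 0#) refl (λ p q → trans (+-cong p q) (+-identityˡ 0#)) {m} _ (λ k → zeroˡ (x ^ toℕ k))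
    unity : ∀ k → r k ^ suc m ≈ 1#
    unity k = begin
      r k ^ suc m                    ≈⟨ difference⇒≈ (trans (+-comm _ _) (value (r k))) ⟩
      1# + product (λ j → r k - r j) ≈⟨ +-congˡ (product-zero (λ j → r k - r j) k (-‿inverseʳ (r k))) ⟩
      1# + 0#                        ≈⟨ +-identityʳ 1# ⟩
      1#                             ∎

module PAdicLemmas (p : ℕ) (p-prime : Prime p) where
  open PAdic p p-prime
  open CommutativeRing ℤₚ-ring hiding (zero)
  open Ops ℤₚ-ring
  open Congruence ℤₚ-ring using (mod)
  open RingLemmas ℤₚ-ring

  private instance
    p≢0 : ℕ.NonZero p
    p≢0 = prime⇒nonZero p-prime

  seq-· : ∀ m n → seq (m · 1#) n ≡ + m
  seq-· zero    n = ≡.refl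
  seq-· (suc m) n = ≡.cong (λ x → + 1 ℤ.+ x) (seq-· m n)

  seq-π^ : ∀ k n → seq ((p · 1#) ^ k) n ≡ + (p ℕ.^ k)
  seq-π^ zero    n = ≡.refl
  seq-π^ (suc k) n = ≡.trans (≡.cong₂ ℤ._*_ (seq-· p n) (seq-π^ k n)) (≡.sym (ℤₚᵣ.pos-* p (p ℕ.^ k)))

  pointwise : ∀ x y → (∀ n → seq x n ≡ seq y n) → x ≈ₚ y
  pointwise x y e = mk≈ₚ λ n → ℤ∣.divides (+ 0) (≡.trans (≡.cong (ℤ._- seq y n) (e n)) (ℤₚᵣ.+-inverseʳ (seq y n)))

  private
    ∣-sum : ∀ {d x y z} → d ℤ∣.∣ x → d ℤ∣.∣ y → x ℤ.+ y ≡ z → d ℤ∣.∣ z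
    ∣-sum h k ≡.refl = ℤ∣.∣m∣n⇒∣m+n h k

    partialSum : (ℕ → ℤₚ) → ℕ → ℕ → ℤ
    partialSum a zero    k = + 0
    partialSum a (suc m) k = partialSum a m k ℤ.+ + (p ℕ.^ m) ℤ.* seq (a m) k

    partialSum-coherent : ∀ a m k → + (p ℕ.^ k) ℤ∣.∣ partialSum a m (suc k) ℤ.- partialSum a m k
    partialSum-coherent a zero    k = ℤ∣.divides (+ 0) ≡.refl
    partialSum-coherent a (suc m) k =
      ∣-sum (partialSum-coherent a m k) (ℤ∣.∣n⇒∣m*n (+ (p ℕ.^ m)) (coherent (a m) k))
        (lemma (partialSum a m (suc k)) (partialSum a m k) (+ (p ℕ.^ m)) (seq (a m) (suc k)) (seq (a m) k))
      where
      lemma : ∀ x y P u v → (x ℤ.- y) ℤ.+ P ℤ.* (u ℤ.- v) ≡ (x ℤ.+ P ℤ.* u) ℤ.- (y ℤ.+ P ℤ.* v)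
      lemma = ℤSolver.solve-∀

    partialSum-step : ∀ a m k → partialSum a (suc m) k ≡ seq (a 0) k ℤ.+ + p ℤ.* partialSum (a ∘ suc) m k
    partialSum-step a zero    k = lemma (+ p) (seq (a 0) k)
      where
      lemma : ∀ P x → + 0 ℤ.+ + 1 ℤ.* x ≡ x ℤ.+ P ℤ.* + 0
      lemma = ℤSolver.solve-∀
    partialSum-step a (suc m) k = ≡.trans
      (≡.cong₂ ℤ._+_ (partialSum-step a m k) (≡.cong (ℤ._* seq (a (suc m)) k) (ℤₚᵣ.pos-* p (p ℕ.^ m))))
      (lemma (seq (a 0) k) (+ p) (partialSum (a ∘ suc) m k) (+ (p ℕ.^ m)) (seq (a (suc m)) k))
      where
      lemma : ∀ x P s Q y → (x ℤ.+ P ℤ.* s) ℤ.+ (P ℤ.* Q) ℤ.* y ≡ x ℤ.+ P ℤ.* (s ℤ.+ Q ℤ.* y)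
      lemma = ℤSolver.solve-∀

  series : (ℕ → ℤₚ) → ℤₚ
  series a = mkℤₚ (λ n → partialSum a n n) λ n →
    ∣-sum (partialSum-coherent a n n) (ℤ∣.∣m⇒∣m*n (seq (a n) (suc n)) ℤ∣.∣-refl)
      (lemma (partialSum a n (suc n)) (partialSum a n n) (+ (p ℕ.^ n) ℤ.* seq (a n) (suc n)))
    where
    lemma : ∀ x y u → (x ℤ.- y) ℤ.+ u ≡ (x ℤ.+ u) ℤ.- y
    lemma = ℤSolver.solve-∀

  abstract
    isPAdic : IsPAdic p (PAdic.ℤₚ-ring p p-prime)
    isPAdic .IsPAdic.series = series
    isPAdic .IsPAdic.series-step a = mk≈ₚ λ n → ≡.subst (+ (p ℕ.^ n) ℤ∣.∣_)
      (≡.trans (lemma (partialSum a n n) (+ (p ℕ.^ n) ℤ.* seq (a n) n))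
        (≡.cong (λ x → partialSum a n n ℤ.- x)
          (≡.trans (partialSum-step a n n)
            (≡.cong (λ P → seq (a 0) n ℤ.+ P ℤ.* partialSum (a ∘ suc) n n) (≡.sym (seq-· p n))))))
      (ℤ∣.∣m⇒∣-m (ℤ∣.∣m⇒∣m*n (seq (a n) n) ℤ∣.∣-refl))
      where
      lemma : ∀ x u → ℤ.- u ≡ x ℤ.- (x ℤ.+ u)
      lemma = ℤSolver.solve-∀
    isPAdic .IsPAdic.separated d h = mk≈ₚ λ n →
      ∣-sum (at (proj₂ (h n)) n) (ℤ∣.∣m⇒∣m*n (seq (proj₁ (h n)) n) ℤ∣.∣-refl)
        (≡.trans (≡.cong (λ P → (seq d n ℤ.- P ℤ.* seq (proj₁ (h n)) n) ℤ.+ + (p ℕ.^ n) ℤ.* seq (proj₁ (h n)) n) (seq-π^ n n))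
          (lemma (seq d n) (+ (p ℕ.^ n) ℤ.* seq (proj₁ (h n)) n)))
      where
      lemma : ∀ x y → (x ℤ.- y) ℤ.+ y ≡ x ℤ.- + 0
      lemma = ℤSolver.solve-∀
    isPAdic .IsPAdic.approximate a = m , mkℤₚ b b-coherent , mk≈ₚ λ n →
      ≡.subst (+ (p ℕ.^ n) ℤ∣.∣_)
        (≡.trans (lemma₁ (seq a (suc n)) (seq a n))
          (≡.cong (λ x → seq a n ℤ.- x)
            (≡.trans (lemma₂ (seq a (suc n)) (+ m)) (≡.cong₂ ℤ._+_ (≡.sym (seq-· m n))
              (≡.trans (p∣a-m n .ℤ∣._∣_.equality)
                (≡.trans (ℤₚᵣ.*-comm (b n) (+ p)) (≡.cong (ℤ._* b n) (≡.sym (seq-· p n)))))))))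
        (ℤ∣.∣m⇒∣-m (coherent a n))
      where
      m : ℕ
      m = seq a 1 ℤDivMod.%ℕ p
      p∣a-m : ∀ n → + p ℤ∣.∣ seq a (suc n) ℤ.- + m
      p∣a-m zero = ℤ∣.divides (seq a 1 ℤDivMod./ℕ p)
        (≡.trans (≡.cong (ℤ._- + m) (ℤDivMod.a≡a%ℕn+[a/ℕn]*n (seq a 1) p)) (lemma (+ m) _))
        where
        lemma : ∀ x y → (x ℤ.+ y) ℤ.- x ≡ y
        lemma = ℤSolver.solve-∀
      p∣a-m (suc n) = ∣-sum
        (ℤ∣.∣-trans (ℤ∣.divides (+ (p ℕ.^ n)) (≡.trans (ℤₚᵣ.pos-* p (p ℕ.^ n)) (ℤₚᵣ.*-comm (+ p) _))) (coherent a (suc n)))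
        (p∣a-m n) (lemma (seq a (suc (suc n))) (seq a (suc n)) (+ m))
        where
        lemma : ∀ x y z → (x ℤ.- y) ℤ.+ (y ℤ.- z) ≡ x ℤ.- z
        lemma = ℤSolver.solve-∀
      b : ℕ → ℤ
      b n = p∣a-m n .ℤ∣._∣_.quotient
      b-coherent : ∀ n → + (p ℕ.^ n) ℤ∣.∣ b (suc n) ℤ.- b n
      b-coherent n = ℤ∣.*-cancelˡ-∣ (+ p) (≡.subst₂ ℤ∣._∣_ (ℤₚᵣ.pos-* p (p ℕ.^ n))
        (≡.trans (lemma (seq a (suc (suc n))) (seq a (suc n)) (+ m))
          (≡.trans (≡.cong₂ ℤ._-_ (p∣a-m (suc n) .ℤ∣._∣_.equality) (p∣a-m n .ℤ∣._∣_.equality))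
            (lemma′ (b (suc n)) (b n) (+ p))))
        (coherent a (suc n)))
        where
        lemma : ∀ x y z → x ℤ.- y ≡ (x ℤ.- z) ℤ.- (y ℤ.- z)
        lemma = ℤSolver.solve-∀
        lemma′ : ∀ x y P → x ℤ.* P ℤ.- y ℤ.* P ≡ P ℤ.* (x ℤ.- y)
        lemma′ = ℤSolver.solve-∀
      lemma₁ : ∀ x y → ℤ.- (x ℤ.- y) ≡ y ℤ.- x
      lemma₁ = ℤSolver.solve-∀
      lemma₂ : ∀ x y → x ≡ y ℤ.+ (x ℤ.- y)
      lemma₂ = ℤSolver.solve-∀

record IsSubring (R : CommutativeRing c ℓ) (S : CommutativeRing.Carrier R → Set c₃) : Set (c ⊔ ℓ ⊔ c₃) where
  open CommutativeRing R
  field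
    S-+ : ∀ {x y} → S x → S y → S (x + y)
    S-* : ∀ {x y} → S x → S y → S (x * y)
    S-neg : ∀ {x} → S x → S (- x)
    S-0 : S 0#
    S-1 : S 1#

module Subring (R : CommutativeRing c ℓ) {S : CommutativeRing.Carrier R → Set c₃} (isSubring : IsSubring R S) where
  open CommutativeRing R
  open IsSubring isSubring

  private
    raw : RawRing (c ⊔ c₃) ℓ
    raw = record
      { Carrier = ∃ S
      ; _≈_ = λ x y → proj₁ x ≈ proj₁ y
      ; _+_ = λ { (x , u) (y , v) → x + y , S-+ u v }
      ; _*_ = λ { (x , u) (y , v) → x * y , S-* u v }
      ; -_  = λ { (x , u) → - x , S-neg u }
      ; 0#  = 0# , S-0
      ; 1#  = 1# , S-1 }

    hom : IsRingHomomorphism raw rawRing proj₁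
    hom = record
      { isSemiringHomomorphism = record
        { isNearSemiringHomomorphism = record
          { +-isMonoidHomomorphism = record
            { isMagmaHomomorphism = record
              { isRelHomomorphism = record { cong = id } ; homo = λ _ _ → refl }
            ; ε-homo = refl }
          ; *-homo = λ _ _ → refl }
        ; 1#-homo = refl }
      ; -‿homo = λ _ → refl }

    open RawRing raw renaming (_≈_ to _≈′_; _+_ to _+′_; _*_ to _*′_; -_ to -′_; 0# to 0′; 1# to 1′)
    abstract
      laws : IsCommutativeRing _≈′_ _+′_ _*′_ -′_ 0′ 1′
      laws = RingMono.isCommutativeRing
        (record { isRingHomomorphism = hom ; injective = id }) isCommutativeRing

  subring : CommutativeRing (c ⊔ c₃) ℓ
  subring = record { isCommutativeRing = laws }

  inclusion : RingHom subring R
  inclusion = proj₁ , hom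

module CongruenceLemmas (R : CommutativeRing c ℓ) where
  open CommutativeRing R hiding (zero)
  open Ops R
  open Congruence R
  open RingLemmas R
  open RingProps ring using (-0#≈0#)

  ≋⇒≈ : ∀ {x y a} → x ≋ y [mod a ] → ∃ λ k → x ≈ y + a * k
  ≋⇒≈ {a = a} (mod d) = RawMagmaOps._∣ʳ_.quotient d ,
    difference⇒≈ (trans (sym (RawMagmaOps._∣ʳ_.equality d)) (*-comm _ a))

  ≈⇒≋ : ∀ {x y a} → (∃ λ k → x ≈ y + a * k) → x ≋ y [mod a ]
  ≈⇒≋ {a = a} (k , e) = mod record { quotient = k ; equality = trans (*-comm k a) (sym (≈⇒difference e)) }

  toQuotient : ∀ a → RingHom R (Quotient R a)
  toQuotient a = id , record
    { isSemiringHomomorphism = record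
      { isNearSemiringHomomorphism = record
        { +-isMonoidHomomorphism = record
          { isMagmaHomomorphism = record
            { isRelHomomorphism = record { cong = L.≈⇒≋ } ; homo = λ _ _ → L.≈⇒≋ refl }
          ; ε-homo = L.≈⇒≋ refl }
        ; *-homo = λ _ _ → L.≈⇒≋ refl }
      ; 1#-homo = L.≈⇒≋ refl }
    ; -‿homo = λ _ → L.≈⇒≋ refl }
    where module L = CongruenceLaws R

  quotient-char : ∀ {a} n → a ≈ n · 1# → CommutativeRing._≈_ (Quotient R a) (Ops._·_ (Quotient R a) n 1#) 0#
  quotient-char {a} n a≈n = L.≋-trans (L.≋-sym (HomLemmas.φ-· R (Quotient R a) (toQuotient a) n))
    (≈⇒≋ (1# , trans (sym a≈n) (sym (trans (+-identityˡ _) (*-identityʳ _)))))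
    where module L = CongruenceLaws R

-- x ^ q ≡ x′ modulo p, with a witness so that it can be transported along homomorphisms.
module FrobeniusModP (R : CommutativeRing c ℓ) {p} (p-prime : Prime p) (r : ℕ) where
  open CommutativeRing R hiding (zero)
  open Ops R
  open CongruenceLemmas R
  private
    π = p · 1#
    q = p ℕ.^ r

    R/p : CommutativeRing c (c ⊔ ℓ)
    R/p = Quotient R π

    module R/p = CommutativeRing R/p
    module L = RingLemmas R/p
    module Char = L.CharP p-prime (quotient-char p refl)
    module H = HomLemmas R R/p (toQuotient π)
    _^′_ = Ops._^_ R/p

  Frobenius : Carrier → Carrier → Set (c ⊔ ℓ)
  Frobenius x x′ = ∃ λ z → x ^ q ≈ x′ + π * z

  private
    to : ∀ {x x′} → Frobenius x x′ → (x ^′ q) R/p.≈ x′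
    to {x} h = R/p.trans (R/p.sym (H.φ-^ x q)) (≈⇒≋ h)

    from : ∀ {x x′} → (x ^′ q) R/p.≈ x′ → Frobenius x x′
    from {x} h = ≋⇒≈ (R/p.trans (H.φ-^ x q) h)

  frobenius-+ : ∀ {x x′ y y′} → Frobenius x x′ → Frobenius y y′ → Frobenius (x + y) (x′ + y′)
  frobenius-+ h k = from (R/p.trans (Char.^-distrib-+ r _ _) (R/p.+-cong (to h) (to k)))

  frobenius-* : ∀ {x x′ y y′} → Frobenius x x′ → Frobenius y y′ → Frobenius (x * y) (x′ * y′)
  frobenius-* h k = from (R/p.trans (L.^-distrib-* _ _ q) (R/p.*-cong (to h) (to k)))

  frobenius-≡ℕ : ∀ {a} m b → a ≈ m · 1# + π * b → Frobenius a a
  frobenius-≡ℕ {a} m b e = from (R/p.trans (L.Ex.^-congˡ q a≈m) (R/p.trans (Char.multiple-frobenius r m) (R/p.sym a≈m)))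
    where
    a≈m : a R/p.≈ Ops._·_ R/p m 1#
    a≈m = R/p.trans (≈⇒≋ (b , e)) (H.φ-· m)

module SubringFrobenius (R : CommutativeRing c ℓ) {S : CommutativeRing.Carrier R → Set c₃}
                        (isSubring : IsSubring R S) {p} (p-prime : Prime p) (r : ℕ) where
  open CommutativeRing R hiding (zero)
  open Ops R
  open IsSubring isSubring
  open RingLemmas R using (0^; 1^; sum-closed; module Ex)
  private
    π = p · 1#
    q = p ℕ.^ r

    G : CommutativeRing (c ⊔ c₃) ℓ
    G = Subring.subring R isSubring

    module G = CommutativeRing G
    module H = HomLemmas G R (Subring.inclusion R isSubring)
    module F = FrobeniusModP G p-prime r

  Frobenius : Carrier → Carrier → Set (c ⊔ ℓ ⊔ c₃)
  Frobenius x x′ = S x × S x′ × ∃ λ z → S z × x ^ q ≈ x′ + π * z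

  private
    to : ∀ {x x′} → ((sx , sx′ , _) : Frobenius x x′) → F.Frobenius (x , sx) (x′ , sx′)
    to {x} (sx , sx′ , z , sz , e) = (z , sz) ,
      trans (H.φ-^ (x , sx) q) (trans e (+-congˡ (*-congʳ (sym (H.φ-· p)))))

    from : ∀ {x x′} (sx : S x) (sx′ : S x′) → F.Frobenius (x , sx) (x′ , sx′) → Frobenius x x′
    from {x} sx sx′ ((z , sz) , e) = sx , sx′ , z , sz ,
      trans (sym (H.φ-^ (x , sx) q)) (trans e (+-congˡ (*-congʳ (H.φ-· p))))

  frobenius-+ : ∀ {x x′ y y′} → Frobenius x x′ → Frobenius y y′ → Frobenius (x + y) (x′ + y′)
  frobenius-+ h@(sx , sx′ , _) k@(sy , sy′ , _) = from (S-+ sx sy) (S-+ sx′ sy′)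
    (F.frobenius-+ {_ , sx} {_ , sx′} {_ , sy} {_ , sy′} (to h) (to k))

  frobenius-* : ∀ {x x′ y y′} → Frobenius x x′ → Frobenius y y′ → Frobenius (x * y) (x′ * y′)
  frobenius-* h@(sx , sx′ , _) k@(sy , sy′ , _) = from (S-* sx sy) (S-* sx′ sy′)
    (F.frobenius-* {_ , sx} {_ , sx′} {_ , sy} {_ , sy′} (to h) (to k))

  frobenius-≡ℕ : ∀ {a} m b → S a → S b → a ≈ m · 1# + π * b → Frobenius a a
  frobenius-≡ℕ m b sa sb e = from sa sa (F.frobenius-≡ℕ m (b , sb)
    (trans e (sym (+-cong (H.φ-· m) (*-congʳ (H.φ-· p))))))

  frobenius-≈ : ∀ {x x′} → S x → S x′ → x ^ q ≈ x′ → Frobenius x x′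
  frobenius-≈ sx sx′ e = sx , sx′ , 0# , S-0 , trans e (sym (trans (+-congˡ (zeroʳ π)) (+-identityʳ _)))

  frobenius-cong : ∀ {x x′ y y′} → S y → S y′ → x ≈ y → x′ ≈ y′ → Frobenius x x′ → Frobenius y y′
  frobenius-cong sy sy′ e e′ (_ , _ , z , sz , h) = sy , sy′ , z , sz , trans (Ex.^-congˡ q (sym e)) (trans h (+-congʳ e′))

  frobenius-sum : 1 ℕ.≤ q → ∀ {n} (f f′ : Fin n → Carrier) → (∀ k → Frobenius (f k) (f′ k)) → Frobenius (sum f) (sum f′)
  frobenius-sum 1≤q {zero}  f f′ h = frobenius-≈ S-0 S-0 (≡.subst (λ n → 0# ^ n ≈ 0#) (ℕₚ.suc-pred q {{ℕ.>-nonZero 1≤q}}) (0^ (ℕ.pred q)))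
  frobenius-sum 1≤q {suc n} f f′ h = frobenius-+ (h zero) (frobenius-sum 1≤q (f ∘ suc) (f′ ∘ suc) (h ∘ suc))

module FrobeniusInvariants {p} {Z : CommutativeRing c₁ ℓ₁} {Ω : CommutativeRing c ℓ} {hom : RingHom Z Ω}
                           (setting : Setting p Z Ω hom)
                           (q r m : ℕ) (q-power : suc (suc q) ≡ p ℕ.^ suc r) where
  private module Z = CommutativeRing Z
  open Setting setting using (limits; approximate; p-prime)
  open FieldLemmas setting
  open CommutativeRing Ω hiding (zero)
  open Ops Ω
  open RingLemmas Ω
  private
    φ = proj₁ hom
    πZ = Ops._·_ Z p Z.1#
    module φ = IsRingHomomorphism (proj₂ hom)

    Q : ℕ
    Q = suc (suc q)

    ζ : Fin (suc m) → Carrier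
    ζ = proj₁ (unity-enumeration m)
    ζ-unity : ∀ k → ζ k ^ suc m ≈ 1#
    ζ-unity = proj₁ (proj₂ (unity-enumeration m))
    ζ-complete : ∀ {x} → x ^ suc m ≈ 1# → ∃ λ k → x ≈ ζ k
    ζ-complete = proj₂ (proj₂ (unity-enumeration m))

    B : CommutativeRing c ℓ
    B = Pointwise.commutativeRing ℕ Ω

    module B = CommutativeRing B
    module OB = Ops B

    Z→B : RingHom Z B
    Z→B = (λ z _ → φ z) , record
      { isSemiringHomomorphism = record
        { isNearSemiringHomomorphism = record
          { +-isMonoidHomomorphism = record
            { isMagmaHomomorphism = record
              { isRelHomomorphism = record { cong = λ e _ → φ.⟦⟧-cong e } ; homo = λ x y _ → φ.+-homo x y }
            ; ε-homo = λ _ → φ.0#-homo }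
          ; *-homo = λ x y _ → φ.*-homo x y }
        ; 1#-homo = λ _ → φ.1#-homo }
      ; -‿homo = λ x _ → φ.-‿homo x }

    shift : RingHom B B
    shift = (λ x j → x (suc j)) , record
      { isSemiringHomomorphism = record
        { isNearSemiringHomomorphism = record
          { +-isMonoidHomomorphism = record
            { isMagmaHomomorphism = record
              { isRelHomomorphism = record { cong = λ e j → e (suc j) } ; homo = λ x y _ → refl }
            ; ε-homo = λ _ → refl }
          ; *-homo = λ x y _ → refl }
        ; 1#-homo = λ _ → refl }
      ; -‿homo = λ x _ → refl }

    at : ℕ → RingHom B Ω
    at j = (λ x → x j) , record
      { isSemiringHomomorphism = record
        { isNearSemiringHomomorphism = record
          { +-isMonoidHomomorphism = record
            { isMagmaHomomorphism = record
              { isRelHomomorphism = record { cong = λ e → e j } ; homo = λ x y → refl }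
            ; ε-homo = refl }
          ; *-homo = λ x y → refl }
        ; 1#-homo = refl }
      ; -‿homo = λ x → refl }

    σ : B.Carrier → B.Carrier
    σ = proj₁ shift

    module Zspan = IntegralClosure Z B Z→B

    orbit : Carrier → B.Carrier
    orbit x j = x ^ (Q ℕ.^ j)

    orbit-cong : ∀ {x y} → x ≈ y → orbit x B.≈ orbit y
    orbit-cong e j = Ex.^-congˡ (Q ℕ.^ j) e

    orbit-* : ∀ x y → orbit x B.* orbit y B.≈ orbit (x * y)
    orbit-* x y j = sym (^-distrib-* x y (Q ℕ.^ j))

    shift-orbit : ∀ x → σ (orbit x) B.≈ orbit (x ^ Q)
    shift-orbit x j = sym (Ex.^-assocʳ x Q (Q ℕ.^ j))

    orbit-^Q : ∀ x → orbit x OB.^ Q B.≈ σ (orbit x)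
    orbit-^Q x j = trans (HomLemmas.φ-^ B Ω (at j) (orbit x) Q)
      (trans (Ex.^-assocʳ x (Q ℕ.^ j) Q) (Ex.^-congʳ x (ℕₚ.*-comm (Q ℕ.^ j) Q)))

    unity-* : ∀ {x y} → x ^ suc m ≈ 1# → y ^ suc m ≈ 1# → (x * y) ^ suc m ≈ 1#
    unity-* {x} {y} h k = trans (^-distrib-* x y (suc m)) (trans (*-cong h k) (*-identityˡ 1#))

    unity-^ : ∀ n {x} → x ^ suc m ≈ 1# → (x ^ n) ^ suc m ≈ 1#
    unity-^ zero    h = 1^ (suc m)
    unity-^ (suc n) h = unity-* h (unity-^ n h)

    e : Fin (suc m) → B.Carrier
    e k = orbit (ζ k)

    Span : B.Carrier → Set (c₁ ⊔ ℓ)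
    Span = Zspan.Span e

    span-orbit : ∀ {x} → x ^ suc m ≈ 1# → Span (orbit x)
    span-orbit h = Zspan.span-cong e (orbit-cong (sym (proj₂ (ζ-complete h)))) (Zspan.span-gen e (proj₁ (ζ-complete h)))

    span-* : ∀ {v w} → Span v → Span w → Span (v B.* w)
    span-* {v} {w} hv hw = Zspan.span-linear e v (λ t →
      Zspan.span-cong e (B.*-comm (e t) v) (Zspan.span-linear e (e t) (λ u →
        Zspan.span-cong e (B.sym (orbit-* (ζ t) (ζ u))) (span-orbit (unity-* (ζ-unity t) (ζ-unity u)))) hv)) hw

    span-1 : Span B.1#
    span-1 = Zspan.span-cong e (λ j → 1^ (Q ℕ.^ j)) (span-orbit (1^ (suc m)))

    span-φ : ∀ a → Span (proj₁ Z→B a)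
    span-φ a = Zspan.span-cong e (B.*-identityʳ _) (Zspan.span-scale e a span-1)

    span-neg : ∀ {v} → Span v → Span (B.- v)
    span-neg {v} h = Zspan.span-cong e (λ j → trans (*-congʳ (trans (φ.-‿homo Z.1#) (-‿cong φ.1#-homo))) (RingProps.-1*x≈-x ring (v j)))
      (Zspan.span-scale e (Z.- Z.1#) h)

    span-shift : ∀ {v} → Span v → Span (σ v)
    span-shift {v} (a , h) = Zspan.span-cong e
      (B.sym (B.trans (λ j → h (suc j)) (HomLemmas.φ-sum B B shift (λ k → proj₁ Z→B (a k) B.* e k))))
      (Zspan.span-sum e (λ k → proj₁ Z→B (a k) B.* σ (e k)) (λ k → Zspan.span-scale e (a k)
        (Zspan.span-cong e (B.sym (shift-orbit (ζ k))) (span-orbit (unity-^ Q (ζ-unity k))))))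

    span-isSubring : IsSubring B Span
    span-isSubring = record
      { S-+ = Zspan.span-+ e ; S-* = span-* ; S-neg = span-neg ; S-0 = Zspan.span-0 e ; S-1 = span-1 }

    module SF = SubringFrobenius B span-isSubring p-prime (suc r)

    frobenius-φ : ∀ a → SF.Frobenius (proj₁ Z→B a) (proj₁ Z→B a)
    frobenius-φ a = SF.frobenius-≡ℕ n (proj₁ Z→B b) (span-φ a) (span-φ b)
      (B.trans (λ _ → φ.⟦⟧-cong e′) (B.trans (λ _ → φ.+-homo _ _)
        (B.+-cong (φB-· n) (B.trans (λ _ → φ.*-homo πZ b) (B.*-congʳ (φB-· p))))))
      where
      n = proj₁ (approximate a)
      b = proj₁ (proj₂ (approximate a))
      e′ = proj₂ (proj₂ (approximate a))
      φB-· : ∀ n → proj₁ Z→B (Ops._·_ Z n Z.1#) B.≈ n OB.· B.1#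
      φB-· = HomLemmas.φ-· Z B Z→B

    frobenius-e : ∀ k → SF.Frobenius (e k) (σ (e k))
    frobenius-e k = SF.frobenius-≈ (span-orbit (ζ-unity k)) (span-shift (span-orbit (ζ-unity k)))
      (≡.subst (λ n → e k OB.^ n B.≈ σ (e k)) q-power (orbit-^Q (ζ k)))

    frobenius-shift : ∀ {v} → Span v → ∃ λ z → Span z × v OB.^ Q B.≈ σ v B.+ p OB.· B.1# B.* z
    frobenius-shift {v} h@(a , v≈) =
      ≡.subst (λ n → ∃ λ z → Span z × v OB.^ n B.≈ σ v B.+ p OB.· B.1# B.* z) (≡.sym q-power) (proj₂ (proj₂ frobenius-v))
      where
      f f′ : Fin (suc m) → B.Carrier
      f  k = proj₁ Z→B (a k) B.* e k
      f′ k = proj₁ Z→B (a k) B.* σ (e k)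
      frobenius-f : SF.Frobenius (OB.sum f) (OB.sum f′)
      frobenius-f = SF.frobenius-sum (≡.subst (1 ℕ.≤_) q-power (ℕ.s≤s ℕ.z≤n)) f f′
        (λ k → SF.frobenius-* (frobenius-φ (a k)) (frobenius-e k))
      σv≈ : OB.sum f′ B.≈ σ v
      σv≈ = B.sym (B.trans (λ j → v≈ (suc j)) (HomLemmas.φ-sum B B shift f))
      frobenius-v : SF.Frobenius v (σ v)
      frobenius-v = SF.frobenius-cong h (span-shift h) (B.sym v≈) σv≈ frobenius-f

  Invariant : Carrier → Set (ℓ ⊔ c₁)
  Invariant t = Span (λ _ → t)

  span-integral : ∀ {v} → Span v → ∀ j → IsIntegral (v j)
  span-integral (a , h) j = int-cong (sym (trans (h j) (HomLemmas.φ-sum B Ω (at j) (λ k → proj₁ Z→B (a k) B.* e k))))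
    (sum-closed IsIntegral int-0 int-+ _ (λ k → int-* (int-φ (a k)) (int-^ (Q ℕ.^ j) (int-unity m (ζ-unity k)))))

  invariant⇒integral : ∀ {t} → Invariant t → IsIntegral t
  invariant⇒integral h = span-integral h 0

  constant : ∀ {v} → Span v → (∀ j → v j ≈ v 0) → Invariant (v 0)
  constant h h′ = Zspan.span-cong e h′ h

  invariant-cong : ∀ {t u} → t ≈ u → Invariant t → Invariant u
  invariant-cong h = Zspan.span-cong e (λ _ → h)

  invariant-isSubring : IsSubring Ω Invariant
  invariant-isSubring = record
    { S-+ = λ {x} {y} → Zspan.span-+ e {λ _ → x} {λ _ → y}
    ; S-* = λ {x} {y} → span-* {λ _ → x} {λ _ → y}
    ; S-neg = λ {x} → span-neg {λ _ → x}
    ; S-0 = Zspan.span-0 e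
    ; S-1 = span-1 }

  open IsSubring invariant-isSubring public using ()
    renaming (S-+ to invariant-+; S-* to invariant-*; S-neg to invariant-neg; S-0 to invariant-0; S-1 to invariant-1)

  invariant-φ : ∀ a → Invariant (φ a)
  invariant-φ = span-φ

  invariant-unity : ∀ {ω} → ω ^ suc m ≈ 1# → ω ^ Q ≈ ω → Invariant ω
  invariant-unity {ω} h fixed = Zspan.span-cong e orbit-constant (span-orbit h)
    where
    orbit-constant : ∀ j → ω ^ (Q ℕ.^ j) ≈ ω
    orbit-constant zero    = *-identityʳ ω
    orbit-constant (suc j) = trans (sym (Ex.^-assocʳ ω Q (Q ℕ.^ j))) (trans (Ex.^-congˡ (Q ℕ.^ j) fixed) (orbit-constant j))

  invariant-frobenius : ∀ {t} → Invariant t → ∃ λ y → Invariant y × t ^ Q ≈ t + π * y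
  invariant-frobenius {t} h = z 0 , constant (proj₁ (proj₂ shifted)) z-constant , at-eq 0
    where
    shifted : ∃ λ z → Span z × (λ _ → t) OB.^ Q B.≈ (λ _ → t) B.+ p OB.· B.1# B.* z
    shifted = frobenius-shift {λ _ → t} h
    z : B.Carrier
    z = proj₁ shifted
    at-eq : ∀ j → t ^ Q ≈ t + π * z j
    at-eq j = trans (sym (HomLemmas.φ-^ B Ω (at j) (λ _ → t) Q))
      (trans (proj₂ (proj₂ shifted) j) (+-congˡ (*-congʳ (HomLemmas.φ-· B Ω (at j) p))))
    z-constant : ∀ j → z j ≈ z 0
    z-constant j = inv-cancelˡ inv-π (RingProps.+-cancelˡ ring t _ _ (trans (sym (at-eq j)) (at-eq 0)))

  O : CommutativeRing (c ⊔ c₁ ⊔ ℓ) ℓ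
  O = Subring.subring Ω invariant-isSubring

  private
    module O = CommutativeRing O
    module OO = Ops O
    module OH = HomLemmas O Ω (Subring.inclusion Ω invariant-isSubring)

    πO : O.Carrier
    πO = p OO.· O.1#

    O-separated : Separated O p
    O-separated (d , _) h = separated d λ n → proj₁ (proj₁ (h n)) , invariant⇒integral (proj₂ (proj₁ (h n))) ,
      trans (proj₂ (h n)) (*-congʳ (trans (OH.φ-^ πO n) (Ex.^-congˡ n (OH.φ-· p))))

  invariant-limit : (y : ℕ → Carrier) → (∀ n → Invariant (y n)) →
                    ∃ λ (x : ℕ → Carrier) → (∀ n → Invariant (x n)) × (∀ n → x n ≈ y n + π * x (suc n))
  invariant-limit y h = (λ n → x n 0) , (λ n → constant (x-span n) (x-constant n)) , (λ n → x-step n 0)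
    where
    coefficient : Fin (suc m) → ℕ → Z.Carrier
    coefficient k n = proj₁ (h n) k
    b : Fin (suc m) → ℕ → Z.Carrier
    b k = proj₁ (limits (coefficient k))
    x : ℕ → B.Carrier
    x n j = sum (λ k → φ (b k n) * e k j)
    x-span : ∀ n → Span (x n)
    x-span n = (λ k → b k n) , (λ j → sym (HomLemmas.φ-sum B Ω (at j) (λ k → proj₁ Z→B (b k n) B.* e k)))
    y-sum : ∀ n j → y n ≈ sum (λ k → φ (coefficient k n) * e k j)
    y-sum n j = trans (proj₂ (h n) j) (HomLemmas.φ-sum B Ω (at j) (λ k → proj₁ Z→B (coefficient k n) B.* e k))
    x-step : ∀ n j → x n j ≈ y n + π * x (suc n) j
    x-step n j = begin
      sum (λ k → φ (b k n) * e k j)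
        ≈⟨ S.sum-cong-≋ {suc m} (λ k → term k) ⟩
      sum (λ k → φ (coefficient k n) * e k j + π * (φ (b k (suc n)) * e k j))
        ≈⟨ S.∑-distrib-+ {suc m} (λ k → φ (coefficient k n) * e k j) (λ k → π * (φ (b k (suc n)) * e k j)) ⟩
      sum (λ k → φ (coefficient k n) * e k j) + sum (λ k → π * (φ (b k (suc n)) * e k j))
        ≈⟨ +-cong (y-sum n j) (S.*-distribˡ-sum {suc m} π (λ k → φ (b k (suc n)) * e k j)) ⟨
      y n + π * x (suc n) j ∎
      where
      open SetoidReasoning setoid
      term : ∀ k → φ (b k n) * e k j ≈ φ (coefficient k n) * e k j + π * (φ (b k (suc n)) * e k j)
      term k = trans (*-congʳ (trans (φ.⟦⟧-cong (proj₂ (limits (coefficient k)) n))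
        (trans (φ.+-homo _ _) (+-congˡ (trans (φ.*-homo πZ _) (*-congʳ φπ))))))
        (trans (distribʳ _ _ _) (+-congˡ (*-assoc _ _ _)))
    x-constant : ∀ n j → x n j ≈ x n 0
    x-constant n j = trans (difference⇒≈ (descend (λ i → x (i ℕ.+ n) j - x (i ℕ.+ n) 0)
      (λ i → int-+ (span-integral (x-span (i ℕ.+ n)) j) (int-neg (span-integral (x-span (i ℕ.+ n)) 0)))
      (λ i → difference (x-step (i ℕ.+ n) j) (x-step (i ℕ.+ n) 0)))) (+-identityʳ _)
      where
      difference : ∀ {x y u v z} → x ≈ z + π * u → y ≈ z + π * v → x - y ≈ π * (u - v)
      difference {u = u} {v} h k = trans (≈⇒difference (+-swap-difference h k))
        (trans (+-congˡ (RingProps.-‿distribʳ-* ring π v)) (sym (distribˡ π u (- v))))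

  private
    O-limits : HasLimits O p
    O-limits y = (λ n → proj₁ lim n , proj₁ (proj₂ lim) n) , λ n →
      trans (proj₂ (proj₂ lim) n) (+-congˡ (*-congʳ (sym (OH.φ-· p))))
      where lim = invariant-limit (λ n → proj₁ (y n)) (λ n → proj₂ (y n))

    p^r : O.Carrier
    p^r = (p ℕ.^ r) OO.· O.1#

    Q≈0 : Q OO.· O.1# O.≈ πO O.* p^r
    Q≈0 = O.trans {Q OO.· O.1#} {(p ℕ.* p ℕ.^ r) OO.· O.1#} {πO O.* p^r} (O.reflexive (≡.cong (λ n → n OO.· O.1#) q-power)) (RingLemmas.Mu.×1-homo-* O p (p ℕ.^ r))

    O-frobenius : ∀ t → ∃ λ y → t OO.^ Q O.≈ t O.+ πO O.* y
    O-frobenius (t , h) = (proj₁ frob , proj₁ (proj₂ frob)) ,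
      trans (OH.φ-^ (t , h) Q) (trans (proj₂ (proj₂ frob)) (+-congˡ (*-congʳ (sym (OH.φ-· p)))))
      where frob = invariant-frobenius h

  Digit : Carrier → Set (c ⊔ ℓ ⊔ c₁)
  Digit t = ∃ λ ω → (ω ≈ 0# ⊎ ω ^ suc q ≈ 1#) × ∃ λ t′ → Invariant t′ × t ≈ ω + π * t′

  digit : ∀ {t} → Invariant t → Digit t
  digit {t} h = proj₁ T.T , fixed-point q (trans (sym (OH.φ-^ T.T Q)) T.T^q≈T) ,
    proj₁ (proj₁ T.t≈T) , proj₂ (proj₁ T.t≈T) , trans (proj₂ T.t≈T) (+-congˡ (*-congʳ (OH.φ-· p)))
    where module T = Complete.Teichmüller O p O-limits O-separated {suc q} {p^r} Q≈0 O-frobenius (t , h)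

  invariant-geometric : ∀ {s} → Invariant s → ∃ λ x → Invariant x × (1# + π * s) * x ≈ 1#
  invariant-geometric {s} h = proj₁ (proj₁ inverse) , proj₂ (proj₁ inverse) ,
    trans (*-congʳ (+-congˡ (*-congʳ (sym (OH.φ-· p))))) (proj₂ inverse)
    where
    inverse : ∃ λ x → (O.1# O.+ πO O.* (s , h)) O.* x O.≈ O.1#
    inverse = Complete.geometric O p O-limits O-separated (s , h)

  invariant-trace : ∀ i {w} → w ^ suc m ≈ 1# → w ^ (Q ℕ.^ i) ≈ w → Invariant (sum {i} (λ j → w ^ (Q ℕ.^ toℕ j)))
  invariant-trace i {w} h fixed = Zspan.span-cong e conjugates
    (Zspan.span-sum e {i} (λ j → orbit (w ^ (Q ℕ.^ toℕ j))) (λ j → span-orbit (unity-^ (Q ℕ.^ toℕ j) h)))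
    where
    rotated : ℕ → Carrier
    rotated s = sum {i} (λ j → w ^ (Q ℕ.^ (toℕ j ℕ.+ s)))
    rotated-suc : ∀ s → rotated (suc s) ≈ rotated s
    rotated-suc s = trans
      (S.sum-cong-≋ {i} (λ j → Ex.^-congʳ w (≡.cong (Q ℕ.^_) (ℕₚ.+-suc (toℕ j) s))))
      (sum-rotate +-commutativeMonoid (λ j → w ^ (Q ℕ.^ (j ℕ.+ s))) i
        (trans (Ex.^-congʳ w (ℕₚ.^-distribˡ-+-* Q i s))
        (trans (sym (Ex.^-assocʳ w (Q ℕ.^ i) (Q ℕ.^ s))) (Ex.^-congˡ (Q ℕ.^ s) fixed))))
    rotated≈ : ∀ s → rotated s ≈ sum {i} (λ j → w ^ (Q ℕ.^ toℕ j))
    rotated≈ zero    = S.sum-cong-≋ {i} (λ j → Ex.^-congʳ w (≡.cong (Q ℕ.^_) (ℕₚ.+-identityʳ (toℕ j))))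
    rotated≈ (suc s) = trans (rotated-suc s) (rotated≈ s)
    conjugates : ∀ s → OB.sum {i} (λ j → orbit (w ^ (Q ℕ.^ toℕ j))) s ≈ sum {i} (λ j → w ^ (Q ℕ.^ toℕ j))
    conjugates s = trans (HomLemmas.φ-sum B Ω (at s) {i} (λ j → orbit (w ^ (Q ℕ.^ toℕ j))))
      (trans (S.sum-cong-≋ {i} (λ j → trans (Ex.^-assocʳ w (Q ℕ.^ toℕ j) (Q ℕ.^ s))
        (Ex.^-congʳ w (≡.sym (ℕₚ.^-distribˡ-+-* Q (toℕ j) s))))) (rotated≈ s))

  invariant-elim : ∀ (P : Carrier → Set c₃) → (∀ {x y} → x ≈ y → P x → P y) → P 0# → (∀ {x y} → P x → P y → P (x + y)) →
                   (∀ a {ω} → ω ^ suc m ≈ 1# → P (φ a * ω)) → ∀ {t} → Invariant t → P t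
  invariant-elim P P≈ P0 P+ Pterm (a , h) = P≈
    (sym (trans (h 0) (HomLemmas.φ-sum B Ω (at 0) (λ k → proj₁ Z→B (a k) B.* e k))))
    (sum-closed P P0 P+ _ (λ k → Pterm (a k) (unity-^ (Q ℕ.^ 0) (ζ-unity k))))

-- ℤ[ Q ] = ℤₚ[μ_{Q-1}], where Q = q + 2.
module UnramifiedIntegers {p} {Z : CommutativeRing c₁ ℓ₁} {Ω : CommutativeRing c ℓ} {hom : RingHom Z Ω}
                          (setting : Setting p Z Ω hom) (q r : ℕ) (q-power : suc (suc q) ≡ p ℕ.^ suc r) where
  open FrobeniusInvariants setting q r q q-power public
  open FieldLemmas setting
  open Setting setting using (scale)
  open CommutativeRing Ω hiding (zero)
  open Ops Ω
  open RingLemmas Ω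
  open Solver commutativeSemiring using (solve; _:+_; _:*_; _:=_)
  open SetoidReasoning setoid

  unity∈ : ∀ {ω} → ω ^ suc q ≈ 1# → Invariant ω
  unity∈ h = invariant-unity h (trans (*-congˡ h) (*-identityʳ _))

  Teichmüller∈ : ∀ {ω} → ω ≈ 0# ⊎ ω ^ suc q ≈ 1# → Invariant ω
  Teichmüller∈ (inj₁ h) = invariant-cong (sym h) invariant-0
  Teichmüller∈ (inj₂ h) = unity∈ h

  ℕ∈ : ∀ n → Invariant (n · 1#)
  ℕ∈ zero    = invariant-0
  ℕ∈ (suc n) = invariant-+ invariant-1 (ℕ∈ n)

  π^∈ : ∀ n → Invariant (π ^ n)
  π^∈ zero    = invariant-1
  π^∈ (suc n) = invariant-* (ℕ∈ p) (π^∈ n)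

  private
    LeadingDigit : Carrier → Set (c ⊔ ℓ ⊔ c₁)
    LeadingDigit t = ∃ λ n → ∃ λ ω → ∃ λ t′ → ω ^ suc q ≈ 1# × Invariant t′ × t ≈ π ^ n * (ω + π * t′)

    Divides : ℕ → Set (c ⊔ ℓ ⊔ c₁)
    Divides D = 0 ℕ.< D → ∀ {t s} → Invariant t → IsIntegral s → D · 1# ≈ t * s → LeadingDigit t

  -- A divisor of D has its first nonzero digit at a place bounded by the p-adic valuation of D.
  leading-digit : ∀ D → Divides D
  leading-digit = <-rec Divides step
    where
    step : ∀ D → (∀ {D₁} → D₁ ℕ.< D → Divides D₁) → Divides D
    step D rec 0<D {t} {s} ht hs e = by-digit (digit ht)
      where
      by-valuation : ∀ {t′} → Invariant t′ → t ≈ π * t′ → LeadingDigit t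
      by-valuation {t′} ht′ t≈ with p ℕ∣.∣? D
      ... | no p∤D = contradiction (trans e (trans (*-congʳ t≈) (*-assoc π t′ s)))
              (p∤⇒π∤ p∤D (int-* (invariant⇒integral ht′) hs))
      ... | yes (ℕ∣.divides D₁ D≡) =
        let 0<D₁ , D₁<D = quotient-p {D} {D₁} D≡ 0<D
            n , ω′ , t″ , unity , ht″ , eq′ = rec {D₁} D₁<D 0<D₁ ht′ hs (cancel-p {D} {D₁} D≡ (trans e (*-congʳ t≈)))
        in suc n , ω′ , t″ , unity , ht″ , trans t≈ (trans (*-congˡ eq′) (sym (*-assoc π (π ^ n) _)))
      by-digit : Digit t → LeadingDigit t
      by-digit (ω , inj₂ unity , t′ , ht′ , eq) = 0 , ω , t′ , unity , ht′ , trans eq (sym (*-identityˡ _))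
      by-digit (ω , inj₁ ω≈0 , t′ , ht′ , eq) = by-valuation ht′ (trans eq (trans (+-congʳ ω≈0) (+-identityˡ _)))

  inverse∈ : ∀ {t y} → Invariant t → t * y ≈ 1# → ∃ λ n → Invariant (π ^ n * y)
  inverse∈ {t} {y} ht ty≈1 = n , invariant-cong (sym π^n*y≈) (invariant-* (unity∈ ω⁻¹-unity) (proj₁ (proj₂ inv)))
    where
    D : ℕ
    D = suc (proj₁ (scale y))
    leading : LeadingDigit t
    leading = leading-digit D (ℕ.s≤s ℕ.z≤n) ht (proj₂ (scale y)) (sym (begin
      t * ((D · 1#) * y)   ≈⟨ solve 3 (λ t D y → t :* (D :* y) := D :* (t :* y)) refl t (D · 1#) y ⟩
      (D · 1#) * (t * y)   ≈⟨ *-congˡ ty≈1 ⟩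
      (D · 1#) * 1#        ≈⟨ *-identityʳ _ ⟩
      D · 1#               ∎))
    n : ℕ
    n = proj₁ leading
    ω t′ ω⁻¹ : Carrier
    ω = proj₁ (proj₂ leading)
    t′ = proj₁ (proj₂ (proj₂ leading))
    ω⁻¹ = ω ^ q
    ω-unity : ω ^ suc q ≈ 1#
    ω-unity = proj₁ (proj₂ (proj₂ (proj₂ leading)))
    t≈ : t ≈ π ^ n * (ω + π * t′)
    t≈ = proj₂ (proj₂ (proj₂ (proj₂ (proj₂ leading))))
    ω⁻¹-unity : ω⁻¹ ^ suc q ≈ 1#
    ω⁻¹-unity = trans (Ex.^-assocʳ ω q (suc q)) (trans (Ex.^-congʳ ω (ℕₚ.*-comm q (suc q)))
      (trans (sym (Ex.^-assocʳ ω (suc q) q)) (trans (Ex.^-congˡ q ω-unity) (1^ q))))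
    inv : ∃ λ g → Invariant g × (1# + π * (ω⁻¹ * t′)) * g ≈ 1#
    inv = invariant-geometric (invariant-* (unity∈ ω⁻¹-unity) (proj₁ (proj₂ (proj₂ (proj₂ (proj₂ leading))))))
    g : Carrier
    g = proj₁ inv
    unit : (ω + π * t′) * (ω⁻¹ * g) ≈ 1#
    unit = begin
      (ω + π * t′) * (ω⁻¹ * g)
        ≈⟨ solve 5 (λ w π t v g → (w :+ π :* t) :* (v :* g) := (w :* v :+ π :* (v :* t)) :* g) refl ω π t′ ω⁻¹ g ⟩
      (ω * ω⁻¹ + π * (ω⁻¹ * t′)) * g
        ≈⟨ *-congʳ (+-congʳ ω-unity) ⟩
      (1# + π * (ω⁻¹ * t′)) * g
        ≈⟨ proj₂ (proj₂ inv) ⟩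
      1# ∎
    π^n*y≈ : π ^ n * y ≈ ω⁻¹ * g
    π^n*y≈ = inv-cancelˡ (_ , unit) (begin
      (ω + π * t′) * (π ^ n * y)   ≈⟨ solve 3 (λ u P y → u :* (P :* y) := P :* u :* y) refl (ω + π * t′) (π ^ n) y ⟩
      π ^ n * (ω + π * t′) * y     ≈⟨ *-congʳ t≈ ⟨
      t * y                        ≈⟨ ty≈1 ⟩
      1#                           ≈⟨ unit ⟨
      (ω + π * t′) * (ω⁻¹ * g)     ∎)

  saturated : ∀ k {x} → IsIntegral x → Invariant (π ^ k * x) → Invariant x
  saturated zero    hx h = invariant-cong (*-identityˡ _) h
  saturated (suc k) {x} hx h = by-digit (digit h)
    where
    by-digit : Digit (π ^ suc k * x) → Invariant x
    by-digit (ω , inj₁ ω≈0 , t′ , ht′ , e) = saturated k hx (invariant-cong (inv-cancelˡ inv-π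
      (trans (sym (trans e (trans (+-congʳ ω≈0) (+-identityˡ _)))) (*-assoc π (π ^ k) x))) ht′)
    by-digit (ω , inj₂ unity , t′ , ht′ , e) = contradiction 1/π≈ (1/p-not-integral
      (int-* (int-+ (int-* (int-^ k (int-· p)) hx) (int-neg (invariant⇒integral ht′))) (int-^ q (int-unity q unity))))
      where
      1/π≈ : π * ((π ^ k * x - t′) * ω ^ q) ≈ 1#
      1/π≈ = begin
        π * ((π ^ k * x - t′) * ω ^ q)
          ≈⟨ *-assoc π _ _ ⟨
        π * (π ^ k * x - t′) * ω ^ q
          ≈⟨ *-congʳ (trans (distribˡ π _ _) (+-cong (trans (sym (*-assoc π _ _)) e) (sym (RingProps.-‿distribʳ-* ring π t′)))) ⟩
        (ω + π * t′ - π * t′) * ω ^ q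
          ≈⟨ *-congʳ (trans (+-assoc _ _ _) (trans (+-congˡ (-‿inverseʳ _)) (+-identityʳ ω))) ⟩
        ω * ω ^ q
          ≈⟨ unity ⟩
        1# ∎

  -- The digits of an element of ℤₚ[μ_m] that is invariant under ζ ↦ ζ^Q lie in ℤₚ[μ_{Q-1}].
  descent : ∀ m {t} → FrobeniusInvariants.Invariant setting q r m q-power t → Invariant t
  descent m {t} h = invariant-cong (sym t≈x) (proj₁ (proj₂ lim) 0)
    where
    module I = FrobeniusInvariants setting q r m q-power
    ts : ℕ → ∃ I.Invariant
    ts zero    = t , h
    ts (suc n) = let _ , _ , t′ , h′ , _ = I.digit (proj₂ (ts n)) in t′ , h′
    ω : ℕ → Carrier
    ω n = proj₁ (I.digit (proj₂ (ts n)))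
    ts-step : ∀ n → proj₁ (ts n) ≈ ω n + π * proj₁ (ts (suc n))
    ts-step n = proj₂ (proj₂ (proj₂ (proj₂ (I.digit (proj₂ (ts n))))))
    lim : ∃ λ (x : ℕ → Carrier) → (∀ n → Invariant (x n)) × (∀ n → x n ≈ ω n + π * x (suc n))
    lim = invariant-limit ω (λ n → Teichmüller∈ (proj₁ (proj₂ (I.digit (proj₂ (ts n))))))
    x : ℕ → Carrier
    x = proj₁ lim
    t≈x : t ≈ x 0
    t≈x = trans (difference⇒≈ (descend (λ n → proj₁ (ts n) - x n)
      (λ n → int-+ (I.invariant⇒integral (proj₂ (ts n))) (int-neg (invariant⇒integral (proj₁ (proj₂ lim) n))))
      (λ n → trans (≈⇒difference (+-swap-difference (ts-step n) (proj₂ (proj₂ lim) n)))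
        (trans (+-congˡ (RingProps.-‿distribʳ-* ring π _)) (sym (distribˡ π _ _)))))) (+-identityʳ _)

  trace∈ : ∀ i m {w} → w ^ suc m ≈ 1# → w ^ (suc (suc q) ℕ.^ i) ≈ w →
           Invariant (sum {i} (λ j → w ^ (suc (suc q) ℕ.^ toℕ j)))
  trace∈ i m h fixed = descent m (FrobeniusInvariants.invariant-trace setting q r m q-power i h fixed)

module AdjoinLemmas {p} {Z : CommutativeRing c₁ ℓ₁} {K : CommutativeRing c₂ ℓ₂} {Ω : CommutativeRing c ℓ}
                    (Z→K : RingHom Z K) (K→Ω : RingHom K Ω)
                    (setting : Setting p Z Ω (compose {A = Z} {K} {Ω} Z→K K→Ω))
                    (denominators : HasDenominators Z K Z→K)
                    (q r : ℕ) (q-power : suc (suc q) ≡ p ℕ.^ suc r) where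
  open HasDenominators denominators
  open RingOfIntegers Z K Ω Z→K K→Ω using (Adjoin; base; gen; add; mul; inv; resp)
  open UnramifiedIntegers setting q r q-power
  open FieldLemmas setting
  open Setting setting using (inv-ℕ)
  open CommutativeRing Ω hiding (zero)
  open Ops Ω
  open RingLemmas Ω
  open Solver commutativeSemiring using (solve; _:+_; _:*_; _:=_)
  private
    module K→Ω = IsRingHomomorphism (proj₂ K→Ω)

    Localised : Carrier → Set (c₁ ⊔ ℓ)
    Localised x = ∃ λ k → Invariant (π ^ k * x)

    localised-* : ∀ {x y} → Localised x → Localised y → Localised (x * y)
    localised-* {x} {y} (k , h) (l , h′) = k ℕ.+ l , invariant-cong (trans
      (solve 4 (λ P x R y → P :* x :* (R :* y) := P :* R :* (x :* y)) refl (π ^ k) x (π ^ l) y)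
      (*-congʳ (sym (Ex.^-homo-* π k l)))) (invariant-* h h′)

    localised-+ : ∀ {x y} → Localised x → Localised y → Localised (x + y)
    localised-+ {x} {y} (k , h) (l , h′) = k ℕ.+ l , invariant-cong (trans
      (solve 4 (λ P x R y → R :* (P :* x) :+ P :* (R :* y) := P :* R :* (x :+ y)) refl (π ^ k) x (π ^ l) y)
      (*-congʳ (sym (Ex.^-homo-* π k l)))) (invariant-+ (invariant-* (π^∈ l) h) (invariant-* (π^∈ k) h′))

    localised-inv : ∀ {x y} → Localised x → x * y ≈ 1# → Localised y
    localised-inv {x} {y} (k , h) xy≈1 = n , invariant-cong (trans
        (solve 4 (λ P R y u → P :* (R :* (y :* u)) := P :* u :* (R :* y)) refl (π ^ k) (π ^ n) y u)
        (trans (*-congʳ π^ku≈1) (*-identityˡ _))) (invariant-* (π^∈ k) (proj₂ inverse))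
      where
      u : Carrier
      u = proj₁ (inv-^ k inv-π)
      π^ku≈1 : π ^ k * u ≈ 1#
      π^ku≈1 = proj₂ (inv-^ k inv-π)
      inverse : ∃ λ n → Invariant (π ^ n * (y * u))
      inverse = inverse∈ h (trans (solve 4 (λ P x y u → P :* x :* (y :* u) := P :* u :* (x :* y)) refl (π ^ k) x y u)
        (trans (*-cong π^ku≈1 xy≈1) (*-identityˡ 1#)))
      n : ℕ
      n = proj₁ inverse

    localised : ∀ {x} → Invariant x → Localised x
    localised h = 0 , invariant-cong (sym (*-identityˡ _)) h

    localised-cong : ∀ {x y} → x ≈ y → Localised x → Localised y
    localised-cong e (k , h) = k , invariant-cong (*-congˡ e) h

    localised-base : ∀ a → Localised (proj₁ K→Ω a)
    localised-base a = localised-cong a≈ (localised-*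
        (localised-inv (localised (ℕ∈ (suc D))) (proj₂ (inv-ℕ D))) (localised (invariant-φ z)))
      where
      D : ℕ
      D = proj₁ (fraction a)
      z : CommutativeRing.Carrier Z
      z = proj₁ (proj₂ (fraction a))
      D⁻¹ : Carrier
      D⁻¹ = proj₁ (inv-ℕ D)
      a≈ : D⁻¹ * proj₁ K→Ω (proj₁ Z→K z) ≈ proj₁ K→Ω a
      a≈ = inv-cancelˡ (inv-ℕ D) (trans (sym (*-assoc _ D⁻¹ _)) (trans (*-congʳ (proj₂ (inv-ℕ D))) (trans (*-identityˡ _)
        (trans (sym (K→Ω.⟦⟧-cong (proj₂ (proj₂ (fraction a))))) (trans (K→Ω.*-homo _ a) (*-congʳ (HomLemmas.φ-· K Ω K→Ω (suc D))))))))

  adjoin⇒localised : ∀ {x} → Adjoin (λ x → x ^ suc q ≈ 1#) x → ∃ λ k → Invariant (π ^ k * x)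
  adjoin⇒localised (base a)   = localised-base a
  adjoin⇒localised (gen h)    = localised (unity∈ h)
  adjoin⇒localised (add u v)  = localised-+ (adjoin⇒localised u) (adjoin⇒localised v)
  adjoin⇒localised (mul u v)  = localised-* (adjoin⇒localised u) (adjoin⇒localised v)
  adjoin⇒localised (inv u e)  = localised-inv (adjoin⇒localised u) e
  adjoin⇒localised (resp e u) = localised-cong e (adjoin⇒localised u)

  integer⇒invariant : ∀ {x} → Adjoin (λ x → x ^ suc q ≈ 1#) x → IsIntegral x → Invariant x
  integer⇒invariant h int = let k , h′ = adjoin⇒localised h in saturated k int h′

geometricSum : ℕ → ℕ → ℕ
geometricSum q zero    = 0
geometricSum q (suc i) = suc (q ℕ.* geometricSum q i)

geometricSum-* : ∀ q i → suc (q ℕ.* geometricSum (suc q) i) ≡ suc q ℕ.^ i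
geometricSum-* q zero    = ≡.cong suc (ℕₚ.*-zeroʳ q)
geometricSum-* q (suc i) = ≡.trans (lemma q (geometricSum (suc q) i)) (≡.cong (suc q ℕ.*_) (geometricSum-* q i))
  where
  lemma : ∀ q T → suc (q ℕ.* suc (suc q ℕ.* T)) ≡ suc q ℕ.* suc (q ℕ.* T)
  lemma = ℕSolver.solve-∀

record Character (S : CommutativeRing c ℓ) (N : ℕ) : Set (c ⊔ ℓ) where
  open CommutativeRing S
  open Ops S
  field
    χ   : Vec ℕ N → Carrier
    χ-0 : χ (Vec.replicate N 0) ≈ 1#
    χ-+ : ∀ α β → χ (Vec.zipWith ℕ._+_ α β) ≈ χ α * χ β
    χ-* : ∀ n α → χ (Vec.map (n ℕ.*_) α) ≈ χ α ^ n

module Characters (S : CommutativeRing c ℓ) where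
  open CommutativeRing S hiding (zero)
  open Ops S
  open RingLemmas S
  open Polynomials S using (monomial)
  open Solver commutativeSemiring using (solve; _:+_; _:*_; _:=_)

  infixl 8 _↑_
  _↑_ : ∀ {N} → Character S N → ℕ → Character S N
  X ↑ n = record
    { χ   = λ α → χ α ^ n
    ; χ-0 = trans (Ex.^-congˡ n χ-0) (1^ n)
    ; χ-+ = λ α β → trans (Ex.^-congˡ n (χ-+ α β)) (^-distrib-* (χ α) (χ β) n)
    ; χ-* = λ m α → trans (Ex.^-congˡ n (χ-* m α)) (trans (Ex.^-assocʳ (χ α) m n)
              (trans (Ex.^-congʳ (χ α) (ℕₚ.*-comm m n)) (sym (Ex.^-assocʳ (χ α) n m)))) }
    where open Character X

  point : ∀ {N} → Vec Carrier N → Character S N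
  point z = record { χ = λ α → monomial α z ; χ-0 = mono-0 z ; χ-+ = λ α β → mono-+ α β z ; χ-* = λ n α → mono-* n α z }
    where
    mono-0 : ∀ {N} (z : Vec Carrier N) → monomial (Vec.replicate N 0) z ≈ 1#
    mono-0 []      = refl
    mono-0 (x ∷ z) = trans (*-identityˡ _) (mono-0 z)
    mono-+ : ∀ {N} (α β : Vec ℕ N) z → monomial (Vec.zipWith ℕ._+_ α β) z ≈ monomial α z * monomial β z
    mono-+ []      []      []      = sym (*-identityˡ 1#)
    mono-+ (a ∷ α) (b ∷ β) (x ∷ z) = trans (*-cong (Ex.^-homo-* x a b) (mono-+ α β z))
      (solve 4 (λ p q u v → p :* q :* (u :* v) := p :* u :* (q :* v)) refl (x ^ a) (x ^ b) _ _)
    mono-* : ∀ {N} n (α : Vec ℕ N) z → monomial (Vec.map (n ℕ.*_) α) z ≈ monomial α z ^ n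
    mono-* n []      []      = sym (1^ n)
    mono-* n (a ∷ α) (x ∷ z) = trans (*-cong (trans (Ex.^-congʳ x (ℕₚ.*-comm n a)) (sym (Ex.^-assocʳ x a n))) (mono-* n α z))
      (sym (^-distrib-* (x ^ a) (monomial α z) n))

  monomial-closed : ∀ {N} (P : Carrier → Set c₃) → P 1# → (∀ {x y} → P x → P y → P (x * y)) →
                    ∀ (α : Vec ℕ N) (z : Vec (∃ P) N) → P (monomial α (Vec.map proj₁ z))
  monomial-closed P P1 P* []      []            = P1
  monomial-closed P P1 P* (a ∷ α) ((x , h) ∷ z) = P* (power a) (monomial-closed P P1 P* α z)
    where
    power : ∀ a → P (x ^ a)
    power zero    = P1
    power (suc a) = P* h (power a)

module Evaluation (R : CommutativeRing c₁ ℓ₁) (S : CommutativeRing c₂ ℓ₂) (hom : RingHom R S) where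
  private
    module R = CommutativeRing R
    φ = proj₁ hom
  open CommutativeRing S hiding (zero)
  open Ops S
  open IsRingHomomorphism (proj₂ hom)
  open RingLemmas S
  open Characters S
  open Polynomials R using (Poly; coeff; oneₚ; _*ₚ_; _^ₚ_; quasiPower; quasiNorm)
  open Character
  open Solver commutativeSemiring using (solve; _:+_; _:*_; _:=_)
  open SetoidReasoning setoid

  evalAt : ∀ {N} → Character S N → Poly N → Carrier
  evalAt X []            = 0#
  evalAt X ((a , α) ∷ f) = φ a * χ X α + evalAt X f

  eval≈ : ∀ {N} (f : Poly N) z → Polynomials.eval S (mapCoeffs φ f) z ≈ evalAt (point z) f
  eval≈ []            z = refl
  eval≈ ((a , α) ∷ f) z = +-congˡ (eval≈ f z)

  evalAt-cong : ∀ {N} {X Y : Character S N} → (∀ α → χ X α ≈ χ Y α) → ∀ f → evalAt X f ≈ evalAt Y f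
  evalAt-cong h []            = refl
  evalAt-cong {X = X} {Y} h ((a , α) ∷ f) = +-cong (*-congˡ (h α)) (evalAt-cong {X = X} {Y} h f)

  module _ {N : ℕ} (X : Character S N) where

    evalAt-++ : ∀ f g → evalAt X (f ++ g) ≈ evalAt X f + evalAt X g
    evalAt-++ []      g = sym (+-identityˡ _)
    evalAt-++ (t ∷ f) g = trans (+-congˡ (evalAt-++ f g)) (sym (+-assoc _ _ _))

    evalAt-one : evalAt X oneₚ ≈ 1#
    evalAt-one = trans (+-identityʳ _) (trans (*-cong 1#-homo (χ-0 X)) (*-identityˡ 1#))

    evalAt-term : ∀ a α g → evalAt X (List.map (λ t → a R.* proj₁ t , Vec.zipWith ℕ._+_ α (proj₂ t)) g) ≈
                            φ a * χ X α * evalAt X g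
    evalAt-term a α []            = sym (zeroʳ _)
    evalAt-term a α ((b , β) ∷ g) = trans (+-cong (*-cong (*-homo a b) (χ-+ X α β)) (evalAt-term a α g))
      (solve 5 (λ a b u v e → a :* b :* (u :* v) :+ a :* u :* e := a :* u :* (b :* v :+ e)) refl
        (φ a) (φ b) (χ X α) (χ X β) (evalAt X g))

    evalAt-* : ∀ f g → evalAt X (f *ₚ g) ≈ evalAt X f * evalAt X g
    evalAt-* []            g = sym (zeroˡ _)
    evalAt-* ((a , α) ∷ f) g = trans (evalAt-++ (List.map _ g) (f *ₚ g))
      (trans (+-cong (evalAt-term a α g) (evalAt-* f g)) (sym (distribʳ _ _ _)))

    evalAt-^ : ∀ f m → evalAt X (f ^ₚ m) ≈ evalAt X f ^ m
    evalAt-^ f zero    = evalAt-one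
    evalAt-^ f (suc m) = trans (evalAt-* f (f ^ₚ m)) (*-congˡ (evalAt-^ f m))

    evalAt-quasiPower : ∀ f n → evalAt X (quasiPower f n) ≈ evalAt (X ↑ n) f
    evalAt-quasiPower []            n = refl
    evalAt-quasiPower ((a , α) ∷ f) n = +-cong (*-congˡ (χ-* X n α)) (evalAt-quasiPower f n)

    evalAt-quasiNorm : ∀ q i g → evalAt X (quasiNorm q i g) ≈ product {i} (λ j → evalAt (X ↑ (q ℕ.^ toℕ j)) g)
    evalAt-quasiNorm q i g = go i id
      where
      go : ∀ i (s : ℕ → ℕ) → evalAt X (List.foldr (λ j h → quasiPower g (q ℕ.^ j) *ₚ h) oneₚ (List.applyUpTo s i)) ≈
                             product {i} (λ j → evalAt (X ↑ (q ℕ.^ s (toℕ j))) g)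
      go zero    s = evalAt-one
      go (suc i) s = trans (evalAt-* (quasiPower g (q ℕ.^ s 0)) _)
        (*-cong (evalAt-quasiPower g (q ℕ.^ s 0)) (go i (s ∘ suc)))

    private
      remove : Vec ℕ N → Poly N → Poly N
      remove α []            = []
      remove α ((b , β) ∷ f) = if ⌊ Vecₚ.≡-dec ℕₚ._≟_ β α ⌋ then remove α f else (b , β) ∷ remove α f

      evalAt-remove : ∀ α f → evalAt X f ≈ φ (coeff f α) * χ X α + evalAt X (remove α f)
      evalAt-remove α [] = sym (trans (+-identityʳ _) (trans (*-congʳ 0#-homo) (zeroˡ _)))
      evalAt-remove α ((b , β) ∷ f) with Vecₚ.≡-dec ℕₚ._≟_ β α
      ... | yes ≡.refl = begin
        φ b * χ X β + evalAt X f                                          ≈⟨ +-congˡ (evalAt-remove β f) ⟩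
        φ b * χ X β + (φ (coeff f β) * χ X β + evalAt X (remove β f))
          ≈⟨ solve 4 (λ a b u e → a :* u :+ (b :* u :+ e) := (a :+ b) :* u :+ e) refl (φ b) (φ (coeff f β)) (χ X β) _ ⟩
        (φ b + φ (coeff f β)) * χ X β + evalAt X (remove β f)             ≈⟨ +-congʳ (*-congʳ (+-homo b _)) ⟨
        φ (b R.+ coeff f β) * χ X β + evalAt X (remove β f)               ∎
      ... | no _ = begin
        φ b * χ X β + evalAt X f                                          ≈⟨ +-congˡ (evalAt-remove α f) ⟩
        φ b * χ X β + (φ (coeff f α) * χ X α + evalAt X (remove α f))
          ≈⟨ solve 3 (λ a b c → a :+ (b :+ c) := b :+ (a :+ c)) refl (φ b * χ X β) (φ (coeff f α) * χ X α) _ ⟩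
        φ (coeff f α) * χ X α + (φ b * χ X β + evalAt X (remove α f))
          ≈⟨ +-congʳ (*-congʳ (⟦⟧-cong (R.+-identityˡ _))) ⟨
        φ (R.0# R.+ coeff f α) * χ X α + (φ b * χ X β + evalAt X (remove α f)) ∎

      coeff-remove-self : ∀ α f → coeff (remove α f) α R.≈ R.0#
      coeff-remove-self α [] = R.refl
      coeff-remove-self α ((b , β) ∷ f) with Vecₚ.≡-dec ℕₚ._≟_ β α in eq
      ... | yes _ = coeff-remove-self α f
      ... | no _ rewrite eq = R.trans (R.+-identityˡ _) (coeff-remove-self α f)

      coeff-remove-other : ∀ {α β} → α ≢ β → ∀ f → coeff (remove α f) β R.≈ coeff f β
      coeff-remove-other α≢β [] = R.refl
      coeff-remove-other {α} {β} α≢β ((b , γ) ∷ f) with Vecₚ.≡-dec ℕₚ._≟_ γ α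
      ... | no _ = R.+-congˡ (coeff-remove-other α≢β f)
      ... | yes ≡.refl with Vecₚ.≡-dec ℕₚ._≟_ γ β
      ...   | yes γ≡β = contradiction γ≡β α≢β
      ...   | no _ = R.trans (coeff-remove-other α≢β f) (R.sym (R.+-identityˡ _))

      remove-length : ∀ α f → List.length (remove α f) ℕ.≤ List.length f
      remove-length α [] = ℕ.z≤n
      remove-length α ((b , β) ∷ f) with Vecₚ.≡-dec ℕₚ._≟_ β α
      ... | yes _ = ℕₚ.m≤n⇒m≤1+n (remove-length α f)
      ... | no _ = ℕ.s≤s (remove-length α f)

      remove-head : ∀ b β f → remove β ((b , β) ∷ f) ≡ remove β f
      remove-head b β f with Vecₚ.≡-dec ℕₚ._≟_ β β
      ... | yes _ = ≡.refl
      ... | no β≢β = contradiction ≡.refl β≢β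

    evalAt-zero : ∀ f → (∀ α → coeff f α R.≈ R.0#) → evalAt X f ≈ 0#
    evalAt-zero f = go (List.length f) f ℕₚ.≤-refl
      where
      go : ∀ n f → List.length f ℕ.≤ n → (∀ α → coeff f α R.≈ R.0#) → evalAt X f ≈ 0#
      go n       []               _           h = refl
      go (suc n) f@((b , β) ∷ f′) (ℕ.s≤s len) h = begin
        evalAt X f                                              ≈⟨ evalAt-remove β f ⟩
        φ (coeff f β) * χ X β + evalAt X (remove β f)           ≈⟨ +-cong (*-congʳ (trans (⟦⟧-cong (h β)) 0#-homo)) (reflexive (≡.cong (evalAt X) (remove-head b β f′))) ⟩
        0# * χ X β + evalAt X (remove β f′)                     ≈⟨ +-cong (zeroˡ _) (go n (remove β f′) (ℕₚ.≤-trans (remove-length β f′) len) vanish) ⟩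
        0# + 0#                                                 ≈⟨ +-identityˡ 0# ⟩
        0#                                                      ∎
        where
        vanish : ∀ α → coeff (remove β f′) α R.≈ R.0#
        vanish α with Vecₚ.≡-dec ℕₚ._≟_ β α
        ... | yes ≡.refl = coeff-remove-self β f′
        ... | no β≢α = ≡.subst (λ g → coeff g α R.≈ R.0#) (remove-head b β f′) (R.trans (coeff-remove-other β≢α f) (h α))

    evalAt-coeff : ∀ f g → (∀ α → coeff f α R.≈ coeff g α) → evalAt X f ≈ evalAt X g
    evalAt-coeff f g h = begin
      evalAt X f                                     ≈⟨ +-identityʳ _ ⟨
      evalAt X f + 0#                                ≈⟨ +-congˡ (-‿inverseˡ (evalAt X g)) ⟨
      evalAt X f + (- evalAt X g + evalAt X g)       ≈⟨ +-assoc _ _ _ ⟨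
      evalAt X f - evalAt X g + evalAt X g           ≈⟨ +-congʳ (+-congˡ (evalAt-neg g)) ⟨
      evalAt X f + evalAt X (neg g) + evalAt X g     ≈⟨ +-congʳ (trans (sym (evalAt-++ f (neg g))) (evalAt-zero (f ++ neg g) vanish)) ⟩
      0# + evalAt X g                                ≈⟨ +-identityˡ _ ⟩
      evalAt X g                                     ∎
      where
      neg : Poly N → Poly N
      neg = List.map (map₁ (R.-_))
      evalAt-neg : ∀ g → evalAt X (neg g) ≈ - evalAt X g
      evalAt-neg []            = sym (RingProps.-0#≈0# ring)
      evalAt-neg ((a , α) ∷ g) = trans (+-cong (trans (*-congʳ (-‿homo a)) (sym (RingProps.-‿distribˡ-* ring _ _))) (evalAt-neg g))
        (RingProps.-‿+-comm ring _ _)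
      coeff-++ : ∀ f g α → coeff (f ++ g) α R.≈ coeff f α R.+ coeff g α
      coeff-++ []      g α = R.sym (R.+-identityˡ _)
      coeff-++ (t ∷ f) g α = R.trans (R.+-congˡ (coeff-++ f g α)) (R.sym (R.+-assoc _ _ _))
      coeff-neg : ∀ g α → coeff (neg g) α R.≈ R.- coeff g α
      coeff-neg []            α = R.sym (RingProps.-0#≈0# R.ring)
      coeff-neg ((b , β) ∷ g) α with Vecₚ.≡-dec ℕₚ._≟_ β α
      ... | yes _ = R.trans (R.+-congˡ (coeff-neg g α)) (RingProps.-‿+-comm R.ring _ _)
      ... | no _ = R.trans (R.+-identityˡ _) (R.trans (coeff-neg g α) (R.-‿cong (R.sym (R.+-identityˡ _))))
      vanish : ∀ α → coeff (f ++ neg g) α R.≈ R.0#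
      vanish α = R.trans (coeff-++ f (neg g) α) (R.trans (R.+-cong (h α) (coeff-neg g α)) (R.-‿inverseʳ _))

    -- Exchanging the sum over the terms with the sum over the conjugates.
    conjugateSum-closed : ∀ (P : Carrier → Set c₃) → P 0# → (∀ {x y} → P x → P y → P (x + y)) →
      (∀ {x y} → x ≈ y → P x → P y) → ∀ i (e : ℕ → ℕ) →
      (∀ a α → P (φ a * sum {i} (λ j → χ X α ^ e (toℕ j)))) →
      ∀ f → P (sum {i} (λ j → evalAt (X ↑ e (toℕ j)) f))
    conjugateSum-closed P P0 P+ P≈ i e h [] = P≈ (sym (S.sum-replicate-zero i)) P0
    conjugateSum-closed P P0 P+ P≈ i e h ((a , α) ∷ f) = P≈
      (trans (+-congʳ (S.*-distribˡ-sum {i} (φ a) (λ j → χ X α ^ e (toℕ j))))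
        (sym (S.∑-distrib-+ {i} (λ j → φ a * χ X α ^ e (toℕ j)) (λ j → evalAt (X ↑ e (toℕ j)) f))))
      (P+ (h a α) (conjugateSum-closed P P0 P+ P≈ i e h f))

  module _ {N : ℕ} (X : Character S N) where

    quasiNorm-rotate : ∀ q i → (∀ α → χ X α ^ (q ℕ.^ i) ≈ χ X α) → ∀ g s →
                       evalAt (X ↑ (q ℕ.^ s)) (quasiNorm q i g) ≈ evalAt X (quasiNorm q i g)
    quasiNorm-rotate q i fixed g s = trans (expand s) (trans (rotated≈ s) (sym (evalAt-quasiNorm X q i g)))
      where
      conjugate : ℕ → Carrier
      conjugate j = evalAt (X ↑ (q ℕ.^ j)) g
      rotated : ℕ → Carrier
      rotated s = product {i} (λ j → conjugate (toℕ j ℕ.+ s))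
      product-cong : ∀ {f f′ : Fin i → Carrier} → (∀ j → f j ≈ f′ j) → product {i} f ≈ product {i} f′
      product-cong = MonoidSum.sum-cong-≋ *-commutativeMonoid {i}
      expand : ∀ s → evalAt (X ↑ (q ℕ.^ s)) (quasiNorm q i g) ≈ rotated s
      expand s = trans (evalAt-quasiNorm (X ↑ (q ℕ.^ s)) q i g) (product-cong λ j →
        evalAt-cong {X = X ↑ (q ℕ.^ s) ↑ (q ℕ.^ toℕ j)} {X ↑ (q ℕ.^ (toℕ j ℕ.+ s))} (λ α →
          trans (Ex.^-assocʳ (χ X α) (q ℕ.^ s) (q ℕ.^ toℕ j))
            (Ex.^-congʳ (χ X α) (≡.trans (≡.sym (ℕₚ.^-distribˡ-+-* q s (toℕ j))) (≡.cong (q ℕ.^_) (ℕₚ.+-comm s (toℕ j)))))) g)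
      periodic : ∀ s → conjugate (i ℕ.+ s) ≈ conjugate s
      periodic s = evalAt-cong {X = X ↑ (q ℕ.^ (i ℕ.+ s))} {X ↑ (q ℕ.^ s)} (λ α →
        trans (Ex.^-congʳ (χ X α) (ℕₚ.^-distribˡ-+-* q i s))
          (trans (sym (Ex.^-assocʳ (χ X α) (q ℕ.^ i) (q ℕ.^ s))) (Ex.^-congˡ (q ℕ.^ s) (fixed α)))) g
      rotated≈ : ∀ s → rotated s ≈ product {i} (λ j → conjugate (toℕ j))
      rotated≈ zero    = product-cong λ j → reflexive (≡.cong conjugate (ℕₚ.+-identityʳ (toℕ j)))
      rotated≈ (suc s) = trans
        (trans (product-cong λ j → reflexive (≡.cong conjugate (ℕₚ.+-suc (toℕ j) s)))
          (sum-rotate *-commutativeMonoid (λ j → conjugate (j ℕ.+ s)) i (periodic s)))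
        (rotated≈ s)

    quasiNorm-^ : ∀ q i g m → evalAt X (quasiNorm q i (g ^ₚ m)) ≈ evalAt X (quasiNorm q i g) ^ m
    quasiNorm-^ q i g m = trans (evalAt-quasiNorm X q i (g ^ₚ m))
      (trans (MonoidSum.sum-cong-≋ *-commutativeMonoid {i} (λ j → evalAt-^ (X ↑ (q ℕ.^ toℕ j)) g m))
        (trans (product-^ i (λ j → evalAt (X ↑ (q ℕ.^ toℕ j)) g)) (sym (Ex.^-congˡ m (evalAt-quasiNorm X q i g)))))
      where
      product-^ : ∀ i (f : Fin i → Carrier) → product {i} (λ j → f j ^ m) ≈ product {i} f ^ m
      product-^ zero    f = sym (1^ m)
      product-^ (suc i) f = trans (*-congˡ (product-^ i (f ∘ suc))) (sym (^-distrib-* (f zero) _ m))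

  module Frobenius {p} (p-prime : Prime p) (p≈0 : p · 1# ≈ 0#) (r : ℕ) (fixed : ∀ a → φ a ^ (p ℕ.^ r) ≈ φ a) where
    open CharP p-prime p≈0
    private q = p ℕ.^ r

    evalAt-frobenius : ∀ {N} (X : Character S N) f → evalAt (X ↑ q) f ≈ evalAt X f ^ q
    evalAt-frobenius X []            = sym (multiple-frobenius r 0)
    evalAt-frobenius X ((a , α) ∷ f) = begin
      φ a * χ X α ^ q + evalAt (X ↑ q) f   ≈⟨ +-cong (*-congʳ (sym (fixed a))) (evalAt-frobenius X f) ⟩
      φ a ^ q * χ X α ^ q + evalAt X f ^ q ≈⟨ +-congʳ (^-distrib-* (φ a) (χ X α) q) ⟨
      (φ a * χ X α) ^ q + evalAt X f ^ q   ≈⟨ ^-distrib-+ r _ _ ⟨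
      (φ a * χ X α + evalAt X f) ^ q       ∎

    evalAt-quasiNorm-frobenius : ∀ {N} (X : Character S N) i f → evalAt X (quasiNorm q i f) ≈ evalAt X f ^ geometricSum q i
    evalAt-quasiNorm-frobenius X i f = trans (evalAt-quasiNorm X q i f)
      (trans (MonoidSum.sum-cong-≋ *-commutativeMonoid {i} (λ j → iterated (toℕ j))) (powers i (evalAt X f)))
      where
      iterated : ∀ j → evalAt (X ↑ (q ℕ.^ j)) f ≈ evalAt X f ^ (q ℕ.^ j)
      iterated zero    = trans (evalAt-cong {X = X ↑ 1} {X} (λ α → *-identityʳ _) f) (sym (*-identityʳ _))
      iterated (suc j) = begin
        evalAt (X ↑ (q ℕ.* q ℕ.^ j)) f    ≈⟨ evalAt-cong {X = X ↑ (q ℕ.* q ℕ.^ j)} {X ↑ (q ℕ.^ j) ↑ q} (λ α →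
            trans (Ex.^-congʳ (χ X α) (ℕₚ.*-comm q (q ℕ.^ j))) (sym (Ex.^-assocʳ (χ X α) (q ℕ.^ j) q))) f ⟩
        evalAt (X ↑ (q ℕ.^ j) ↑ q) f      ≈⟨ evalAt-frobenius (X ↑ (q ℕ.^ j)) f ⟩
        evalAt (X ↑ (q ℕ.^ j)) f ^ q      ≈⟨ Ex.^-congˡ q (iterated j) ⟩
        (evalAt X f ^ (q ℕ.^ j)) ^ q      ≈⟨ trans (Ex.^-assocʳ (evalAt X f) (q ℕ.^ j) q) (Ex.^-congʳ (evalAt X f) (ℕₚ.*-comm (q ℕ.^ j) q)) ⟩
        evalAt X f ^ (q ℕ.* q ℕ.^ j)      ∎
      powers : ∀ i x → product {i} (λ j → x ^ (q ℕ.^ toℕ j)) ≈ x ^ geometricSum q i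
      powers zero    x = refl
      powers (suc i) x = *-cong (*-identityʳ x) (trans
        (MonoidSum.sum-cong-≋ *-commutativeMonoid {i} (λ j → sym (Ex.^-assocʳ x q (q ℕ.^ toℕ j))))
        (trans (powers i (x ^ q)) (Ex.^-assocʳ x q (geometricSum q i))))

module EvaluationHom (R : CommutativeRing c ℓ) (S : CommutativeRing c₁ ℓ₁) (T : CommutativeRing c₂ ℓ₂)
                     (R→S : RingHom R S) (S→T : RingHom S T) (R→T : RingHom R T)
                     (agree : ∀ x → CommutativeRing._≈_ T (proj₁ S→T (proj₁ R→S x)) (proj₁ R→T x)) where
  open CommutativeRing T
  open Character
  private
    ψ = proj₁ S→T
    module ψ = IsRingHomomorphism (proj₂ S→T)
    module ES = Evaluation R S R→S
    module ET = Evaluation R T R→T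

  evalAt-hom : ∀ {N} (X : Character S N) (Y : Character T N) → (∀ α → ψ (χ X α) ≈ χ Y α) →
               ∀ f → ψ (ES.evalAt X f) ≈ ET.evalAt Y f
  evalAt-hom X Y h []            = ψ.0#-homo
  evalAt-hom X Y h ((a , α) ∷ f) = trans (ψ.+-homo _ _) (+-cong (trans (ψ.*-homo _ _) (*-cong (agree a) (h α))) (evalAt-hom X Y h f))

  monomial-hom : ∀ {N} (α : Vec ℕ N) z → ψ (Polynomials.monomial S α z) ≈ Polynomials.monomial T α (Vec.map ψ z)
  monomial-hom []      []      = ψ.1#-homo
  monomial-hom (a ∷ α) (x ∷ z) = trans (ψ.*-homo _ _) (*-cong (HomLemmas.φ-^ S T S→T x a) (monomial-hom α z))

module EvaluationLift (R : CommutativeRing c₁ ℓ₁) (a : CommutativeRing.Carrier R) (S : CommutativeRing c₂ ℓ₂)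
                      (hom : RingHom R S) (hom′ : RingHom (Quotient R a) S)
                      (agree : ∀ x → CommutativeRing._≈_ S (proj₁ hom′ x) (proj₁ hom x)) where
  open CommutativeRing S
  open Polynomials using (Poly; coeff)
  private
    R/a : CommutativeRing _ _
    R/a = Quotient R a
    module R/a = CommutativeRing R/a
    module E = Evaluation R S hom
    module E′ = Evaluation R/a S hom′

    coeff-quotient : ∀ {N} (F : Poly R N) α → coeff R F α R/a.≈ coeff R/a F α
    coeff-quotient []            α = R/a.refl
    coeff-quotient ((b , β) ∷ F) α = R/a.+-congˡ (coeff-quotient F α)

    evalAt-quotient : ∀ {N} (X : Character S N) (F : Poly R N) → E′.evalAt X F ≈ E.evalAt X F
    evalAt-quotient X []            = refl
    evalAt-quotient X ((b , β) ∷ F) = +-cong (*-congʳ (agree b)) (evalAt-quotient X F)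

  evalAt-lift : ∀ {N} (X : Character S N) (f : Poly R/a N) (F : Poly R N) →
                (∀ α → coeff R F α R/a.≈ coeff R/a f α) → E′.evalAt X f ≈ E.evalAt X F
  evalAt-lift X f F h = trans (E′.evalAt-coeff X f F (λ α → R/a.trans (R/a.sym (h α)) (coeff-quotient F α))) (evalAt-quotient X F)

ℤ-ring : CommutativeRing _ _
ℤ-ring = ℤₚᵣ.+-*-commutativeRing

-- ℚ→Ω x behaves as the quotient of the images of the numerator and the denominator of x.
record HasRationalValues (Z : CommutativeRing c₁ ℓ₁) (Ω : CommutativeRing c ℓ) (Z→Ω : RingHom Z Ω)
                         (ℤ→Z : RingHom ℤ-ring Z) (ℚ→Ω : ℚ → CommutativeRing.Carrier Ω) : Set ℓ where
  open CommutativeRing Ω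
  field
    rational : ∀ {x d} a → (x ℚ./ 1) ≡ (d ℚ./ 1) ℚ.* a →
               proj₁ Z→Ω (proj₁ ℤ→Z d) * ℚ→Ω a ≈ proj₁ Z→Ω (proj₁ ℤ→Z x)

odd : ∀ n → ¬ (2 ℕ∣.∣ n) → ∃ λ k → n ≡ suc (k ℕ.* 2)
odd zero          h = contradiction (ℕ∣.divides 0 ≡.refl) h
odd (suc zero)    h = 0 , ≡.refl
odd (suc (suc n)) h = let k , e = odd n (λ d → h (ℕ∣.∣m∣n⇒∣m+n (ℕ∣.∣-refl {2}) d)) in suc k , ≡.cong (λ m → suc (suc m)) e

odd-* : ∀ {m n} → (∃ λ k → m ≡ suc (k ℕ.* 2)) → (∃ λ k → n ≡ suc (k ℕ.* 2)) → ∃ λ k → m ℕ.* n ≡ suc (k ℕ.* 2)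
odd-* (j , ≡.refl) (k , ≡.refl) = k ℕ.+ j ℕ.* suc (k ℕ.* 2) , lemma j k
  where
  lemma : ∀ j k → suc (j ℕ.* 2) ℕ.* suc (k ℕ.* 2) ≡ suc ((k ℕ.+ j ℕ.* suc (k ℕ.* 2)) ℕ.* 2)
  lemma = ℕSolver.solve-∀

odd-^ : ∀ {m} → (∃ λ k → m ≡ suc (k ℕ.* 2)) → ∀ n → ∃ λ k → m ℕ.^ n ≡ suc (k ℕ.* 2)
odd-^ h zero    = 0 , ≡.refl
odd-^ h (suc n) = odd-* h (odd-^ h n)

module Steps (R : CommutativeRing c ℓ) where
  open CommutativeRing R hiding (zero)
  open Ops R
  open RingLemmas R using (module S)

  -- a₀ g(n) + a₁ g(n + 2) + a₂ g(n + 4) + ⋯.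
  pairing : ∀ {l} → Vec Carrier l → (ℕ → Carrier) → ℕ → Carrier
  pairing []       g n = 0#
  pairing (a ∷ as) g n = a * g n + pairing as g (2 ℕ.+ n)

  pairing≈sum : ∀ {l} (as : Vec Carrier l) g n → pairing as g n ≈ sum (λ k → Vec.lookup as k * g (n ℕ.+ 2 ℕ.* toℕ k))
  pairing≈sum []       g n = refl
  pairing≈sum {suc l} (a ∷ as) g n = +-cong (*-congˡ (reflexive (≡.cong g (≡.sym (ℕₚ.+-identityʳ n)))))
    (trans (pairing≈sum as g (2 ℕ.+ n)) (S.sum-cong-≋ {l} (λ k → *-congˡ (reflexive (≡.cong g (index (toℕ k)))))))
    where
    index : ∀ k → 2 ℕ.+ n ℕ.+ 2 ℕ.* k ≡ n ℕ.+ 2 ℕ.* suc k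
    index k = ≡.trans (≡.cong (ℕ._+ 2 ℕ.* k) (ℕₚ.+-comm 2 n))
      (≡.trans (ℕₚ.+-assoc n 2 (2 ℕ.* k)) (≡.cong (n ℕ.+_) (≡.sym (ℕₚ.*-suc 2 k))))

module IntegralRow where
  open Steps ℤ-ring public

  binom : ℕ → ℕ → ℤ
  binom m n = + (n C m)

  moment : ∀ {l} → Vec ℤ l → ℕ → ℕ → ℤ
  moment as m n = pairing as (binom m) n

  private
    C-pascal : ∀ n m → + (suc n C suc m) ≡ + (n C m) ℤ.+ + (n C suc m)
    C-pascal n m = ≡.trans (≡.cong +_ (≡.sym (nCk+nC[k+1]≡[n+1]C[k+1] n m))) (ℤₚᵣ.pos-+ (n C m) (n C suc m))

    moment-0 : ∀ {l} (as : Vec ℤ l) n → moment as 0 (2 ℕ.+ n) ≡ moment as 0 n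
    moment-0 []       n = ≡.refl
    moment-0 (a ∷ as) n = ≡.cong₂ ℤ._+_ (≡.cong (λ x → a ℤ.* + x) (≡.trans (C0 (2 ℕ.+ n)) (≡.sym (C0 n)))) (moment-0 as (2 ℕ.+ n))
      where
      C0 : ∀ n → n C 0 ≡ 1
      C0 zero = ≡.refl
      C0 (suc n) = ≡.refl

    moment-1 : ∀ {l} (as : Vec ℤ l) n → moment as 1 (2 ℕ.+ n) ≡ moment as 1 n ℤ.+ + 2 ℤ.* moment as 0 n
    moment-1 []       n = ≡.refl
    moment-1 (a ∷ as) n = ≡.trans (≡.cong₂ ℤ._+_
        (≡.cong (a ℤ.*_) (≡.trans (C-pascal (suc n) 0) (≡.cong (λ x → + (suc n C 0) ℤ.+ x) (C-pascal n 0))))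
        (moment-1 as (2 ℕ.+ n)))
      (lemma a (+ (n C 0)) (+ (n C 1)) (moment as 1 (2 ℕ.+ n)) (moment as 0 (2 ℕ.+ n)))
      where
      lemma : ∀ a x y u v → a ℤ.* (x ℤ.+ (x ℤ.+ y)) ℤ.+ (u ℤ.+ + 2 ℤ.* v) ≡ (a ℤ.* y ℤ.+ u) ℤ.+ + 2 ℤ.* (a ℤ.* x ℤ.+ v)
      lemma = ℤSolver.solve-∀

    moment-2 : ∀ {l} (as : Vec ℤ l) m n → moment as (2 ℕ.+ m) (2 ℕ.+ n) ≡
               moment as (2 ℕ.+ m) n ℤ.+ + 2 ℤ.* moment as (1 ℕ.+ m) n ℤ.+ moment as m n
    moment-2 []       m n = ≡.refl
    moment-2 (a ∷ as) m n = ≡.trans (≡.cong₂ ℤ._+_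
        (≡.cong (a ℤ.*_) (≡.trans (C-pascal (suc n) (suc m)) (≡.cong₂ ℤ._+_ (C-pascal n m) (C-pascal n (suc m)))))
        (moment-2 as m (2 ℕ.+ n)))
      (lemma a (+ (n C m)) (+ (n C suc m)) (+ (n C (2 ℕ.+ m))) (moment as (2 ℕ.+ m) (2 ℕ.+ n))
        (moment as (1 ℕ.+ m) (2 ℕ.+ n)) (moment as m (2 ℕ.+ n)))
      where
      lemma : ∀ a x y z u v w → a ℤ.* ((x ℤ.+ y) ℤ.+ (y ℤ.+ z)) ℤ.+ (u ℤ.+ + 2 ℤ.* v ℤ.+ w) ≡
              (a ℤ.* z ℤ.+ u) ℤ.+ + 2 ℤ.* (a ℤ.* y ℤ.+ v) ℤ.+ (a ℤ.* x ℤ.+ w)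
      lemma = ℤSolver.solve-∀

    combine : ∀ {l} → ℤ → Vec ℤ l → ℤ → Vec ℤ l → Vec ℤ l
    combine x as y bs = Vec.zipWith (λ a b → x ℤ.* a ℤ.+ y ℤ.* b) as bs

    moment-combine : ∀ {l} x (as : Vec ℤ l) y bs m n →
                     moment (combine x as y bs) m n ≡ x ℤ.* moment as m n ℤ.+ y ℤ.* moment bs m n
    moment-combine x []       y []       m n = lemma x y
      where
      lemma : ∀ x y → + 0 ≡ x ℤ.* + 0 ℤ.+ y ℤ.* + 0
      lemma = ℤSolver.solve-∀
    moment-combine x (a ∷ as) y (b ∷ bs) m n =
      ≡.trans (≡.cong (λ z → (x ℤ.* a ℤ.+ y ℤ.* b) ℤ.* binom m n ℤ.+ z) (moment-combine x as y bs m (2 ℕ.+ n)))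
        (lemma x a y b (binom m n) (moment as m (2 ℕ.+ n)) (moment bs m (2 ℕ.+ n)))
      where
      lemma : ∀ x a y b c u v → (x ℤ.* a ℤ.+ y ℤ.* b) ℤ.* c ℤ.+ (x ℤ.* u ℤ.+ y ℤ.* v) ≡
              x ℤ.* (a ℤ.* c ℤ.+ u) ℤ.+ y ℤ.* (b ℤ.* c ℤ.+ v)
      lemma = ℤSolver.solve-∀

    pad : ∀ {l} → Vec ℤ l → Vec ℤ (suc l)
    pad []       = + 0 ∷ []
    pad (a ∷ as) = a ∷ pad as

    moment-pad : ∀ {l} (as : Vec ℤ l) m n → moment (pad as) m n ≡ moment as m n
    moment-pad []       m n = ≡.refl
    moment-pad (a ∷ as) m n = ≡.cong (λ z → a ℤ.* binom m n ℤ.+ z) (moment-pad as m (2 ℕ.+ n))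

    moment-shift : ∀ {l} (as : Vec ℤ l) m n → moment (+ 0 ∷ as) m n ≡ moment as m (2 ℕ.+ n)
    moment-shift as m n = ℤₚᵣ.+-identityˡ _

  -- The coefficients of (v - 1)ˡ. Pairing them with the powers of v = (1 + u)², times (1 + u)ⁿ,
  -- gives (1 + u)ⁿ (2u + u²)ˡ, whose lowest term is 2ˡ uˡ.
  differences : ∀ l → Vec ℤ (suc l)
  differences zero    = + 1 ∷ []
  differences (suc l) = combine (+ 1) (+ 0 ∷ differences l) (ℤ.- + 1) (pad (differences l))

  private
    moment-differences : ∀ l m n → moment (differences (suc l)) m n ≡ moment (differences l) m (2 ℕ.+ n) ℤ.- moment (differences l) m n
    moment-differences l m n = ≡.trans (moment-combine (+ 1) (+ 0 ∷ differences l) (ℤ.- + 1) (pad (differences l)) m n)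
      (≡.trans (≡.cong₂ (λ x y → + 1 ℤ.* x ℤ.+ (ℤ.- + 1) ℤ.* y) (moment-shift (differences l) m n) (moment-pad (differences l) m n))
        (lemma (moment (differences l) m (2 ℕ.+ n)) (moment (differences l) m n)))
      where
      lemma : ∀ x y → + 1 ℤ.* x ℤ.+ (ℤ.- + 1) ℤ.* y ≡ x ℤ.- y
      lemma = ℤSolver.solve-∀

    cancel₁ : ∀ x → x ℤ.- x ≡ + 0
    cancel₁ = ℤₚᵣ.+-inverseʳ
    cancel₂ : ∀ x y → (x ℤ.+ + 2 ℤ.* y) ℤ.- x ≡ + 2 ℤ.* y
    cancel₂ = ℤSolver.solve-∀
    cancel₃ : ∀ x y z → (x ℤ.+ + 2 ℤ.* y ℤ.+ z) ℤ.- x ≡ + 2 ℤ.* y ℤ.+ z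
    cancel₃ = ℤSolver.solve-∀

  differences-low : ∀ l m n → m ℕ.< l → moment (differences l) m n ≡ + 0
  differences-low (suc l) zero n _ =
    ≡.trans (moment-differences l 0 n) (≡.trans (≡.cong (ℤ._- moment (differences l) 0 n) (moment-0 (differences l) n)) (cancel₁ (moment (differences l) 0 n)))
  differences-low (suc l) (suc zero) n (ℕ.s≤s 0<l) =
    ≡.trans (moment-differences l 1 n) (≡.trans (≡.cong (ℤ._- moment (differences l) 1 n) (moment-1 (differences l) n))
      (≡.trans (cancel₂ (moment (differences l) 1 n) (moment (differences l) 0 n)) (≡.cong (+ 2 ℤ.*_) (differences-low l 0 n 0<l))))
  differences-low (suc l) (suc (suc m)) n (ℕ.s≤s m<l) =
    ≡.trans (moment-differences l (2 ℕ.+ m) n) (≡.trans (≡.cong (ℤ._- moment (differences l) (2 ℕ.+ m) n) (moment-2 (differences l) m n))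
      (≡.trans (cancel₃ (moment (differences l) (2 ℕ.+ m) n) (moment (differences l) (suc m) n) (moment (differences l) m n)) (≡.cong₂ (λ x y → + 2 ℤ.* x ℤ.+ y) (differences-low l (suc m) n m<l)
        (differences-low l m n (ℕₚ.≤-trans (ℕₚ.n≤1+n _) m<l)))))

  differences-top : ∀ l n → moment (differences l) l n ≡ + (2 ℕ.^ l)
  differences-top zero n = ≡.refl
  differences-top (suc zero) n = ≡.trans (moment-differences 0 1 n)
    (≡.trans (≡.cong (ℤ._- moment (differences 0) 1 n) (moment-1 (differences 0) n))
      (≡.trans (cancel₂ (moment (differences 0) 1 n) (moment (differences 0) 0 n)) (≡.cong (+ 2 ℤ.*_) (differences-top 0 n))))
  differences-top (suc (suc l)) n = ≡.trans (moment-differences (suc l) (2 ℕ.+ l) n)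
    (≡.trans (≡.cong (ℤ._- moment (differences (suc l)) (2 ℕ.+ l) n) (moment-2 (differences (suc l)) l n))
      (≡.trans (cancel₃ (moment (differences (suc l)) (2 ℕ.+ l) n) (moment (differences (suc l)) (suc l) n) (moment (differences (suc l)) l n)) (≡.trans (≡.cong₂ (λ x y → + 2 ℤ.* x ℤ.+ y) (differences-top (suc l) n)
        (differences-low (suc l) l n ℕₚ.≤-refl)) (≡.trans (ℤₚᵣ.+-identityʳ _) (≡.sym (ℤₚᵣ.pos-* 2 (2 ℕ.^ suc l)))))))

  private
    exponent : ℕ → ℕ
    exponent zero    = 0
    exponent (suc l) = suc l ℕ.+ exponent l

  row : ∀ l → ℕ → Vec ℤ (suc l)
  row zero    n = + 1 ∷ []
  row (suc l) n = combine (+ (2 ℕ.^ suc l)) (pad (row l n)) (ℤ.- moment (row l n) (suc l) n) (differences (suc l))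

  private
    row-moment : ∀ l m n → moment (row (suc l) n) m n ≡
                 + (2 ℕ.^ suc l) ℤ.* moment (row l n) m n ℤ.+ (ℤ.- moment (row l n) (suc l) n) ℤ.* moment (differences (suc l)) m n
    row-moment l m n = ≡.trans (moment-combine (+ (2 ℕ.^ suc l)) (pad (row l n)) (ℤ.- moment (row l n) (suc l) n) (differences (suc l)) m n)
      (≡.cong (λ x → + (2 ℕ.^ suc l) ℤ.* x ℤ.+ (ℤ.- moment (row l n) (suc l) n) ℤ.* moment (differences (suc l)) m n)
        (moment-pad (row l n) m n))

    row-low : ∀ l m n → m ℕ.< suc l → moment (row (suc l) n) m n ≡ + (2 ℕ.^ suc l) ℤ.* moment (row l n) m n
    row-low l m n m<l = ≡.trans (row-moment l m n)
      (≡.trans (≡.cong (λ x → + (2 ℕ.^ suc l) ℤ.* moment (row l n) m n ℤ.+ (ℤ.- moment (row l n) (suc l) n) ℤ.* x) (differences-low (suc l) m n m<l))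
        (lemma (+ (2 ℕ.^ suc l)) (moment (row l n) m n) (moment (row l n) (suc l) n)))
      where
      lemma : ∀ D x y → D ℤ.* x ℤ.+ (ℤ.- y) ℤ.* + 0 ≡ D ℤ.* x
      lemma = ℤSolver.solve-∀

  row-zero : ∀ l n → moment (row l n) 0 n ≡ + (2 ℕ.^ exponent l)
  row-zero zero    n = ≡.refl
  row-zero (suc l) n = ≡.trans (row-low l 0 n (ℕ.s≤s ℕ.z≤n))
    (≡.trans (≡.cong (+ (2 ℕ.^ suc l) ℤ.*_) (row-zero l n))
      (≡.trans (≡.sym (ℤₚᵣ.pos-* (2 ℕ.^ suc l) (2 ℕ.^ exponent l))) (≡.cong +_ (≡.sym (ℕₚ.^-distribˡ-+-* 2 (suc l) (exponent l))))))

  row-suc : ∀ l m n → m ℕ.< l → moment (row l n) (suc m) n ≡ + 0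
  row-suc (suc l) m n (ℕ.s≤s m≤l) with ℕₚ.m≤n⇒m<n∨m≡n m≤l
  ... | inj₁ m<l = ≡.trans (row-low l (suc m) n (ℕ.s≤s m<l))
    (≡.trans (≡.cong (+ (2 ℕ.^ suc l) ℤ.*_) (row-suc l m n m<l)) (ℤₚᵣ.*-zeroʳ (+ (2 ℕ.^ suc l))))
  ... | inj₂ ≡.refl = ≡.trans (row-moment l (suc l) n)
    (≡.trans (≡.cong (λ x → + (2 ℕ.^ suc l) ℤ.* moment (row l n) (suc l) n ℤ.+ (ℤ.- moment (row l n) (suc l) n) ℤ.* x) (differences-top (suc l) n))
      (lemma (+ (2 ℕ.^ suc l)) (moment (row l n) (suc l) n)))
    where
    lemma : ∀ D x → D ℤ.* x ℤ.+ (ℤ.- x) ℤ.* D ≡ + 0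
    lemma = ℤSolver.solve-∀

  -- An integral solution of (row) · P = (2ᵉ, 0, …, 0).
  integral-row : ∀ l n → ∃ λ e → ∃ λ (as : Vec ℤ (suc l)) →
                 moment as 0 n ≡ + (2 ℕ.^ e) × (∀ m → m ℕ.< l → moment as (suc m) n ≡ + 0)
  integral-row l n = exponent l , row l n , row-zero l n , λ m → row-suc l m n

module RationalRow where
  open IntegralRow

  private
    module ℚ-sum = RingLemmas ℚₚᵣ.+-*-commutativeRing
    open Ops ℚₚᵣ.+-*-commutativeRing using (sum)

  ℤ→ℚ : ℤ → ℚ
  ℤ→ℚ z = z ℚ./ 1

  private
    ℤ→ℚᵘ : ∀ z → ℚ.toℚᵘ (ℤ→ℚ z) ℚᵘ.≃ ℚᵘ.mkℚᵘ z 0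
    ℤ→ℚᵘ z = ℚₚᵣ.toℚᵘ-fromℚᵘ (ℚᵘ.mkℚᵘ z 0)

  ℤ→ℚ-+ : ∀ x y → ℤ→ℚ (x ℤ.+ y) ≡ ℤ→ℚ x ℚ.+ ℤ→ℚ y
  ℤ→ℚ-+ x y = ℚₚᵣ.toℚᵘ-injective (ℚᵘₚ.≃-trans (ℤ→ℚᵘ (x ℤ.+ y)) (ℚᵘₚ.≃-sym
    (ℚᵘₚ.≃-trans (ℚₚᵣ.toℚᵘ-homo-+ (ℤ→ℚ x) (ℤ→ℚ y)) (ℚᵘₚ.≃-trans (ℚᵘₚ.+-cong (ℤ→ℚᵘ x) (ℤ→ℚᵘ y)) (ℚᵘ.*≡* (lemma x y))))))
    where
    lemma : ∀ x y → (x ℤ.* + 1 ℤ.+ y ℤ.* + 1) ℤ.* + 1 ≡ (x ℤ.+ y) ℤ.* + 1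
    lemma = ℤSolver.solve-∀

  ℤ→ℚ-* : ∀ x y → ℤ→ℚ (x ℤ.* y) ≡ ℤ→ℚ x ℚ.* ℤ→ℚ y
  ℤ→ℚ-* x y = ℚₚᵣ.toℚᵘ-injective (ℚᵘₚ.≃-trans (ℤ→ℚᵘ (x ℤ.* y)) (ℚᵘₚ.≃-sym
    (ℚᵘₚ.≃-trans (ℚₚᵣ.toℚᵘ-homo-* (ℤ→ℚ x) (ℤ→ℚ y)) (ℚᵘₚ.*-cong (ℤ→ℚᵘ x) (ℤ→ℚᵘ y)))))

  binomial≡C : ∀ n k → binomial (+ n) k ≡ ℤ→ℚ (+ (n C k))
  binomial≡C n zero    = ≡.refl
  binomial≡C n (suc k) = ≡.trans (≡.cong (ℚ._* ((+ n ℤ.- + k) ℚ./ suc k)) (binomial≡C n k))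
    (ℚₚᵣ.toℚᵘ-injective (ℚᵘₚ.≃-trans (ℚₚᵣ.toℚᵘ-homo-* (ℤ→ℚ (+ (n C k))) ((+ n ℤ.- + k) ℚ./ suc k))
      (ℚᵘₚ.≃-trans (ℚᵘₚ.*-cong (ℤ→ℚᵘ (+ (n C k))) (ℚₚᵣ.toℚᵘ-fromℚᵘ (ℚᵘ.mkℚᵘ (+ n ℤ.- + k) k)))
        (ℚᵘₚ.≃-trans (ℚᵘ.*≡* (identity-ℤ n k)) (ℚᵘₚ.≃-sym (ℤ→ℚᵘ (+ (n C suc k))))))))
    where
    recurrence : ∀ n k → suc k ℕ.* (n C suc k) ℕ.+ k ℕ.* (n C k) ≡ n ℕ.* (n C k)
    recurrence n k = ℕₚ.+-cancelˡ-≡ (n C k) _ _ (≡.trans (lemma k (n C k) (n C suc k))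
      (≡.trans (≡.cong (suc k ℕ.*_) (nCk+nC[k+1]≡[n+1]C[k+1] n k)) (C-absorb n k)))
      where
      lemma : ∀ k x y → x ℕ.+ (suc k ℕ.* y ℕ.+ k ℕ.* x) ≡ suc k ℕ.* (x ℕ.+ y)
      lemma = ℕSolver.solve-∀
    identity-ℤ : ∀ n k → (+ (n C k) ℤ.* (+ n ℤ.- + k)) ℤ.* + 1 ≡ + (n C suc k) ℤ.* (+ 1 ℤ.* + suc k)
    identity-ℤ n k = ≡.trans (lemma₁ (+ (n C k)) (+ n) (+ k))
      (≡.trans (≡.cong (ℤ._- + k ℤ.* + (n C k)) (≡.sym cast)) (lemma₂ (+ (n C suc k)) (+ suc k) (+ k ℤ.* + (n C k))))
      where
      cast : + suc k ℤ.* + (n C suc k) ℤ.+ + k ℤ.* + (n C k) ≡ + n ℤ.* + (n C k)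
      cast = ≡.trans (≡.cong₂ ℤ._+_ (≡.sym (ℤₚᵣ.pos-* (suc k) (n C suc k))) (≡.sym (ℤₚᵣ.pos-* k (n C k))))
        (≡.trans (≡.sym (ℤₚᵣ.pos-+ (suc k ℕ.* (n C suc k)) (k ℕ.* (n C k))))
          (≡.trans (≡.cong +_ (recurrence n k)) (ℤₚᵣ.pos-* n (n C k))))
      lemma₁ : ∀ c n k → (c ℤ.* (n ℤ.- k)) ℤ.* + 1 ≡ n ℤ.* c ℤ.- k ℤ.* c
      lemma₁ = ℤSolver.solve-∀
      lemma₂ : ∀ c s x → (s ℤ.* c ℤ.+ x) ℤ.- x ≡ c ℤ.* (+ 1 ℤ.* s)
      lemma₂ = ℤSolver.solve-∀

  ℤ→ℚ-sum : ∀ {l} (f : Fin l → ℤ) → ℤ→ℚ (Ops.sum ℤ-ring f) ≡ sum (ℤ→ℚ ∘ f)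
  ℤ→ℚ-sum {zero}  f = ≡.refl
  ℤ→ℚ-sum {suc l} f = ≡.trans (ℤ→ℚ-+ (f zero) _) (≡.cong (ℤ→ℚ (f zero) ℚ.+_) (ℤ→ℚ-sum (f ∘ suc)))

  private
    sum-cong : ∀ {l} {f g : Fin l → ℚ} → (∀ k → f k ≡ g k) → sum f ≡ sum g
    sum-cong {l} {f} {g} = ℚ-sum.S.sum-cong-≋ {l} {f} {g}

    identity-sum : ∀ {l} (f : Fin l → ℚ) j → sum (λ k → f k ℚ.* identity k j) ≡ f j
    identity-sum {suc l} f zero = ≡.trans (≡.cong₂ ℚ._+_ (ℚₚᵣ.*-identityʳ (f zero))
      (≡.trans (sum-cong (λ k → ℚₚᵣ.*-zeroʳ (f (suc k)))) (ℚ-sum.S.sum-replicate-zero l))) (ℚₚᵣ.+-identityʳ _)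
    identity-sum {suc l} f (suc j) = ≡.trans (≡.cong₂ ℚ._+_ (ℚₚᵣ.*-zeroʳ (f zero))
      (≡.trans (sum-cong (λ k → ≡.cong (f (suc k) ℚ.*_) (identity-suc k j))) (identity-sum (f ∘ suc) j))) (ℚₚᵣ.+-identityˡ _)
      where
      identity-suc : ∀ {l} (j k : Fin l) → identity (suc j) (suc k) ≡ identity j k
      identity-suc j k with j Finₚ.≟ k
      ... | yes _ = ≡.refl
      ... | no _  = ≡.refl

  inverse-row : ∀ {l} (M M⁻¹ : Matrix (suc l)) → (∀ j k → (M ⊗ M⁻¹) j k ≡ identity j k) →
                ∀ (x : Fin (suc l) → ℚ) d → sum (λ k → x k ℚ.* M k zero) ≡ d →
                (∀ m → sum (λ k → x k ℚ.* M k (suc m)) ≡ ℚ.0ℚ) → ∀ j → x j ≡ d ℚ.* M⁻¹ zero j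
  inverse-row {l} M M⁻¹ inverse x d h₀ h j = begin
    x j
      ≡⟨ identity-sum x j ⟨
    sum (λ k → x k ℚ.* identity k j)
      ≡⟨ sum-cong (λ k → ≡.cong (x k ℚ.*_) (≡.sym (inverse k j))) ⟩
    sum (λ k → x k ℚ.* sum (λ m → M k m ℚ.* M⁻¹ m j))
      ≡⟨ sum-cong (λ k → ℚ-sum.S.*-distribˡ-sum {suc l} (x k) (λ m → M k m ℚ.* M⁻¹ m j)) ⟩
    sum (λ k → sum (λ m → x k ℚ.* (M k m ℚ.* M⁻¹ m j)))
      ≡⟨ ℚ-sum.S.∑-comm {suc l} {suc l} (λ k m → x k ℚ.* (M k m ℚ.* M⁻¹ m j)) ⟩
    sum (λ m → sum (λ k → x k ℚ.* (M k m ℚ.* M⁻¹ m j)))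
      ≡⟨ sum-cong (λ m → ≡.trans (sum-cong (λ k → ≡.sym (ℚₚᵣ.*-assoc (x k) (M k m) (M⁻¹ m j))))
           (≡.sym (ℚ-sum.S.*-distribʳ-sum {suc l} (M⁻¹ m j) (λ k → x k ℚ.* M k m)))) ⟩
    sum (λ m → sum (λ k → x k ℚ.* M k m) ℚ.* M⁻¹ m j)
      ≡⟨ ≡.cong₂ ℚ._+_ (≡.cong (ℚ._* M⁻¹ zero j) h₀)
           (≡.trans (sum-cong (λ m → ≡.trans (≡.cong (ℚ._* M⁻¹ (suc m) j) (h m)) (ℚₚᵣ.*-zeroˡ (M⁻¹ (suc m) j)))) (ℚ-sum.S.sum-replicate-zero l)) ⟩
    d ℚ.* M⁻¹ zero j ℚ.+ ℚ.0ℚ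
      ≡⟨ ℚₚᵣ.+-identityʳ _ ⟩
    d ℚ.* M⁻¹ zero j ∎
    where open ≡.≡-Reasoning

  firstRow-integral : ∀ {l} n (P⁻¹ : Matrix (suc l)) → IsInverse (P (+ n) (suc l)) P⁻¹ →
    ∃ λ e → ∃ λ (as : Vec ℤ (suc l)) → moment as 0 n ≡ + (2 ℕ.^ e) × (∀ m → m ℕ.< l → moment as (suc m) n ≡ + 0) ×
    (∀ k → ℤ→ℚ (Vec.lookup as k) ≡ ℤ→ℚ (+ (2 ℕ.^ e)) ℚ.* P⁻¹ zero k)
  firstRow-integral {l} n P⁻¹ (inverse , _) = e , as , h₀ , h ,
    inverse-row (P (+ n) (suc l)) P⁻¹ inverse (λ k → ℤ→ℚ (Vec.lookup as k)) (ℤ→ℚ (+ (2 ℕ.^ e)))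
      (≡.trans (rational 0) (≡.cong ℤ→ℚ h₀))
      (λ m → ≡.trans (rational (suc (toℕ m))) (≡.cong ℤ→ℚ (h (toℕ m) (Finₚ.toℕ<n m))))
    where
    e = proj₁ (integral-row l n)
    as = proj₁ (proj₂ (integral-row l n))
    h₀ = proj₁ (proj₂ (proj₂ (integral-row l n)))
    h = proj₂ (proj₂ (proj₂ (integral-row l n)))
    rational : ∀ m → sum (λ k → ℤ→ℚ (Vec.lookup as k) ℚ.* binomial (+ (n ℕ.+ 2 ℕ.* toℕ k)) m) ≡ ℤ→ℚ (moment as m n)
    rational m = ≡.trans (sum-cong (λ k → ≡.trans (≡.cong (ℤ→ℚ (Vec.lookup as k) ℚ.*_) (binomial≡C (n ℕ.+ 2 ℕ.* toℕ k) m))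
        (≡.sym (ℤ→ℚ-* (Vec.lookup as k) (binom m (n ℕ.+ 2 ℕ.* toℕ k))))))
      (≡.trans (≡.sym (ℤ→ℚ-sum (λ k → Vec.lookup as k ℤ.* binom m (n ℕ.+ 2 ℕ.* toℕ k))))
        (≡.cong ℤ→ℚ (≡.sym (pairing≈sum as (binom m) n))))

module Interpolation {p} {Z : CommutativeRing c₁ ℓ₁} {Ω : CommutativeRing c ℓ} {hom : RingHom Z Ω}
                     (setting : Setting p Z Ω hom) (ι-hom : RingHom ℤ-ring Ω)
                     (ι-integral : ∀ z → FieldLemmas.IsIntegral setting (proj₁ ι-hom z)) where
  open FieldLemmas setting
  open Setting setting using (limits; Z-separated)
  open CommutativeRing Ω hiding (zero)
  open Ops Ω
  open RingLemmas Ω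
  open Steps Ω
  open IntegralRow using (binom; moment)
  open Solver commutativeSemiring using (solve; _:+_; _:*_; _:=_)
  open SetoidReasoning setoid
  private
    ι = proj₁ ι-hom
    module ι = IsRingHomomorphism (proj₂ ι-hom)

    truncated : Carrier → ℕ → ℕ → Carrier
    truncated u zero    n = 0#
    truncated u (suc l) n = truncated u l n + ι (binom l n) * u ^ l

    truncated-suc : ∀ u l n → truncated u (suc l) (suc n) ≈ truncated u (suc l) n + u * truncated u l n
    truncated-suc u zero    n = sym (trans (+-congˡ (zeroʳ u)) (+-identityʳ _))
    truncated-suc u (suc l) n = begin
      truncated u (suc l) (suc n) + ι (binom (suc l) (suc n)) * u ^ suc l
        ≈⟨ +-cong (truncated-suc u l n) (*-congʳ (trans (ι.⟦⟧-cong pascal) (ι.+-homo _ _))) ⟩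
      truncated u (suc l) n + u * truncated u l n + (ι (binom l n) + ι (binom (suc l) n)) * (u * u ^ l)
        ≈⟨ solve 6 (λ t u s a b v → t :+ u :* s :+ (a :+ b) :* (u :* v) := t :+ b :* (u :* v) :+ u :* (s :+ a :* v)) refl
             (truncated u (suc l) n) u (truncated u l n) (ι (binom l n)) (ι (binom (suc l) n)) (u ^ l) ⟩
      truncated u (suc l) n + ι (binom (suc l) n) * (u * u ^ l) + u * (truncated u l n + ι (binom l n) * u ^ l) ∎
      where
      pascal : binom (suc l) (suc n) ≡ binom l n ℤ.+ binom (suc l) n
      pascal = ≡.trans (≡.cong +_ (≡.sym (nCk+nC[k+1]≡[n+1]C[k+1] n l))) (ℤₚᵣ.pos-+ (n C l) (n C suc l))

    truncated-0 : ∀ u l → truncated u (suc l) 0 ≈ 1#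
    truncated-0 u zero    = trans (+-identityˡ _) (trans (*-identityʳ _) ι.1#-homo)
    truncated-0 u (suc l) = trans (+-cong (truncated-0 u l)
      (trans (*-congʳ (trans (ι.⟦⟧-cong (≡.cong +_ (k>n⇒nCk≡0 {0} {suc l} (ℕ.s≤s ℕ.z≤n)))) ι.0#-homo)) (zeroˡ _))) (+-identityʳ 1#)

    ^-truncated : ∀ {u} → IsIntegral u → ∀ l n → ∃ λ s → IsIntegral s × (1# + u) ^ n ≈ truncated u (suc l) n + u ^ suc l * s
    ^-truncated {u} hu l zero = 0# , int-0 , sym (trans (+-cong (truncated-0 u l) (zeroʳ _)) (+-identityʳ 1#))
    ^-truncated {u} hu l (suc n) = ι (binom l n) + (1# + u) * s , int-+ (ι-integral _) (int-* (int-+ int-1 hu) hs) , (begin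
      (1# + u) * (1# + u) ^ n
        ≈⟨ *-congˡ e ⟩
      (1# + u) * (truncated u l n + b * v + u * v * s)
        ≈⟨ distribʳ _ 1# u ⟩
      1# * (truncated u l n + b * v + u * v * s) + u * (truncated u l n + b * v + u * v * s)
        ≈⟨ +-congʳ (*-identityˡ _) ⟩
      truncated u l n + b * v + u * v * s + u * (truncated u l n + b * v + u * v * s)
        ≈⟨ solve 5 (λ t b v u s → t :+ b :* v :+ u :* v :* s :+ u :* (t :+ b :* v :+ u :* v :* s) :=
             t :+ b :* v :+ u :* t :+ u :* v :* (b :+ (s :+ u :* s))) refl (truncated u l n) b v u s ⟩
      truncated u l n + b * v + u * truncated u l n + u * v * (b + (s + u * s))
        ≈⟨ +-cong (sym (truncated-suc u l n)) (*-congˡ (+-congˡ (sym (trans (distribʳ s 1# u) (+-congʳ (*-identityˡ s)))))) ⟩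
      truncated u (suc l) (suc n) + u * v * (b + (1# + u) * s) ∎)
      where
      b = ι (binom l n)
      v = u ^ l
      s = proj₁ (^-truncated hu l n)
      hs = proj₁ (proj₂ (^-truncated hu l n))
      e = proj₂ (proj₂ (^-truncated hu l n))

    ι-pairing : ∀ {k} → Vec ℤ k → (ℕ → Carrier) → ℕ → Carrier
    ι-pairing as = pairing (Vec.map ι as)

    pairing-truncated : ∀ {k} (as : Vec ℤ k) u l n →
      ι-pairing as (truncated u (suc l)) n ≈ ι-pairing as (truncated u l) n + ι (moment as l n) * u ^ l
    pairing-truncated []       u l n = sym (trans (+-identityˡ _) (trans (*-congʳ ι.0#-homo) (zeroˡ _)))
    pairing-truncated (a ∷ as) u l n = begin
      ι a * (truncated u l n + ι (binom l n) * u ^ l) + ι-pairing as (truncated u (suc l)) (2 ℕ.+ n)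
        ≈⟨ +-congˡ (pairing-truncated as u l (2 ℕ.+ n)) ⟩
      ι a * (truncated u l n + ι (binom l n) * u ^ l) + (ι-pairing as (truncated u l) (2 ℕ.+ n) + ι (moment as l (2 ℕ.+ n)) * u ^ l)
        ≈⟨ solve 6 (λ a t b v P m → a :* (t :+ b :* v) :+ (P :+ m :* v) := a :* t :+ P :+ (a :* b :+ m) :* v) refl
             (ι a) (truncated u l n) (ι (binom l n)) (u ^ l) (ι-pairing as (truncated u l) (2 ℕ.+ n)) (ι (moment as l (2 ℕ.+ n))) ⟩
      ι a * truncated u l n + ι-pairing as (truncated u l) (2 ℕ.+ n) + (ι a * ι (binom l n) + ι (moment as l (2 ℕ.+ n))) * u ^ l
        ≈⟨ +-congˡ (*-congʳ (trans (ι.+-homo _ _) (+-congʳ (ι.*-homo _ _)))) ⟨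
      ι a * truncated u l n + ι-pairing as (truncated u l) (2 ℕ.+ n) + ι (moment (a ∷ as) l n) * u ^ l ∎

    pairing-moments : ∀ {k} (as : Vec ℤ k) u n {D} → moment as 0 n ≡ D → ∀ l → (∀ m → m ℕ.< l → moment as (suc m) n ≡ + 0) →
                      ι-pairing as (truncated u (suc l)) n ≈ ι D
    pairing-moments as u n h₀ zero    h = trans (pairing-truncated as u 0 n)
      (trans (+-cong (pairing-zero as n) (trans (*-identityʳ _) (ι.⟦⟧-cong h₀))) (+-identityˡ _))
      where
      pairing-zero : ∀ {k} (as : Vec ℤ k) n → ι-pairing as (truncated u 0) n ≈ 0#
      pairing-zero []       n = refl
      pairing-zero (a ∷ as) n = trans (+-cong (zeroʳ _) (pairing-zero as (2 ℕ.+ n))) (+-identityˡ 0#)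
    pairing-moments as u n h₀ (suc l) h = trans (pairing-truncated as u (suc l) n)
      (trans (+-cong (pairing-moments as u n h₀ l (λ m m<l → h m (ℕₚ.m<n⇒m<1+n m<l)))
        (trans (*-congʳ (trans (ι.⟦⟧-cong (h l ℕₚ.≤-refl)) ι.0#-homo)) (zeroˡ _))) (+-identityʳ _))

    pairing-approximation : ∀ {k} (as : Vec ℤ k) (g h : ℕ → Carrier) {x d} n →
      (∀ j → ∃ λ s → IsIntegral s × g (j ℕ.* 2 ℕ.+ n) ≈ x * h (j ℕ.* 2 ℕ.+ n) + d * s) →
      ∃ λ s → IsIntegral s × ι-pairing as g n ≈ x * ι-pairing as h n + d * s
    pairing-approximation [] g h {x} {d} n H = 0# , int-0 , sym (trans (+-cong (zeroʳ x) (zeroʳ d)) (+-identityˡ 0#))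
    pairing-approximation (a ∷ as) g h {x} {d} n H = ι a * s + s′ , int-+ (int-* (ι-integral a) hs) hs′ , trans (+-cong (*-congˡ e) e′)
      (solve 7 (λ a x h d s P s′ → a :* (x :* h :+ d :* s) :+ (x :* P :+ d :* s′) := x :* (a :* h :+ P) :+ d :* (a :* s :+ s′)) refl
        (ι a) x (h n) d s (ι-pairing as h (2 ℕ.+ n)) s′)
      where
      head : ∃ λ s → IsIntegral s × g n ≈ x * h n + d * s
      head = H 0
      index : ∀ j → j ℕ.* 2 ℕ.+ (2 ℕ.+ n) ≡ suc j ℕ.* 2 ℕ.+ n
      index j = ≡.trans (≡.sym (ℕₚ.+-assoc (j ℕ.* 2) 2 n)) (≡.cong (ℕ._+ n) (ℕₚ.+-comm (j ℕ.* 2) 2))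
      tail : ∃ λ s → IsIntegral s × ι-pairing as g (2 ℕ.+ n) ≈ x * ι-pairing as h (2 ℕ.+ n) + d * s
      tail = pairing-approximation as g h (2 ℕ.+ n) (λ j →
        ≡.subst (λ i → ∃ λ s → IsIntegral s × g i ≈ x * h i + d * s) (≡.sym (index j)) (H (suc j)))
      s = proj₁ head
      hs = proj₁ (proj₂ head)
      e = proj₂ (proj₂ head)
      s′ = proj₁ tail
      hs′ = proj₁ (proj₂ tail)
      e′ = proj₂ (proj₂ tail)

  -- For ε = ±1 and odd n all the exponents n + 2k are odd, so (ε (1 + u))^(n + 2k) = ε (1 + u)^(n + 2k).
  pairing-sign : ∀ {k} (as : Vec ℤ k) {D} n → (∃ λ h → n ≡ suc (h ℕ.* 2)) → ∀ l →
    moment as 0 n ≡ D → (∀ m → m ℕ.< l → moment as (suc m) n ≡ + 0) →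
    ∀ {ε y s} → IsIntegral ε → IsIntegral s → ε * ε ≈ 1# → y ≈ ε + π * s →
    ∃ λ w → IsIntegral w × pairing (Vec.map ι as) (y ^_) n ≈ ε * ι D + π ^ suc l * w
  pairing-sign as {D} n (h , ≡.refl) l h₀ hm {ε} {y} {s} hε hs ε² e = proj₁ result , proj₁ (proj₂ result) ,
    trans (proj₂ (proj₂ result)) (+-congʳ (*-congˡ (pairing-moments as u n h₀ l hm)))
    where
    u = π * (ε * s)
    y≈ : y ≈ ε * (1# + u)
    y≈ = begin
      y                              ≈⟨ e ⟩
      ε + π * s                      ≈⟨ +-cong (*-identityʳ ε) (*-congʳ (*-identityʳ π)) ⟨
      ε * 1# + π * 1# * s            ≈⟨ +-congˡ (*-congʳ (*-congˡ ε²)) ⟨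
      ε * 1# + π * (ε * ε) * s       ≈⟨ solve 4 (λ e o π s → e :* o :+ π :* (e :* e) :* s := e :* (o :+ π :* (e :* s))) refl ε 1# π s ⟩
      ε * (1# + u)                   ∎
    ε-even : ∀ j → ε ^ (j ℕ.* 2) ≈ 1#
    ε-even j = trans (Ex.^-congʳ ε (ℕₚ.*-comm j 2)) (trans (sym (Ex.^-assocʳ ε 2 j))
      (trans (Ex.^-congˡ j (trans (*-congˡ (*-identityʳ ε)) ε²)) (1^ j)))
    ε-odd : ∀ j → ε ^ (j ℕ.* 2 ℕ.+ n) ≈ ε
    ε-odd j = trans (Ex.^-homo-* ε (j ℕ.* 2) n) (trans (*-cong (ε-even j) (*-congˡ (ε-even h))) (trans (*-identityˡ _) (*-identityʳ ε)))
    power : ∀ j → ∃ λ w → IsIntegral w × y ^ (j ℕ.* 2 ℕ.+ n) ≈ ε * truncated u (suc l) (j ℕ.* 2 ℕ.+ n) + π ^ suc l * w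
    power j = let s′ , hs′ , e′ = ^-truncated (int-* (int-· p) (int-* hε hs)) l (j ℕ.* 2 ℕ.+ n) in
      ε * ((ε * s) ^ suc l * s′) , int-* hε (int-* (int-^ (suc l) (int-* hε hs)) hs′) , (begin
        y ^ (j ℕ.* 2 ℕ.+ n)
          ≈⟨ Ex.^-congˡ (j ℕ.* 2 ℕ.+ n) y≈ ⟩
        (ε * (1# + u)) ^ (j ℕ.* 2 ℕ.+ n)
          ≈⟨ ^-distrib-* ε (1# + u) (j ℕ.* 2 ℕ.+ n) ⟩
        ε ^ (j ℕ.* 2 ℕ.+ n) * (1# + u) ^ (j ℕ.* 2 ℕ.+ n)
          ≈⟨ *-cong (ε-odd j) e′ ⟩
        ε * (truncated u (suc l) (j ℕ.* 2 ℕ.+ n) + u ^ suc l * s′)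
          ≈⟨ *-congˡ (+-congˡ (*-congʳ (^-distrib-* π (ε * s) (suc l)))) ⟩
        ε * (truncated u (suc l) (j ℕ.* 2 ℕ.+ n) + π ^ suc l * (ε * s) ^ suc l * s′)
          ≈⟨ solve 5 (λ e t P v s → e :* (t :+ P :* v :* s) := e :* t :+ P :* (e :* (v :* s))) refl
               ε (truncated u (suc l) (j ℕ.* 2 ℕ.+ n)) (π ^ suc l) ((ε * s) ^ suc l) s′ ⟩
        ε * truncated u (suc l) (j ℕ.* 2 ℕ.+ n) + π ^ suc l * (ε * ((ε * s) ^ suc l * s′)) ∎)
    result : ∃ λ w → IsIntegral w × ι-pairing as (y ^_) n ≈ ε * ι-pairing as (truncated u (suc l)) n + π ^ suc l * w
    result = pairing-approximation as (y ^_) (truncated u (suc l)) n power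

  pairing-divisible : ∀ {k} (as : Vec ℤ k) (g : ℕ → Carrier) {d} n →
    (∀ j → n ℕ.≤ j → ∃ λ s → IsIntegral s × g j ≈ d * s) →
    ∃ λ s → IsIntegral s × pairing (Vec.map ι as) g n ≈ d * s
  pairing-divisible as g {d} n H = let s , hs , e = pairing-approximation as g (λ _ → 0#) {0#} n (λ j →
                                         let s , hs , e = H (j ℕ.* 2 ℕ.+ n) (ℕₚ.m≤n+m n (j ℕ.* 2))
                                         in s , hs , trans e (sym (trans (+-congʳ (zeroˡ 0#)) (+-identityˡ _))))
                                   in s , hs , trans e (trans (+-congʳ (zeroˡ _)) (+-identityˡ _))

  -- 2 divides 1 - p, which is a unit of ℤₚ.
  inv-2 : ∀ {k} → p ≡ suc (k ℕ.* 2) → ∃ λ h → IsIntegral h × (2 · 1#) * h ≈ 1#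
  inv-2 {k} p≡ = - (k · 1# * φ g) , int-neg (int-* (int-· k) (int-φ g)) , (begin
    2 · 1# * - (k · 1# * φ g)               ≈⟨ RingProps.-‿distribʳ-* ring _ _ ⟨
    - (2 · 1# * (k · 1# * φ g))             ≈⟨ -‿cong (solve 3 (λ t k g → t :* (k :* g) := (k :* t) :* g) refl (2 · 1#) (k · 1#) (φ g)) ⟩
    - (k · 1# * (2 · 1#) * φ g)             ≈⟨ -‿cong (*-congʳ (sym (Mu.×1-homo-* k 2))) ⟩
    - ((k ℕ.* 2) · 1# * φ g)                ≈⟨ RingProps.-‿distribˡ-* ring _ _ ⟩
    - ((k ℕ.* 2) · 1#) * φ g                ≈⟨ *-congʳ 1-π≈ ⟨
    (1# + π * - 1#) * φ g                   ≈⟨ *-congʳ (trans (+-cong φ.1#-homo (*-cong φπ (trans (φ.-‿homo Z.1#) (-‿cong φ.1#-homo)))) refl) ⟨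
    (φ Z.1# + φ πZ * φ (Z.- Z.1#)) * φ g    ≈⟨ *-congʳ (trans (φ.+-homo _ _) (+-congˡ (φ.*-homo _ _))) ⟨
    φ (Z.1# Z.+ πZ Z.* (Z.- Z.1#)) * φ g    ≈⟨ φ.*-homo _ g ⟨
    φ ((Z.1# Z.+ πZ Z.* (Z.- Z.1#)) Z.* g)  ≈⟨ φ.⟦⟧-cong (proj₂ inverse) ⟩
    φ Z.1#                                  ≈⟨ φ.1#-homo ⟩
    1#                                      ∎)
    where
    module Z = CommutativeRing Z
    module φ = IsRingHomomorphism (proj₂ hom)
    φ = proj₁ hom
    πZ = Ops._·_ Z p Z.1#
    inverse : ∃ λ g → (Z.1# Z.+ πZ Z.* (Z.- Z.1#)) Z.* g Z.≈ Z.1#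
    inverse = Complete.geometric Z p limits Z-separated (Z.- Z.1#)
    g = proj₁ inverse
    1-π≈ : 1# + π * - 1# ≈ - ((k ℕ.* 2) · 1#)
    1-π≈ = begin
      1# + π * - 1#                         ≈⟨ +-congˡ (trans (sym (RingProps.-‿distribʳ-* ring π 1#)) (-‿cong (*-identityʳ π))) ⟩
      1# - π                                ≈⟨ +-congˡ (-‿cong (Mu.×-congˡ p≡)) ⟩
      1# - (1# + (k ℕ.* 2) · 1#)            ≈⟨ +-congˡ (sym (RingProps.-‿+-comm ring 1# _)) ⟩
      1# + (- 1# - (k ℕ.* 2) · 1#)          ≈⟨ +-assoc _ _ _ ⟨
      1# - 1# - (k ℕ.* 2) · 1#              ≈⟨ trans (+-congʳ (-‿inverseʳ 1#)) (+-identityˡ _) ⟩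
      - ((k ℕ.* 2) · 1#)                    ∎

module HeytingLemmas (H : HeytingField c ℓ ℓ′) where
  open HeytingField H
  private
    R : CommutativeRing _ _
    R = HeytingCommutativeRing.commutativeRing heytingCommutativeRing
  open RingLemmas R
  open InvLemmas R

  private
    #⇒inv : ∀ {x y} → x # y → Inv R (x - y)
    #⇒inv h = let y , _ , e = #⇒invertible h in y , e

    inv⇒#0 : ∀ {x} → Inv R x → x # 0#
    inv⇒#0 {x} h = let y , e = inv-cong (sym x-0) h in invertible⇒# (y , trans (*-comm y _) e , e)
      where
      x-0 : x - 0# ≈ x
      x-0 = ≈⇒difference (sym (+-identityˡ x))

    #0⇒inv : ∀ {x} → x # 0# → Inv R x
    #0⇒inv {x} h = inv-cong (≈⇒difference (sym (+-identityˡ x))) (#⇒inv h)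

  Inv-+ : ∀ {x y} → Inv R (x + y) → Inv R x ⊎ Inv R y
  Inv-+ {x} {y} h with #-cotrans (inv⇒#0 h) y
  ... | inj₁ x+y#y = inj₁ (inv-cong (≈⇒difference (+-comm x y)) (#⇒inv x+y#y))
  ... | inj₂ y#0   = inj₂ (#0⇒inv y#0)

  ¬Inv⇒≈0 : ∀ {x} → ¬ Inv R x → x ≈ 0#
  ¬Inv⇒≈0 {x} h = proj₁ (tight x 0#) (h ∘ #0⇒inv)

  1≉0 : ¬ 1# ≈ 0#
  1≉0 e = #-irrefl e (inv⇒#0 (1# , *-identityˡ 1#))

module Scaling (Z : CommutativeRing c₁ ℓ₁) (K : CommutativeRing c₂ ℓ₂) (Ω : CommutativeRing c ℓ)
               (Z→K : RingHom Z K) (K→Ω : RingHom K Ω)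
               (denominators : HasDenominators Z K Z→K) where
  open HasDenominators denominators
  private
    module Z = CommutativeRing Z
    module K = CommutativeRing K
    Z→Ω = compose {A = Z} {K} {Ω} Z→K K→Ω
    φ = proj₁ Z→Ω
    ψ = proj₁ K→Ω
    module ψ = IsRingHomomorphism (proj₂ K→Ω)
    module φ = IsRingHomomorphism (proj₂ Z→Ω)
    module MK = MonicRoots K Ω ψ
    module MZ = MonicRoots Z Ω φ
    module HK = HornerLemma K Ω ψ
    module HZ = HornerLemma Z Ω φ
  open CommutativeRing Ω hiding (zero)
  open Ops Ω
  open RingLemmas Ω
  open Solver commutativeSemiring using (solve; _:+_; _:*_; _:=_)
  open SetoidReasoning setoid

  fractionΩ : ∀ a → ∃ λ D → ∃ λ z → (suc D · 1#) * ψ a ≈ φ z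
  fractionΩ a = let D , z , e = fraction a in D , z ,
    trans (*-congʳ (sym (HomLemmas.φ-· K Ω K→Ω (suc D)))) (trans (sym (ψ.*-homo _ a)) (ψ.⟦⟧-cong e))

  commonDenominator : ∀ {n} (a : Vector K.Carrier n) → ∃ λ D → ∀ j → ∃ λ z → (suc D · 1#) * ψ (a j) ≈ φ z
  commonDenominator {zero}  a = 0 , λ ()
  commonDenominator {suc n} a = ℕ.pred (suc d ℕ.* suc D) , λ
    { zero    → let z = proj₁ (proj₂ (fractionΩ (a zero))) ; e = proj₂ (proj₂ (fractionΩ (a zero))) in
                Ops._·_ Z (suc D) Z.1# Z.* z , (begin
                  (suc d ℕ.* suc D) · 1# * ψ (a zero)             ≈⟨ *-congʳ (Mu.×1-homo-* (suc d) (suc D)) ⟩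
                  (suc d · 1#) * (suc D · 1#) * ψ (a zero)        ≈⟨ solve 3 (λ x y a → x :* y :* a := y :* (x :* a)) refl (suc d · 1#) (suc D · 1#) (ψ (a zero)) ⟩
                  (suc D · 1#) * ((suc d · 1#) * ψ (a zero))      ≈⟨ *-cong (HomLemmas.φ-· Z Ω Z→Ω (suc D)) (sym e) ⟨
                  φ (Ops._·_ Z (suc D) Z.1#) * φ z                ≈⟨ φ.*-homo _ z ⟨
                  φ (Ops._·_ Z (suc D) Z.1# Z.* z)                ∎)
    ; (suc j) → let z , e = proj₂ rest j in
                Ops._·_ Z (suc d) Z.1# Z.* z , (begin
                  (suc d ℕ.* suc D) · 1# * ψ (a (suc j))          ≈⟨ *-congʳ (Mu.×1-homo-* (suc d) (suc D)) ⟩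
                  (suc d · 1#) * (suc D · 1#) * ψ (a (suc j))     ≈⟨ *-assoc _ _ _ ⟩
                  (suc d · 1#) * ((suc D · 1#) * ψ (a (suc j)))   ≈⟨ *-cong (HomLemmas.φ-· Z Ω Z→Ω (suc d)) (sym e) ⟨
                  φ (Ops._·_ Z (suc d) Z.1#) * φ z                ≈⟨ φ.*-homo _ z ⟨
                  φ (Ops._·_ Z (suc d) Z.1# Z.* z)                ∎) }
    where
    d : ℕ
    d = proj₁ (fractionΩ (a zero))
    rest : ∃ λ D → ∀ j → ∃ λ z → (suc D · 1#) * ψ (a (suc j)) ≈ φ z
    rest = commonDenominator (a ∘ suc)
    D : ℕ
    D = proj₁ rest

  scale : ∀ {x} → MK.IsMonicRoot x → ∃ λ D → MZ.IsMonicRoot ((suc D · 1#) * x)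
  scale {x} (n , a , e) = D , n , proj₁ (scaled n a (proj₂ (commonDenominator a))) ,
    trans (proj₂ (scaled n a (proj₂ (commonDenominator a)))) (trans (*-congˡ e) (zeroʳ _))
    where
    D : ℕ
    D = proj₁ (commonDenominator a)
    E : Carrier
    E = suc D · 1#
    EZ : Z.Carrier
    EZ = Ops._·_ Z (suc D) Z.1#
    scaled : ∀ n (a : Vector K.Carrier n) → (∀ j → ∃ λ z → E * ψ (a j) ≈ φ z) →
             ∃ λ (b : Vector Z.Carrier n) → MZ.monicValue b (E * x) ≈ E ^ n * MK.monicValue a x
    scaled zero    a h = (λ ()) , sym (*-identityˡ _)
    scaled (suc n) a h = b , (begin
      MZ.monicValue b (E * x)
        ≈⟨ HZ.horner b (E * x) ⟩
      φ (z Z.* Ops._^_ Z EZ n) + E * x * MZ.monicValue (proj₁ rest) (E * x)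
        ≈⟨ +-cong (trans (φ.*-homo z _) (*-cong (sym (proj₂ (h zero))) (trans (HomLemmas.φ-^ Z Ω Z→Ω EZ n) (Ex.^-congˡ n (HomLemmas.φ-· Z Ω Z→Ω (suc D))))))
             (*-congˡ (proj₂ rest)) ⟩
      E * ψ (a zero) * E ^ n + E * x * (E ^ n * MK.monicValue (a ∘ suc) x)
        ≈⟨ solve 5 (λ E a P x m → E :* a :* P :+ E :* x :* (P :* m) := E :* P :* (a :+ x :* m)) refl
             E (ψ (a zero)) (E ^ n) x (MK.monicValue (a ∘ suc) x) ⟩
      E * E ^ n * (ψ (a zero) + x * MK.monicValue (a ∘ suc) x)
        ≈⟨ *-congˡ (HK.horner a x) ⟨
      E * E ^ n * MK.monicValue a x ∎)
      where
      z : Z.Carrier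
      z = proj₁ (h zero)
      rest : ∃ λ (b : Vector Z.Carrier n) → MZ.monicValue b (E * x) ≈ E ^ n * MK.monicValue (a ∘ suc) x
      rest = scaled n (a ∘ suc) (h ∘ suc)
      b : Vector Z.Carrier (suc n)
      b zero    = z Z.* Ops._^_ Z EZ n
      b (suc j) = proj₁ rest j

-- frac z d stands for z / (d + 1).
record HasFractions (Z : CommutativeRing c₁ ℓ₁) (K : CommutativeRing c₂ ℓ₂) (Z→K : RingHom Z K)
                    (ℤ→Z : RingHom ℤ-ring Z) (ℚ→K : ℚ → CommutativeRing.Carrier K) : Set (c₁ ⊔ ℓ₁ ⊔ c₂ ⊔ ℓ₂) where
  open CommutativeRing K
  field
    frac   : CommutativeRing.Carrier Z → ℕ → Carrier
    clear  : ∀ z d → proj₁ Z→K (proj₁ ℤ→Z (+ suc d)) * frac z d ≈ proj₁ Z→K z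
    split  : ∀ a → ∃ λ z → ∃ λ d → a ≈ frac z d
    ℚ→frac : ∀ a → ℚ→K a ≈ frac (proj₁ ℤ→Z (ℚ.numerator a)) (ℚ.denominator-1 a)

module FractionLemmas {Z : CommutativeRing c₁ ℓ₁} {K : CommutativeRing c₂ ℓ₂} {Z→K : RingHom Z K} {ℤ→Z : RingHom ℤ-ring Z}
                      {ℚ→K : ℚ → CommutativeRing.Carrier K} (hasFractions : HasFractions Z K Z→K ℤ→Z ℚ→K) where
  open HasFractions hasFractions
  private
    module Z = CommutativeRing Z
    ι = proj₁ ℤ→Z
    φ = proj₁ Z→K
    module ι = IsRingHomomorphism (proj₂ ℤ→Z)
    module φ = IsRingHomomorphism (proj₂ Z→K)
  open CommutativeRing K hiding (zero)
  open Ops K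
  open InvLemmas K
  open SetoidReasoning setoid
  open Solver commutativeSemiring using (solve; _:+_; _:*_; _:=_)

  private
    ℕ-· : ∀ n → n · 1# ≈ φ (ι (+ n))
    ℕ-· n = trans (sym (HomLemmas.φ-· Z K Z→K n)) (φ.⟦⟧-cong (ι-· n))
      where
      ι-· : ∀ n → Ops._·_ Z n Z.1# Z.≈ ι (+ n)
      ι-· zero    = Z.sym ι.0#-homo
      ι-· (suc n) = Z.trans (Z.+-cong (Z.sym ι.1#-homo) (ι-· n)) (Z.sym (ι.+-homo (+ 1) (+ n)))

  denominators : HasDenominators Z K Z→K
  denominators = record { fraction = λ a → let z , d , e = split a in d , z , trans (*-cong (ℕ-· (suc d)) e) (clear z d) }

  inv-ℕ : ∀ n → Inv K (suc n · 1#)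
  inv-ℕ n = frac Z.1# n , trans (*-congʳ (ℕ-· (suc n))) (trans (clear Z.1# n) φ.1#-homo)

  rational : ∀ {x d} a → (x ℚ./ 1) ≡ (d ℚ./ 1) ℚ.* a →
             φ (ι d) * ℚ→K a ≈ φ (ι x)
  rational {x} {d} a@record{} e = trans (*-congˡ (ℚ→frac a)) (inv-cancelˡ (inv-cong (ℕ-· (ℚ.denominatorℕ a)) (inv-ℕ (ℚ.denominator-1 a))) (begin
    S * (φ (ι d) * A)                   ≈⟨ solve 3 (λ s d a → s :* (d :* a) := d :* (s :* a)) refl S (φ (ι d)) A ⟩
    φ (ι d) * (S * A)                   ≈⟨ *-congˡ (clear (ι (ℚ.numerator a)) (ℚ.denominator-1 a)) ⟩
    φ (ι d) * φ (ι (ℚ.numerator a))     ≈⟨ trans (φ.⟦⟧-cong (ι.*-homo _ _)) (φ.*-homo _ _) ⟨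
    φ (ι (d ℤ.* ℚ.numerator a))         ≈⟨ φ.⟦⟧-cong (ι.⟦⟧-cong equation) ⟩
    φ (ι (x ℤ.* + ℚ.denominatorℕ a))    ≈⟨ trans (φ.⟦⟧-cong (ι.*-homo _ _)) (φ.*-homo _ _) ⟩
    φ (ι x) * S                         ≈⟨ *-comm _ S ⟩
    S * φ (ι x)                         ∎))
    where
    S = φ (ι (+ ℚ.denominatorℕ a))
    A = frac (ι (ℚ.numerator a)) (ℚ.denominator-1 a)
    unnormalised : ℚᵘ.mkℚᵘ x 0 ℚᵘ.≃ ℚᵘ.mkℚᵘ d 0 ℚᵘ.* ℚ.toℚᵘ a
    unnormalised = ℚᵘₚ.≃-trans (ℚᵘₚ.≃-sym (ℚₚᵣ.toℚᵘ-fromℚᵘ (ℚᵘ.mkℚᵘ x 0)))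
      (ℚᵘₚ.≃-trans (ℚₚᵣ.toℚᵘ-cong e) (ℚᵘₚ.≃-trans (ℚₚᵣ.toℚᵘ-homo-* (d ℚ./ 1) a)
        (ℚᵘₚ.*-cong (ℚₚᵣ.toℚᵘ-fromℚᵘ (ℚᵘ.mkℚᵘ d 0)) ℚᵘₚ.≃-refl)))
    equation : d ℤ.* ℚ.numerator a ≡ x ℤ.* + ℚ.denominatorℕ a
    equation with ℚᵘ.*≡* h ← unnormalised = ≡.trans (≡.sym (ℤₚᵣ.*-identityʳ _))
      (≡.trans (≡.sym h) (≡.cong (x ℤ.*_) (≡.cong +_ (≡.cong suc (ℕₚ.+-identityʳ (ℚ.denominator-1 a))))))

module ℚₚLemmas (p : ℕ) (p-prime : Prime p) where
  open PAdic p p-prime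
  open Fractions using (_/1+_; cross)
  open PAdicLemmas p p-prime using (pointwise)
  private
    module Z = CommutativeRing ℤₚ-ring

  fromℤ-cong : ∀ {x y} → x ≡ y → fromℤ x Z.≈ fromℤ y
  fromℤ-cong {x} {y} e = pointwise (fromℤ x) (fromℤ y) (λ _ → e)

  fromℤ-hom : RingHom ℤ-ring (PAdic.ℤₚ-ring p p-prime)
  fromℤ-hom = fromℤ , record
    { isSemiringHomomorphism = record
      { isNearSemiringHomomorphism = record
        { +-isMonoidHomomorphism = record
          { isMagmaHomomorphism = record
            { isRelHomomorphism = record { cong = fromℤ-cong }
            ; homo = λ x y → pointwise (fromℤ (x ℤ.+ y)) (fromℤ x Z.+ fromℤ y) (λ _ → ≡.refl) }
          ; ε-homo = pointwise (fromℤ (+ 0)) Z.0# (λ _ → ≡.refl) }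
        ; *-homo = λ x y → pointwise (fromℤ (x ℤ.* y)) (fromℤ x Z.* fromℤ y) (λ _ → ≡.refl) }
      ; 1#-homo = pointwise (fromℤ (+ 1)) Z.1# (λ _ → ≡.refl) }
    ; -‿homo = λ x → pointwise (fromℤ (ℤ.- x)) (Z.- fromℤ x) (λ _ → ≡.refl) }

  abstract
    hasFractions : HasFractions (PAdic.ℤₚ-ring p p-prime) (PAdic.ℚₚ-ring p p-prime) (PAdic.ℤₚ→ℚₚ p p-prime) fromℤ-hom (PAdic.ℚ→ℚₚ p p-prime)
    hasFractions .HasFractions.frac z d = z /1+ d
    hasFractions .HasFractions.clear z d = cross (pointwise ((fromℤ (+ suc d) Z.* z) Z.* fromℤ (+ 1)) (z Z.* fromℤ (+ (1 ℕ.* suc d)))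
      (λ n → ≡.trans (lemma (+ suc d) (seq z n)) (≡.cong (λ m → seq z n ℤ.* + m) (≡.sym (ℕₚ.*-identityˡ (suc d))))))
      where
      lemma : ∀ d z → (d ℤ.* z) ℤ.* + 1 ≡ z ℤ.* d
      lemma = ℤSolver.solve-∀
    hasFractions .HasFractions.split (z /1+ d) = z , d , cross (pointwise (z Z.* fromℤ (+ suc d)) (z Z.* fromℤ (+ suc d)) (λ _ → ≡.refl))
    hasFractions .HasFractions.ℚ→frac a = cross (pointwise x x (λ _ → ≡.refl))
      where
      x : ℤₚ
      x = fromℤ (ℚ.numerator a) Z.* fromℤ (+ ℚ.denominatorℕ a)

module Closure {p} (p-prime : Prime p) {Z : CommutativeRing c₁ ℓ₁} {K : CommutativeRing c₂ ℓ₂} {Z→K : RingHom Z K}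
               {ℤ→Z : RingHom ℤ-ring Z} {ℚ→K : ℚ → CommutativeRing.Carrier K} (isPAdic : IsPAdic p Z)
               (hasFractions : HasFractions Z K Z→K ℤ→Z ℚ→K) (K̅ : AlgebraicClosure K c ℓ ℓ′) where
  open FractionLemmas hasFractions
  open AlgebraicClosure K̅ using (heytingField; commutativeRing; embedding; algebraic; algebraicallyClosed)
  open CommutativeRing commutativeRing
  private
    module L = HeytingLemmas heytingField
    module E = IsRingHomomorphism (proj₂ embedding)

  setting : Setting p Z (AlgebraicClosure.commutativeRing K̅)
    (compose {A = Z} {K} {AlgebraicClosure.commutativeRing K̅} Z→K (AlgebraicClosure.embedding K̅))
  setting = record
    { p-prime = p-prime
    ; isPAdic = isPAdic
    ; Inv-+   = L.Inv-+
    ; tight   = L.¬Inv⇒≈0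
    ; 1≉0     = L.1≉0
    ; inv-ℕ   = λ n → let y , e = inv-ℕ n in proj₁ embedding y ,
        trans (*-congʳ (sym (HomLemmas.φ-· K commutativeRing embedding (suc n))))
          (trans (sym (E.*-homo _ y)) (trans (E.⟦⟧-cong e) E.1#-homo))
    ; scale   = λ x → Scaling.scale Z K commutativeRing Z→K embedding denominators (algebraic x)
    ; root    = algebraicallyClosed }

  rationalValues : HasRationalValues Z (AlgebraicClosure.commutativeRing K̅)
    (compose {A = Z} {K} {AlgebraicClosure.commutativeRing K̅} Z→K (AlgebraicClosure.embedding K̅)) ℤ→Z (λ a → proj₁ (AlgebraicClosure.embedding K̅) (ℚ→K a))
  rationalValues = record { rational = λ {x} {d} a h → trans (sym (E.*-homo _ _)) (E.⟦⟧-cong (rational {x} {d} a h)) }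

-- ℤ[ Q ] is the ring of integers of K(μ_{Q-1}), and p# Q is p in it.
record IsIntegers (p : ℕ) {Z : CommutativeRing c₁ ℓ₁} {K : CommutativeRing c₂ ℓ₂} {Ω : CommutativeRing c ℓ}
                  (Z→K : RingHom Z K) (K→Ω : RingHom K Ω) (ℤ[_] : ℕ → CommutativeRing c₃ ℓ₃) (toΩ : ∀ Q → RingHom ℤ[ Q ] Ω)
                  (p# : ∀ Q → CommutativeRing.Carrier ℤ[ Q ]) : Set (c ⊔ ℓ ⊔ c₁ ⊔ c₂ ⊔ c₃ ⊔ ℓ₃) where
  open CommutativeRing Ω
  open RootsOfUnity Ω
  open RingOfIntegers Z K Ω Z→K K→Ω using (Adjoin; IsIntegral)
  field
    injective : ∀ {Q x y} → proj₁ (toΩ Q) x ≈ proj₁ (toΩ Q) y → CommutativeRing._≈_ ℤ[ Q ] x y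
    adjoin    : ∀ {Q} x → Adjoin (IsRootOfUnity (Q ℕ.∸ 1)) (proj₁ (toΩ Q) x)
    integral  : ∀ {Q} x → IsIntegral (proj₁ (toΩ Q) x)
    element   : ∀ {Q x} → Adjoin (IsRootOfUnity (Q ℕ.∸ 1)) x → IsIntegral x → ∃ λ y → proj₁ (toΩ Q) y ≈ x
    p#≡       : ∀ Q → p# Q ≡ Ops._·_ ℤ[ Q ] p (CommutativeRing.1# ℤ[ Q ])

module ResidueFields {p} {Z : CommutativeRing c₁ ℓ₁} {K : CommutativeRing c₂ ℓ₂} {Ω : CommutativeRing c ℓ}
                     (Z→K : RingHom Z K) (K→Ω : RingHom K Ω)
                     (setting : Setting p Z Ω (compose {A = Z} {K} {Ω} Z→K K→Ω))
                     (denominators : HasDenominators Z K Z→K)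
                     (ℤ[_] : ℕ → CommutativeRing c₃ ℓ₃) (toΩ : ∀ Q → RingHom ℤ[ Q ] Ω)
                     (p# : ∀ Q → CommutativeRing.Carrier ℤ[ Q ]) (isIntegers : IsIntegers p {Z} {K} {Ω} Z→K K→Ω ℤ[_] toΩ p#) where
  open IsIntegers isIntegers public
  open RootsOfUnity Ω public using (IsRootOfUnity)
  open RingOfIntegers Z K Ω Z→K K→Ω public using (Adjoin; base; gen; add; mul; inv; resp; adjoin-mono)
  open FieldLemmas setting
  open Setting setting using (p-prime; 1≉0; inv-ℕ; root)
  open CommutativeRing Ω hiding (zero)
  open Ops Ω
  open RingLemmas Ω

  𝔽[_] : ℕ → CommutativeRing c₃ (c₃ ⊔ ℓ₃)
  𝔽[ Q ] = Quotient ℤ[ Q ] (p# Q)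

  ⟦_⟧ : ∀ {Q} → CommutativeRing.Carrier ℤ[ Q ] → Carrier
  ⟦_⟧ {Q} = proj₁ (toΩ Q)

  ⟦p#⟧≈π : ∀ Q → ⟦ p# Q ⟧ ≈ π
  ⟦p#⟧≈π Q = trans (reflexive (≡.cong ⟦_⟧ (p#≡ Q))) (HomLemmas.φ-· ℤ[ Q ] Ω (toΩ Q) p)

  module Residues (Q : ℕ) where
    private
      module R = CommutativeRing ℤ[ Q ]
      module F = CommutativeRing 𝔽[ Q ]
      module C = CongruenceLemmas ℤ[ Q ]
      module H = IsRingHomomorphism (proj₂ (toΩ Q))
    open Congruence ℤ[ Q ] using (_≋_[mod_])

    -- The quotient of x - y by m lies in ℤ[ Q ] as soon as it is integral over ℤₚ.
    congruent : ∀ {m x y} → Inv Ω ⟦ m ⟧ → (∃ λ s → IsIntegral s × ⟦ x ⟧ ≈ ⟦ y ⟧ + ⟦ m ⟧ * s) → x ≋ y [mod m ]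
    congruent {m} {x} {y} (u , mu≈1) (s , hs , e) = C.≈⇒≋ (proj₁ k , injective (trans e (sym
      (trans (H.+-homo y _) (+-congˡ (trans (H.*-homo m _) (*-congˡ (proj₂ k))))))))
      where
      s-adjoin : Adjoin (IsRootOfUnity (Q ℕ.∸ 1)) s
      s-adjoin = resp
        (inv-cancelˡ (u , mu≈1) (trans (sym (*-assoc _ u _)) (trans (*-congʳ mu≈1) (trans (*-identityˡ _)
          (trans (trans (H.+-homo x _) (+-congˡ (H.-‿homo y))) (≈⇒difference e))))))
        (mul (inv (adjoin m) mu≈1) (adjoin (x R.- y)))
      k : ∃ λ (k : R.Carrier) → ⟦ k ⟧ ≈ s
      k = element s-adjoin hs

    inv-p# : Inv Ω ⟦ p# Q ⟧
    inv-p# = inv-cong (sym (⟦p#⟧≈π Q)) inv-π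

    congruent-p : ∀ {x y : R.Carrier} → (∃ λ s → IsIntegral s × ⟦ x ⟧ ≈ ⟦ y ⟧ + π * s) → x F.≈ y
    congruent-p (s , hs , e) = congruent {p# Q} inv-p# (s , hs , trans e (+-congˡ (*-congʳ (sym (⟦p#⟧≈π Q)))))

    ≈⇒congruent-p : ∀ {x y : R.Carrier} → ⟦ x ⟧ ≈ ⟦ y ⟧ → x F.≈ y
    ≈⇒congruent-p e = congruent-p (0# , int-0 , trans e (sym (trans (+-congˡ (zeroʳ π)) (+-identityʳ _))))

    difference-p : ∀ {x y : R.Carrier} → x F.≈ y → ∃ λ (s : R.Carrier) → ⟦ x ⟧ ≈ ⟦ y ⟧ + π * ⟦ s ⟧
    difference-p {x} {y} h = proj₁ d , trans (H.⟦⟧-cong (proj₂ d))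
      (trans (H.+-homo y _) (+-congˡ (trans (H.*-homo (p# Q) _) (*-congʳ (⟦p#⟧≈π Q)))))
      where
      d : ∃ λ k → x R.≈ y R.+ p# Q R.* k
      d = C.≋⇒≈ {x} {y} h

    nontrivial : ¬ F.1# F.≈ F.0#
    nontrivial h = 1/p-not-integral (integral (proj₁ d))
      (sym (trans (sym H.1#-homo) (trans (proj₂ d) (trans (+-congʳ H.0#-homo) (+-identityˡ _)))))
      where
      d : ∃ λ (s : R.Carrier) → ⟦ R.1# ⟧ ≈ ⟦ R.0# ⟧ + π * ⟦ s ⟧
      d = difference-p h

  module PrimePower {Q : ℕ} (Q₀ r : ℕ) (Q≡ : Q ≡ suc (suc Q₀)) (Q-power : suc (suc Q₀) ≡ p ℕ.^ suc r) where
    open Residues Q public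
    private
      module I = UnramifiedIntegers setting Q₀ r Q-power
      module R = CommutativeRing ℤ[ Q ]
      module F = CommutativeRing 𝔽[ Q ]
      module OF = Ops 𝔽[ Q ]
      module LF = RingLemmas 𝔽[ Q ]
      module IF = InvLemmas 𝔽[ Q ]
      module HF = HomLemmas ℤ[ Q ] 𝔽[ Q ] (CongruenceLemmas.toQuotient ℤ[ Q ] (p# Q))
      module HΩ = HomLemmas ℤ[ Q ] Ω (toΩ Q)
      module H = IsRingHomomorphism (proj₂ (toΩ Q))
      S = IsRootOfUnity (Q ℕ.∸ 1)

    Q-1≡ : Q ℕ.∸ 1 ≡ suc Q₀
    Q-1≡ = ≡.cong (ℕ._∸ 1) Q≡

    unity-suc : ∀ {ω} → ω ^ (Q ℕ.∸ 1) ≈ 1# → ω ^ suc Q₀ ≈ 1#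
    unity-suc {ω} = ≡.subst (λ n → ω ^ n ≈ 1#) Q-1≡

    unity-pred : ∀ {ω} → ω ^ suc Q₀ ≈ 1# → ω ^ (Q ℕ.∸ 1) ≈ 1#
    unity-pred {ω} = ≡.subst (λ n → ω ^ n ≈ 1#) (≡.sym Q-1≡)

    integer⇒invariant : (x : R.Carrier) → I.Invariant ⟦ x ⟧
    integer⇒invariant x = AdjoinLemmas.integer⇒invariant Z→K K→Ω setting denominators Q₀ r Q-power
      (adjoin-mono unity-suc (adjoin x)) (integral x)

    invariant⇒adjoin : ∀ {x} → I.Invariant x → Adjoin S x
    invariant⇒adjoin = I.invariant-elim (Adjoin S) resp (resp K→Ω.0#-homo (base (CommutativeRing.0# K))) add
      (λ a h → mul (base (proj₁ Z→K a)) (gen (unity-pred h)))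
      where module K→Ω = IsRingHomomorphism (proj₂ K→Ω)

    trace-adjoin : ∀ i m {w} → w ^ suc m ≈ 1# → w ^ (Q ℕ.^ i) ≈ w → Adjoin S (sum {i} (λ j → w ^ (Q ℕ.^ toℕ j)))
    trace-adjoin i m {w} = ≡.subst (λ n → w ^ suc m ≈ 1# → w ^ (n ℕ.^ i) ≈ w → Adjoin S (sum {i} (λ j → w ^ (n ℕ.^ toℕ j))))
      (≡.sym Q≡) (λ h fixed → invariant⇒adjoin (I.trace∈ i m h fixed))

    unity∈ : ∀ {ω} → ω ^ suc Q₀ ≈ 1# → R.Carrier
    unity∈ h = proj₁ (element (gen (unity-pred h)) (int-unity Q₀ h))

    ⟦unity∈⟧ : ∀ {ω} (h : ω ^ suc Q₀ ≈ 1#) → ⟦ unity∈ h ⟧ ≈ ω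
    ⟦unity∈⟧ h = proj₂ (element (gen (unity-pred h)) (int-unity Q₀ h))

    frobenius : ∀ (x : R.Carrier) → x OF.^ Q F.≈ x
    frobenius x = F.trans (F.sym (HF.φ-^ x Q)) (congruent-p (y , I.invariant⇒integral hy ,
        trans (HΩ.φ-^ x Q) (≡.subst (λ n → ⟦ x ⟧ ^ n ≈ ⟦ x ⟧ + π * y) (≡.sym Q≡) e)))
      where
      frob = I.invariant-frobenius (integer⇒invariant x)
      y = proj₁ frob
      hy = proj₁ (proj₂ frob)
      e = proj₂ (proj₂ frob)

    residue-digit : ∀ (x : R.Carrier) → x F.≈ F.0# ⊎ ∃ λ ω → ∃ λ (h : ω ^ suc Q₀ ≈ 1#) → x F.≈ unity∈ h
    residue-digit x = by-digit (I.digit (integer⇒invariant x))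
      where
      by-digit : I.Digit ⟦ x ⟧ → x F.≈ F.0# ⊎ ∃ λ ω → ∃ λ (h : ω ^ suc Q₀ ≈ 1#) → x F.≈ unity∈ h
      by-digit (ω , inj₁ ω≈0 , t , ht , e) = inj₁ (congruent-p (t , I.invariant⇒integral ht ,
        trans e (+-congʳ (trans ω≈0 (sym (IsRingHomomorphism.0#-homo (proj₂ (toΩ Q))))))))
      by-digit (ω , inj₂ h , t , ht , e)   = inj₂ (ω , h , congruent-p (t , I.invariant⇒integral ht , trans e (+-congʳ (sym (⟦unity∈⟧ h)))))

    unit-power : ∀ {y : R.Carrier} → IsUnit 𝔽[ Q ] y → y OF.^ suc Q₀ F.≈ F.1#
    unit-power {y} u = IF.inv-cancelˡ {y} (RawMagmaOps._∣ʳ_.quotient u , F.trans (F.*-comm y _) (RawMagmaOps._∣ʳ_.equality u))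
      (F.trans (≡.subst (λ n → y OF.^ n F.≈ y) Q≡ (frobenius y)) (F.sym (F.*-identityʳ y)))

    module _ {E} (2E≡ : E ℕ.* 2 ≡ suc Q₀) where

      private
        double : ∀ (y : R.Carrier) → (y F.* y) OF.^ E F.≈ y OF.^ suc Q₀
        double y = F.trans (LF.^-distrib-* y y E) (F.trans (F.sym (LF.Ex.^-homo-* y E E))
          (LF.Ex.^-congʳ y (≡.trans (≡.cong (E ℕ.+_) (≡.sym (ℕₚ.+-identityʳ E))) (≡.trans (ℕₚ.*-comm 2 E) 2E≡))))

      square-power : ∀ {x} → IsUnitSquare 𝔽[ Q ] x → x OF.^ E F.≈ F.1#
      square-power {x} (y , unit , e) = F.trans (LF.Ex.^-congˡ E (F.sym e)) (F.trans (double y) (unit-power unit))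

      private
        signs : ∀ {ε} → ε * ε ≈ 1# → ε ≈ 1# ⊎ ε ≈ - 1#
        signs {ε} h = [ (λ e → inj₁ (trans (difference⇒≈ e) (+-identityʳ 1#))) ,
                        (λ i → inj₂ (RingProps.+-inverseˡ-unique ring ε 1# (inv-cancelˡ i (trans vanish (sym (zeroʳ _)))))) ]′
                      (unity-≟ 1 {ε} {1#} (trans (*-congˡ (*-identityʳ ε)) h) (1^ 2))
          where
          vanish : (ε - 1#) * (ε + 1#) ≈ 0#
          vanish = begin
            (ε - 1#) * (ε + 1#)              ≈⟨ solve 3 (λ e n o → (e :+ n) :* (e :+ o) := e :* e :+ (n :* e :+ e :* o) :+ n :* o) refl ε (- 1#) 1# ⟩
            ε * ε + (- 1# * ε + ε * 1#) + - 1# * 1#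
              ≈⟨ +-cong (+-cong h (trans (+-cong (RingProps.-1*x≈-x ring ε) (*-identityʳ ε)) (-‿inverseˡ ε))) (*-identityʳ _) ⟩
            1# + 0# + - 1#                   ≈⟨ trans (+-congʳ (+-identityʳ 1#)) (-‿inverseʳ 1#) ⟩
            0#                               ∎
            where
            open SetoidReasoning setoid
            open Solver commutativeSemiring using (solve; _:+_; _:*_; _:=_)

        square-root : ∀ ω → ∃ λ η → η * η ≈ ω
        square-root ω = η , (begin
          η * η              ≈⟨ +-identityʳ _ ⟨
          η * η + 0#         ≈⟨ +-congˡ (-‿inverseˡ ω) ⟨
          η * η + (- ω + ω)  ≈⟨ +-assoc _ _ _ ⟨
          η * η - ω + ω      ≈⟨ +-congʳ (trans (sym (+-cong (*-congˡ (*-identityʳ η))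
                                 (trans (+-cong (*-identityʳ _) (trans (+-identityʳ _) (zeroˡ _))) (+-identityʳ _)))) e) ⟩
          0# + ω             ≈⟨ +-identityˡ ω ⟩
          ω                  ∎)
          where
          open SetoidReasoning setoid
          a : Vector Carrier 2
          a zero    = - ω
          a (suc _) = 0#
          η : Carrier
          η = proj₁ (root a)
          e : MonicRoots.monicValue Ω Ω id a η ≈ 0#
          e = proj₂ (root a)

        power-unity : ∀ {ω} → ω ^ suc Q₀ ≈ 1# → ω ^ E * ω ^ E ≈ 1#
        power-unity {ω} h = trans (sym (Ex.^-homo-* ω E E))
          (trans (Ex.^-congʳ ω (≡.trans (≡.cong (E ℕ.+_) (≡.sym (ℕₚ.+-identityʳ E))) (≡.trans (ℕₚ.*-comm 2 E) 2E≡))) h)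

      -- If ω^E = 1, a square root of ω is again a (Q - 1)-th root of unity.
      nonsquare-power : ∀ {x} → IsUnitNonsquare 𝔽[ Q ] x → x OF.^ E F.≈ F.- F.1#
      nonsquare-power {x} (unit , nonsquare) = by-digit (residue-digit x)
        where
        by-digit : (x F.≈ F.0# ⊎ ∃ λ ω → ∃ λ (h : ω ^ suc Q₀ ≈ 1#) → x F.≈ unity∈ h) → x OF.^ E F.≈ F.- F.1#
        by-digit (inj₁ x≈0) = contradiction
          (F.trans (F.sym (RawMagmaOps._∣ʳ_.equality unit)) (F.trans (F.*-congˡ {RawMagmaOps._∣ʳ_.quotient unit} x≈0) (F.zeroʳ _))) nontrivial
        by-digit (inj₂ (ω , h , x≈ω)) = by-sign (signs (power-unity h))
          where
          by-sign : ω ^ E ≈ 1# ⊎ ω ^ E ≈ - 1# → x OF.^ E F.≈ F.- F.1#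
          by-sign (inj₂ ε≈-1) = F.trans (LF.Ex.^-congˡ E x≈ω) (F.trans (F.sym (HF.φ-^ (unity∈ h) E))
            (≈⇒congruent-p (trans (HΩ.φ-^ (unity∈ h) E) (trans (Ex.^-congˡ E (⟦unity∈⟧ h))
              (trans ε≈-1 (sym (trans (H.-‿homo R.1#) (-‿cong H.1#-homo))))))))
          by-sign (inj₁ ε≈1) = contradiction (unity∈ η-unity , η-unit , F.sym (F.trans x≈ω (≈⇒congruent-p
              (trans (⟦unity∈⟧ h) (trans (sym η²≈ω) (sym (trans (H.*-homo _ _) (*-cong (⟦unity∈⟧ η-unity) (⟦unity∈⟧ η-unity))))))))) nonsquare
            where
            η : Carrier
            η = proj₁ (square-root ω)
            η²≈ω : η * η ≈ ω
            η²≈ω = proj₂ (square-root ω)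
            η-unity : η ^ suc Q₀ ≈ 1#
            η-unity = trans (Ex.^-congʳ η (≡.trans (≡.sym 2E≡) (≡.trans (ℕₚ.*-comm E 2) (≡.cong (E ℕ.+_) (ℕₚ.+-identityʳ E)))))
              (trans (Ex.^-homo-* η E E) (trans (sym (^-distrib-* η η E)) (trans (Ex.^-congˡ E η²≈ω) ε≈1)))
            η⁻¹-unity : (η ^ Q₀) ^ suc Q₀ ≈ 1#
            η⁻¹-unity = trans (Ex.^-assocʳ η Q₀ (suc Q₀)) (trans (Ex.^-congʳ η (ℕₚ.*-comm Q₀ (suc Q₀)))
              (trans (sym (Ex.^-assocʳ η (suc Q₀) Q₀)) (trans (Ex.^-congˡ Q₀ η-unity) (1^ Q₀))))
            η-unit : IsUnit 𝔽[ Q ] (unity∈ η-unity)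
            η-unit = record { quotient = unity∈ η⁻¹-unity ; equality = ≈⇒congruent-p
              (trans (H.*-homo _ _) (trans (*-cong (⟦unity∈⟧ η⁻¹-unity) (⟦unity∈⟧ η-unity)) (trans (*-comm _ η) (trans η-unity (sym H.1#-homo))))) }

module EulerianFunctions {p} {Z : CommutativeRing c₁ ℓ₁} {K : CommutativeRing c₂ ℓ₂} {Ω : CommutativeRing c ℓ}
                         (Z→K : RingHom Z K) (K→Ω : RingHom K Ω)
                         (setting : Setting p Z Ω (compose {A = Z} {K} {Ω} Z→K K→Ω))
                         (denominators : HasDenominators Z K Z→K)
                         (ℤ→Z : RingHom ℤ-ring Z) (ℚ→Ω : ℚ → CommutativeRing.Carrier Ω)
                         (rationalValues : HasRationalValues Z Ω (compose {A = Z} {K} {Ω} Z→K K→Ω) ℤ→Z ℚ→Ω)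
                         (ℤ[_] : ℕ → CommutativeRing c₃ ℓ₃) (toΩ : ∀ Q → RingHom ℤ[ Q ] Ω)
                         (p# : ∀ Q → CommutativeRing.Carrier ℤ[ Q ]) (isIntegers : IsIntegers p {Z} {K} {Ω} Z→K K→Ω ℤ[_] toΩ p#)
                         (includeℤ : ∀ q i → RingHom ℤ[ q ] ℤ[ q ℕ.^ i ])
                         (includeℤ-toΩ : ∀ q i x → CommutativeRing._≈_ Ω (proj₁ (toΩ (q ℕ.^ i)) (proj₁ (includeℤ q i) x)) (proj₁ (toΩ q) x))
                         (include𝔽 : ∀ q i → RingHom (Quotient ℤ[ q ] (p# q)) (Quotient ℤ[ q ℕ.^ i ] (p# (q ℕ.^ i))))
                         (include𝔽≡ : ∀ q i x → proj₁ (include𝔽 q i) x ≡ proj₁ (includeℤ q i) x) where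
  open HasRationalValues rationalValues
  open ResidueFields {K = K} {Ω = Ω} Z→K K→Ω setting denominators ℤ[_] toΩ p# isIntegers
  open FieldLemmas setting
  open Setting setting using (p-prime; inv-ℕ)
  open CommutativeRing Ω hiding (zero)
  open Ops Ω
  open RingLemmas Ω
  private
    Z→Ω : RingHom Z Ω
    Z→Ω = compose {A = Z} {K} {Ω} Z→K K→Ω

    ι-hom : RingHom ℤ-ring Ω
    ι-hom = compose {A = ℤ-ring} {Z} {Ω} ℤ→Z Z→Ω

    ι = proj₁ ι-hom
    module ι = IsRingHomomorphism (proj₂ ι-hom)
    module K→Ω = IsRingHomomorphism (proj₂ K→Ω)
    module In = Interpolation setting ι-hom (λ z → int-φ (proj₁ ℤ→Z z))

    inv-2^ : ∀ k → p ≡ suc (k ℕ.* 2) → ∀ e → ∃ λ h → IsIntegral h × ι (+ (2 ℕ.^ e)) * h ≈ 1#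
    inv-2^ k p≡ zero    = 1# , int-1 , trans (*-identityʳ _) ι.1#-homo
    inv-2^ k p≡ (suc e) = proj₁ half * proj₁ rest , int-* (proj₁ (proj₂ half)) (proj₁ (proj₂ rest)) , (begin
      ι (+ (2 ℕ.^ suc e)) * (proj₁ half * proj₁ rest)
        ≈⟨ *-congʳ (trans (ι.⟦⟧-cong (ℤₚᵣ.pos-* 2 (2 ℕ.^ e))) (trans (ι.*-homo (+ 2) _) (*-congʳ ι-2))) ⟩
      (2 · 1#) * ι (+ (2 ℕ.^ e)) * (proj₁ half * proj₁ rest)
        ≈⟨ solve 4 (λ t d h r → t :* d :* (h :* r) := (t :* h) :* (d :* r)) refl (2 · 1#) (ι (+ (2 ℕ.^ e))) (proj₁ half) (proj₁ rest) ⟩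
      (2 · 1#) * proj₁ half * (ι (+ (2 ℕ.^ e)) * proj₁ rest)
        ≈⟨ *-cong (proj₂ (proj₂ half)) (proj₂ (proj₂ rest)) ⟩
      1# * 1#
        ≈⟨ *-identityˡ 1# ⟩
      1# ∎)
      where
      open SetoidReasoning setoid
      open Solver commutativeSemiring using (solve; _:+_; _:*_; _:=_)
      half = In.inv-2 {k} p≡
      rest = inv-2^ k p≡ e
      ι-2 : ι (+ 2) ≈ 2 · 1#
      ι-2 = trans (ι.+-homo (+ 1) (+ 1)) (+-cong ι.1#-homo (trans ι.1#-homo (sym (+-identityʳ 1#))))

  module Norms (q q₀ r i Q₀ R : ℕ) (q≡ : q ≡ suc (suc q₀)) (q-power : suc (suc q₀) ≡ p ℕ.^ suc r)
               (Q≡ : q ℕ.^ i ≡ suc (suc Q₀)) (Q-power : suc (suc Q₀) ≡ p ℕ.^ suc R) where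
    private
      module ℤq = CommutativeRing ℤ[ q ]
      module ℤQ = CommutativeRing ℤ[ q ℕ.^ i ]
      module 𝔽Q = CommutativeRing 𝔽[ q ℕ.^ i ]
      module Hq = IsRingHomomorphism (proj₂ (toΩ q))
      module HQ = IsRingHomomorphism (proj₂ (toΩ (q ℕ.^ i)))
      module Pq = PrimePower {q} q₀ r q≡ q-power
      module PQ = PrimePower {q ℕ.^ i} Q₀ R Q≡ Q-power
      open Polynomials ℤ[ q ] using (Poly; quasiNorm; _^ₚ_; coeff)
      open Character

      q≡p^ : q ≡ p ℕ.^ suc r
      q≡p^ = ≡.trans q≡ q-power

    private
      ℤQ→𝔽Q : RingHom ℤ[ q ℕ.^ i ] 𝔽[ q ℕ.^ i ]
      ℤQ→𝔽Q = CongruenceLemmas.toQuotient ℤ[ q ℕ.^ i ] (p# (q ℕ.^ i))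

      module Eℤ = Evaluation ℤ[ q ] ℤ[ q ℕ.^ i ] (includeℤ q i)
      module EΩ = Evaluation ℤ[ q ] Ω (toΩ q)
      module E𝔽 = Evaluation ℤ[ q ] 𝔽[ q ℕ.^ i ] (compose {A = ℤ[ q ]} {ℤ[ q ℕ.^ i ]} {𝔽[ q ℕ.^ i ]} (includeℤ q i) ℤQ→𝔽Q)
      module Ef = Evaluation 𝔽[ q ] 𝔽[ q ℕ.^ i ] (include𝔽 q i)
      module Lift = EvaluationLift ℤ[ q ] (p# q) 𝔽[ q ℕ.^ i ] (compose {A = ℤ[ q ]} {ℤ[ q ℕ.^ i ]} {𝔽[ q ℕ.^ i ]} (includeℤ q i) ℤQ→𝔽Q) (include𝔽 q i)
        (λ x → 𝔽Q.reflexive (include𝔽≡ q i x))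
      module ℤ→Ω = EvaluationHom ℤ[ q ] ℤ[ q ℕ.^ i ] Ω (includeℤ q i) (toΩ (q ℕ.^ i)) (toΩ q) (includeℤ-toΩ q i)
      module ℤ→𝔽 = EvaluationHom ℤ[ q ] ℤ[ q ℕ.^ i ] 𝔽[ q ℕ.^ i ] (includeℤ q i) ℤQ→𝔽Q
        (compose {A = ℤ[ q ]} {ℤ[ q ℕ.^ i ]} {𝔽[ q ℕ.^ i ]} (includeℤ q i) ℤQ→𝔽Q) (λ _ → 𝔽Q.refl)
      module O𝔽 = Ops 𝔽[ q ℕ.^ i ]
      module L𝔽 = RingLemmas 𝔽[ q ℕ.^ i ]
      module Oℤ = Ops ℤ[ q ℕ.^ i ]
      module H𝔽 = HomLemmas ℤ[ q ℕ.^ i ] 𝔽[ q ℕ.^ i ] ℤQ→𝔽Q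
      module HΩ = HomLemmas ℤ[ q ℕ.^ i ] Ω (toΩ (q ℕ.^ i))

      fixed : ∀ a → proj₁ (include𝔽 q i) a O𝔽.^ (p ℕ.^ suc r) 𝔽Q.≈ proj₁ (include𝔽 q i) a
      fixed a = 𝔽Q.trans (𝔽Q.sym (HomLemmas.φ-^ 𝔽[ q ] 𝔽[ q ℕ.^ i ] (include𝔽 q i) a (p ℕ.^ suc r)))
        (IsRingHomomorphism.⟦⟧-cong (proj₂ (include𝔽 q i))
          (≡.subst (λ n → CommutativeRing._≈_ 𝔽[ q ] (Ops._^_ 𝔽[ q ] a n) a) q≡p^ (Pq.frobenius a)))

      module FE = E𝔽.Frobenius p-prime (CongruenceLemmas.quotient-char ℤ[ q ℕ.^ i ] p (ℤQ.reflexive (p#≡ (q ℕ.^ i)))) (suc r)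
        (λ a → ≡.subst (λ x → x O𝔽.^ (p ℕ.^ suc r) 𝔽Q.≈ x) (include𝔽≡ q i a) (fixed a))

    module AtPoint {N} (embed : ∃ (IsRootOfUnity (q ℕ.^ i ℕ.∸ 1)) → ℤQ.Carrier) (embed-value : ∀ x → ⟦ embed x ⟧ ≡ proj₁ x)
                   (F : Poly N) (z : Vec (∃ (IsRootOfUnity (q ℕ.^ i ℕ.∸ 1))) N) where
      private
        zℤ : Vec ℤQ.Carrier N
        zℤ = Vec.map embed z

        Xℤ : Character ℤ[ q ℕ.^ i ] N
        Xℤ = Characters.point ℤ[ q ℕ.^ i ] zℤ
        X𝔽 : Character 𝔽[ q ℕ.^ i ] N
        X𝔽 = Characters.point 𝔽[ q ℕ.^ i ] zℤ
        XΩ : Character Ω N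
        XΩ = Characters.point Ω (Vec.map proj₁ z)

        Xℤ→Ω : ∀ α → ⟦ χ Xℤ α ⟧ ≈ χ XΩ α
        Xℤ→Ω α = trans (ℤ→Ω.monomial-hom α zℤ) (reflexive (≡.cong (Polynomials.monomial Ω α)
          (≡.trans (≡.sym (Vecₚ.map-∘ ⟦_⟧ embed z)) (Vecₚ.map-cong embed-value z))))

        Xℤ→𝔽 : ∀ α → χ Xℤ α 𝔽Q.≈ χ X𝔽 α
        Xℤ→𝔽 α = 𝔽Q.trans (ℤ→𝔽.monomial-hom α zℤ) (𝔽Q.reflexive (≡.cong (Polynomials.monomial 𝔽[ q ℕ.^ i ] α) (Vecₚ.map-id zℤ)))

        H : Poly N
        H = quasiNorm q i F

      norm : ℤQ.Carrier
      norm = Eℤ.evalAt Xℤ H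

      valueΩ : Poly N → Carrier
      valueΩ g = Polynomials.eval Ω (mapCoeffs (proj₁ (toΩ q)) g) (Vec.map proj₁ z)

      valueΩ-power : ∀ m → valueΩ (quasiNorm q i (F ^ₚ m)) ≈ ⟦ norm ⟧ ^ m
      valueΩ-power m = trans (EΩ.eval≈ (quasiNorm q i (F ^ₚ m)) (Vec.map proj₁ z))
        (trans (EΩ.quasiNorm-^ XΩ q i F m) (Ex.^-congˡ m (sym (ℤ→Ω.evalAt-hom Xℤ XΩ Xℤ→Ω H))))

      -- i N(F) is the sum of the conjugates of N(F), in which every monomial contributes a trace.
      norm-adjoin : 1 ℕ.≤ i → Adjoin (IsRootOfUnity (q ℕ.∸ 1)) (⟦ norm ⟧)
      norm-adjoin 1≤i = resp (inv-cancelˡ inv-i cancel) (mul (inv i-adjoin (proj₂ inv-i)) sum-adjoin)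
        where
        A = Adjoin (IsRootOfUnity (q ℕ.∸ 1))
        inv-i : Inv Ω (i · 1#)
        inv-i = ≡.subst (λ n → Inv Ω (n · 1#)) (ℕₚ.suc-pred i {{ℕ.>-nonZero 1≤i}}) (inv-ℕ (ℕ.pred i))
        i-adjoin : A (i · 1#)
        i-adjoin = resp (HomLemmas.φ-· K Ω K→Ω i) (base (Ops._·_ K i (CommutativeRing.1# K)))
        monomial-unity : ∀ α → χ XΩ α ^ suc Q₀ ≈ 1#
        monomial-unity α = PQ.unity-suc (Characters.monomial-closed Ω (IsRootOfUnity (q ℕ.^ i ℕ.∸ 1)) (1^ (q ℕ.^ i ℕ.∸ 1))
          (λ {x} {y} h k → trans (^-distrib-* x y (q ℕ.^ i ℕ.∸ 1)) (trans (*-cong h k) (*-identityˡ 1#))) α z)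
        monomial-fixed : ∀ α → χ XΩ α ^ (q ℕ.^ i) ≈ χ XΩ α
        monomial-fixed α = trans (Ex.^-congʳ (χ XΩ α) Q≡) (trans (*-congˡ (monomial-unity α)) (*-identityʳ _))
        conjugates : ℕ → Carrier
        conjugates j = EΩ.evalAt (Characters._↑_ Ω XΩ (q ℕ.^ j)) H
        nΩ : Carrier
        nΩ = EΩ.evalAt XΩ H
        sum-adjoin : A (sum {i} (λ j → conjugates (toℕ j)))
        sum-adjoin = EΩ.conjugateSum-closed XΩ A (resp K→Ω.0#-homo (base (CommutativeRing.0# K))) add resp i (q ℕ.^_)
          (λ a α → mul (adjoin a) (Pq.trace-adjoin i Q₀ (monomial-unity α) (monomial-fixed α))) H
        sum≈ : sum {i} (λ j → conjugates (toℕ j)) ≈ i · 1# * ⟦ norm ⟧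
        sum≈ = trans (S.sum-cong-≋ {i} (λ j → EΩ.quasiNorm-rotate XΩ q i monomial-fixed F (toℕ j)))
          (trans (S.sum-replicate i) (trans (·≈* i nΩ) (*-congˡ (sym (ℤ→Ω.evalAt-hom Xℤ XΩ Xℤ→Ω H)))))
        cancel : i · 1# * (proj₁ inv-i * sum {i} (λ j → conjugates (toℕ j))) ≈ i · 1# * ⟦ norm ⟧
        cancel = trans (sym (*-assoc _ _ _)) (trans (*-congʳ (proj₂ inv-i)) (trans (*-identityˡ _) sum≈))

      valueF : 𝔽Q.Carrier
      valueF = E𝔽.evalAt X𝔽 F

      norm≈power : norm 𝔽Q.≈ valueF O𝔽.^ geometricSum q i
      norm≈power = 𝔽Q.trans (ℤ→𝔽.evalAt-hom Xℤ X𝔽 Xℤ→𝔽 H)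
        (≡.subst (λ n → E𝔽.evalAt X𝔽 (quasiNorm n i F) 𝔽Q.≈ valueF O𝔽.^ geometricSum n i) (≡.sym q≡p^)
          (FE.evalAt-quasiNorm-frobenius X𝔽 i F))

      valueF≈ : ∀ (f : Polynomials.Poly 𝔽[ q ] N) →
        (∀ α → CommutativeRing._≈_ 𝔽[ q ] (coeff F α) (Polynomials.coeff 𝔽[ q ] f α)) →
        Polynomials.eval 𝔽[ q ℕ.^ i ] (mapCoeffs (proj₁ (include𝔽 q i)) f) zℤ 𝔽Q.≈ valueF
      valueF≈ f lift = 𝔽Q.trans (Ef.eval≈ f zℤ) (Lift.evalAt-lift X𝔽 f F lift)

      module Value {M l k} (p≡ : p ≡ suc (k ℕ.* 2)) (M*2≡ : M ℕ.* 2 ≡ suc q₀) (1≤i : 1 ℕ.≤ i)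
                 (n : ℕ) (n-odd : ∃ λ h → n ≡ suc (h ℕ.* 2)) (l≤nM : suc l ℕ.≤ n ℕ.* M)
                 (P⁻¹ : Matrix (suc l)) (isInverse : IsInverse (P (+ n) (suc l)) P⁻¹) where
        private
          Y : Carrier
          Y = ⟦ norm ⟧ ^ M
          int-norm : IsIntegral (⟦ norm ⟧)
          int-norm = integral norm
          A = Adjoin (IsRootOfUnity (q ℕ.∸ 1))
          E : ℕ
          E = geometricSum q i ℕ.* M
          row : ∃ λ e → ∃ λ (as : Vec ℤ (suc l)) → IntegralRow.moment as 0 n ≡ + (2 ℕ.^ e) ×
            (∀ m → m ℕ.< l → IntegralRow.moment as (suc m) n ≡ + 0) ×
            (∀ k → RationalRow.ℤ→ℚ (Vec.lookup as k) ≡ RationalRow.ℤ→ℚ (+ (2 ℕ.^ e)) ℚ.* P⁻¹ zero k)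
          row = RationalRow.firstRow-integral n P⁻¹ isInverse
          e = proj₁ row
          as = proj₁ (proj₂ row)
          D : Carrier
          D = ι (+ (2 ℕ.^ e))
          D⁻¹ = proj₁ (inv-2^ k p≡ e)
          int-D⁻¹ = proj₁ (proj₂ (inv-2^ k p≡ e))
          DD⁻¹≈1 = proj₂ (proj₂ (inv-2^ k p≡ e))
          pairing : Carrier
          pairing = Steps.pairing Ω (Vec.map ι as) (Y ^_) n

        eulerianValue : Carrier
        eulerianValue = sum λ k → ℚ→Ω (P⁻¹ zero k) * valueΩ (quasiNorm q i (F ^ₚ ((n ℕ.+ 2 ℕ.* toℕ k) ℕ.* M)))

        private
          D*value≈ : D * eulerianValue ≈ pairing
          D*value≈ = begin
            D * eulerianValue
              ≈⟨ S.*-distribˡ-sum {suc l} D (λ k → ℚ→Ω (P⁻¹ zero k) * valueΩ (quasiNorm q i (F ^ₚ ((n ℕ.+ 2 ℕ.* toℕ k) ℕ.* M)))) ⟩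
            sum (λ k → D * (ℚ→Ω (P⁻¹ zero k) * valueΩ (quasiNorm q i (F ^ₚ ((n ℕ.+ 2 ℕ.* toℕ k) ℕ.* M)))))
              ≈⟨ S.sum-cong-≋ {suc l} term ⟩
            sum (λ k → Vec.lookup (Vec.map ι as) k * Y ^ (n ℕ.+ 2 ℕ.* toℕ k))
              ≈⟨ Steps.pairing≈sum Ω (Vec.map ι as) (Y ^_) n ⟨
            pairing ∎
            where
            open SetoidReasoning setoid
            term : ∀ k → D * (ℚ→Ω (P⁻¹ zero k) * valueΩ (quasiNorm q i (F ^ₚ ((n ℕ.+ 2 ℕ.* toℕ k) ℕ.* M)))) ≈
                         Vec.lookup (Vec.map ι as) k * Y ^ (n ℕ.+ 2 ℕ.* toℕ k)
            term k = trans (sym (*-assoc _ _ _)) (*-cong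
              (trans (rational (P⁻¹ zero k) (proj₂ (proj₂ (proj₂ (proj₂ row))) k)) (reflexive (≡.sym (Vecₚ.lookup-map k ι as))))
              (trans (valueΩ-power ((n ℕ.+ 2 ℕ.* toℕ k) ℕ.* M)) (trans (Ex.^-congʳ (⟦ norm ⟧) (ℕₚ.*-comm (n ℕ.+ 2 ℕ.* toℕ k) M))
                (sym (Ex.^-assocʳ (⟦ norm ⟧) M (n ℕ.+ 2 ℕ.* toℕ k))))))

          value≈ : ∀ {ε d w} → pairing ≈ ε * D + d * w → eulerianValue ≈ ε + d * (D⁻¹ * w)
          value≈ {ε} {d} {w} h = inv-cancelˡ (D⁻¹ , DD⁻¹≈1) (trans D*value≈ (trans h (begin
            ε * D + d * w                  ≈⟨ +-congˡ (*-congˡ (*-identityˡ w)) ⟨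
            ε * D + d * (1# * w)           ≈⟨ +-congˡ (*-congˡ (*-congʳ DD⁻¹≈1)) ⟨
            ε * D + d * (D * D⁻¹ * w)      ≈⟨ solve 5 (λ e D d i w → e :* D :+ d :* (D :* i :* w) := D :* (e :+ d :* (i :* w))) refl ε D d D⁻¹ w ⟩
            D * (ε + d * (D⁻¹ * w))        ∎)))
            where
            open SetoidReasoning setoid
            open Solver commutativeSemiring using (solve; _:+_; _:*_; _:=_)

          value-multiple : ∀ {d} → (∃ λ w → IsIntegral w × pairing ≈ d * w) → ∃ λ w → IsIntegral w × eulerianValue ≈ 0# + d * w
          value-multiple (w , hw , h) = D⁻¹ * w , int-* int-D⁻¹ hw ,
            value≈ (trans h (sym (trans (+-congʳ (zeroˡ D)) (+-identityˡ _))))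

          value-integral : IsIntegral eulerianValue
          value-integral = let w , hw , h = value-multiple (In.pairing-divisible as (Y ^_) {1#} n
                                 (λ j _ → Y ^ j , int-^ j (int-^ M int-norm) , sym (*-identityˡ _)))
                           in int-cong (sym (trans h (trans (+-identityˡ _) (*-identityˡ w)))) hw

          rational-adjoin : ∀ k → A (ℚ→Ω (P⁻¹ zero k))
          rational-adjoin k = resp (inv-cancelˡ (D⁻¹ , DD⁻¹≈1) (trans (sym (*-assoc D D⁻¹ _)) (trans (*-congʳ DD⁻¹≈1)
              (trans (*-identityˡ _) (sym (rational (P⁻¹ zero k) (proj₂ (proj₂ (proj₂ (proj₂ row))) k)))))))
            (mul (inv (base _) DD⁻¹≈1) (base (proj₁ Z→K (proj₁ ℤ→Z (Vec.lookup as k)))))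

          power-adjoin : ∀ m → A (⟦ norm ⟧ ^ m)
          power-adjoin zero    = resp K→Ω.1#-homo (base (CommutativeRing.1# K))
          power-adjoin (suc m) = mul (norm-adjoin 1≤i) (power-adjoin m)

          value-adjoin : A eulerianValue
          value-adjoin = sum-closed A (resp K→Ω.0#-homo (base (CommutativeRing.0# K))) add {suc l} _
              (λ k → mul (rational-adjoin k) (resp (sym (valueΩ-power ((n ℕ.+ 2 ℕ.* toℕ k) ℕ.* M))) (power-adjoin ((n ℕ.+ 2 ℕ.* toℕ k) ℕ.* M))))

        Φ : ℤq.Carrier
        Φ = proj₁ (element value-adjoin value-integral)

        ⟦Φ⟧ : ⟦ Φ ⟧ ≈ eulerianValue
        ⟦Φ⟧ = proj₂ (element value-adjoin value-integral)

        private
          pˡ : ℤq.Carrier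
          pˡ = Ops._^_ ℤ[ q ] (p# q) (suc l)
          pˡ≈ : ⟦ pˡ ⟧ ≈ π ^ suc l
          pˡ≈ = trans (HomLemmas.φ-^ ℤ[ q ] Ω (toΩ q) (p# q) (suc l)) (Ex.^-congˡ (suc l) (⟦p#⟧≈π q))
          inv-pˡ : Inv Ω (⟦ pˡ ⟧)
          inv-pˡ = inv-cong (sym pˡ≈) (inv-^ (suc l) inv-π)
        open Congruence ℤ[ q ] using (_≋_[mod_])

        private

          congruent-Φ : ∀ {ε : ℤq.Carrier} → (∃ λ w → IsIntegral w × eulerianValue ≈ ⟦ ε ⟧ + π ^ suc l * w) → Φ ≋ ε [mod pˡ ]
          congruent-Φ {ε} (w , hw , h) = Pq.congruent {pˡ} {Φ} {ε} inv-pˡ (w , hw , trans ⟦Φ⟧ (trans h (+-congˡ (*-congʳ (sym pˡ≈)))))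

          2E≡ : E ℕ.* 2 ≡ suc Q₀
          2E≡ = ≡.trans (ℕₚ.*-assoc (geometricSum q i) M 2) (≡.trans (≡.cong (geometricSum q i ℕ.*_) M*2≡)
            (≡.trans (ℕₚ.*-comm (geometricSum q i) (suc q₀)) (ℕₚ.suc-injective
              (≡.trans (≡.subst (λ n → suc (suc q₀ ℕ.* geometricSum n i) ≡ n ℕ.^ i) (≡.sym q≡) (geometricSum-* (suc q₀) i)) Q≡))))

          Y≈power : ∀ {x} → x 𝔽Q.≈ valueF → norm O𝔽.^ M 𝔽Q.≈ x O𝔽.^ E
          Y≈power {x} x≈ = 𝔽Q.trans (L𝔽.Ex.^-congˡ M norm≈power) (𝔽Q.trans (L𝔽.Ex.^-assocʳ valueF (geometricSum q i) M)
            (L𝔽.Ex.^-congˡ E (𝔽Q.sym x≈)))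

          sign : ∀ (ε : ℤQ.Carrier) {ε′ : ℤq.Carrier} → ⟦ ε ⟧ ≈ ⟦ ε′ ⟧ → ⟦ ε ⟧ * ⟦ ε ⟧ ≈ 1# →
                 norm O𝔽.^ M 𝔽Q.≈ ε → Φ ≋ ε′ [mod pˡ ]
          sign ε {ε′} ε≈ ε² norm≈ε = congruent-Φ {ε′} (D⁻¹ * w , int-* int-D⁻¹ hw , trans (value≈ eq) (+-congʳ ε≈))
            where
            d : ∃ λ (s : ℤQ.Carrier) → ⟦ norm Oℤ.^ M ⟧ ≈ ⟦ ε ⟧ + π * ⟦ s ⟧
            d = PQ.difference-p {norm Oℤ.^ M} {ε} (𝔽Q.trans (H𝔽.φ-^ norm M) norm≈ε)
            Y≈ : Y ≈ ⟦ ε ⟧ + π * ⟦ proj₁ d ⟧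
            Y≈ = trans (sym (HΩ.φ-^ norm M)) (proj₂ d)
            result : ∃ λ w → IsIntegral w × pairing ≈ ⟦ ε ⟧ * D + π ^ suc l * w
            result = In.pairing-sign as n n-odd l (proj₁ (proj₂ (proj₂ row))) (proj₁ (proj₂ (proj₂ (proj₂ row))))
              (integral ε) (integral (proj₁ d)) ε² Y≈
            w : Carrier
            w = proj₁ result
            hw : IsIntegral w
            hw = proj₁ (proj₂ result)
            eq : pairing ≈ ⟦ ε ⟧ * D + π ^ suc l * w
            eq = proj₂ (proj₂ result)

        square : ∀ {x} → x 𝔽Q.≈ valueF → IsUnitSquare 𝔽[ q ℕ.^ i ] x → Φ ≋ ℤq.1# [mod pˡ ]
        square x≈ h = sign ℤQ.1# {ℤq.1#} (trans HQ.1#-homo (sym Hq.1#-homo))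
          (trans (*-cong HQ.1#-homo HQ.1#-homo) (*-identityˡ 1#)) (𝔽Q.trans (Y≈power x≈) (PQ.square-power {E} 2E≡ h))

        nonsquare : ∀ {x} → x 𝔽Q.≈ valueF → IsUnitNonsquare 𝔽[ q ℕ.^ i ] x → Φ ≋ ℤq.- ℤq.1# [mod pˡ ]
        nonsquare x≈ h = sign (ℤQ.- ℤQ.1#) {ℤq.- ℤq.1#}
          (trans -1Q (sym (trans (Hq.-‿homo ℤq.1#) (-‿cong Hq.1#-homo))))
          (trans (*-cong -1Q -1Q) (trans (RingProps.-1*x≈-x ring (- 1#)) (RingProps.-‿involutive ring 1#)))
          (𝔽Q.trans (Y≈power x≈) (PQ.nonsquare-power {E} 2E≡ h))
          where
          -1Q : ⟦ ℤQ.- ℤQ.1# ⟧ ≈ - 1#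
          -1Q = trans (HQ.-‿homo ℤQ.1#) (-‿cong HQ.1#-homo)

        vanishing : ∀ {x} → x 𝔽Q.≈ valueF → x 𝔽Q.≈ 𝔽Q.0# → Φ ≋ ℤq.0# [mod pˡ ]
        vanishing {x} x≈ x≈0 = congruent-Φ {ℤq.0#}
          (let w , hw , e = value-multiple (In.pairing-divisible as (Y ^_) n divisible) in w , hw , trans e (+-congʳ (sym Hq.0#-homo)))
          where
          norm≈0 : norm 𝔽Q.≈ 𝔽Q.0#
          norm≈0 = 𝔽Q.trans norm≈power (𝔽Q.trans (L𝔽.Ex.^-congˡ (geometricSum q i) (𝔽Q.trans (𝔽Q.sym x≈) x≈0)) (positive-power i 1≤i))
            where
            positive-power : ∀ i → 1 ℕ.≤ i → 𝔽Q.0# O𝔽.^ geometricSum q i 𝔽Q.≈ 𝔽Q.0#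
            positive-power (suc i) _ = L𝔽.0^ (q ℕ.* geometricSum q i)
          d : ∃ λ (s : ℤQ.Carrier) → ⟦ norm ⟧ ≈ ⟦ ℤQ.0# ⟧ + π * ⟦ s ⟧
          d = PQ.difference-p {norm} {ℤQ.0#} norm≈0
          s : Carrier
          s = ⟦ proj₁ d ⟧
          divisible : ∀ j → n ℕ.≤ j → ∃ λ w → IsIntegral w × Y ^ j ≈ π ^ suc l * w
          divisible j n≤j = s ^ suc l * ⟦ norm ⟧ ^ t , int-* (int-^ (suc l) (integral (proj₁ d))) (int-^ t int-norm) ,
            trans (Ex.^-assocʳ (⟦ norm ⟧) M j) (trans (Ex.^-congʳ (⟦ norm ⟧) Mj≡) (trans (Ex.^-homo-* (⟦ norm ⟧) (suc l) t)
              (trans (*-congʳ (trans (Ex.^-congˡ (suc l) (trans (proj₂ d) (trans (+-congʳ HQ.0#-homo) (+-identityˡ _)))) (^-distrib-* π s (suc l)))) (*-assoc _ _ _))))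
            where
            t : ℕ
            t = M ℕ.* j ℕ.∸ suc l
            Mj≡ : M ℕ.* j ≡ suc l ℕ.+ t
            Mj≡ = ≡.sym (ℕₚ.m+[n∸m]≡n (ℕₚ.≤-trans l≤nM (≡.subst (ℕ._≤ M ℕ.* j) (ℕₚ.*-comm M n) (ℕₚ.*-monoʳ-≤ M n≤j))))

    module _ {N l M} (n : ℕ) (n-odd : ∃ λ h → n ≡ suc (h ℕ.* 2)) (1≤i : 1 ℕ.≤ i) (p-odd : ∃ λ k → p ≡ suc (k ℕ.* 2)) (M*2≡ : M ℕ.* 2 ≡ suc q₀)
             (embed : ∃ (IsRootOfUnity (q ℕ.^ i ℕ.∸ 1)) → CommutativeRing.Carrier ℤ[ q ℕ.^ i ])
             (embed-value : ∀ x → ⟦ embed x ⟧ ≡ proj₁ x)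
             (f : Polynomials.Poly 𝔽[ q ] N) (F : Polynomials.Poly ℤ[ q ] N)
             (lift : ∀ α → CommutativeRing._≈_ 𝔽[ q ] (Polynomials.coeff ℤ[ q ] F α) (Polynomials.coeff 𝔽[ q ] f α))
             (l≤ : + suc l ℤ.≤ + n ℤ.* + M) (P⁻¹ : Matrix (suc l)) (isInverse : IsInverse (P (+ n) (suc l)) P⁻¹)
             (A : Fin (suc l) → ℚ) (A≡ : ∀ k → A k ≡ P⁻¹ zero k)
             (exponent : Fin (suc l) → ℕ) (exponent≡ : ∀ k → exponent k ≡ (n ℕ.+ 2 ℕ.* toℕ k) ℕ.* M) where
      private
        module At (z : Vec (∃ (IsRootOfUnity (q ℕ.^ i ℕ.∸ 1))) N) where
          open AtPoint embed embed-value F z public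
          open Value {M} {l} {proj₁ p-odd} (proj₂ p-odd) M*2≡ 1≤i n n-odd
            (ℤₚᵣ.drop‿+≤+ (≡.subst (+ suc l ℤ.≤_) (≡.sym (ℤₚᵣ.pos-* n M)) l≤)) P⁻¹ isInverse public
          value : CommutativeRing.Carrier 𝔽[ q ℕ.^ i ]
          value = Polynomials.eval 𝔽[ q ℕ.^ i ] (mapCoeffs (proj₁ (include𝔽 q i)) f) (Vec.map embed z)
          value≈ : CommutativeRing._≈_ 𝔽[ q ℕ.^ i ] value valueF
          value≈ = valueF≈ f lift

      eulerian : ∃ λ (Φ : Vec (∃ (IsRootOfUnity (q ℕ.^ i ℕ.∸ 1))) N → CommutativeRing.Carrier ℤ[ q ]) →
        (∀ z → CommutativeRing._≈_ Ω (proj₁ (toΩ q) (Φ z)) (Ops.sum Ω λ k → CommutativeRing._*_ Ω (ℚ→Ω (A k))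
          (Polynomials.eval Ω (mapCoeffs (proj₁ (toΩ q)) (Polynomials.quasiNorm ℤ[ q ] q i
            (Polynomials._^ₚ_ ℤ[ q ] F (exponent k)))) (Vec.map proj₁ z)))) ×
        IsEulerianFunction ℤ[ q ] (Ops._^_ ℤ[ q ] (p# q) (suc l)) 𝔽[ q ℕ.^ i ]
          (λ z → Polynomials.eval 𝔽[ q ℕ.^ i ] (mapCoeffs (proj₁ (include𝔽 q i)) f) (Vec.map embed z)) Φ
      eulerian = (λ z → At.Φ z) , (λ z → trans (At.⟦Φ⟧ z) (S.sum-cong-≋ {suc l} (λ k →
          reflexive (≡.sym (≡.cong₂ (λ a e → ℚ→Ω a * At.valueΩ z (quasiNorm q i (F ^ₚ e))) (A≡ k) (exponent≡ k)))))) , record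
        { square    = λ z h → At.square z (At.value≈ z) h
        ; nonsquare = λ z h → At.nonsquare z (At.value≈ z) h
        ; vanishing = λ z h → At.vanishing z (At.value≈ z) h }

  theorem : ¬ (2 ℕ∣.∣ p) → ∀ q → (∃ λ r → (1 ℕ.≤ r) × (q ≡ p ℕ.^ r)) → ∀ {N} l i (1≤l : 1 ℕ.≤ l) → 1 ℕ.≤ i →
    (embed : ∃ (IsRootOfUnity (q ℕ.^ i ℕ.∸ 1)) → CommutativeRing.Carrier ℤ[ q ℕ.^ i ]) → (∀ x → proj₁ (toΩ (q ℕ.^ i)) (embed x) ≡ proj₁ x) →
    (f : Polynomials.Poly (Quotient ℤ[ q ] (p# q)) N) (F : Polynomials.Poly ℤ[ q ] N) →
    (∀ α → CommutativeRing._≈_ (Quotient ℤ[ q ] (p# q)) (Polynomials.coeff ℤ[ q ] F α) (Polynomials.coeff (Quotient ℤ[ q ] (p# q)) f α)) →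
    ∀ b → ¬ (+ 2 ℤ∣.∣ b) → + l ℤ.≤ b ℤ.* + ((q ℕ.∸ 1) DivMod./ 2) →
    (P⁻¹ : Matrix l) → IsInverse (P b l) P⁻¹ →
    ∃ λ (Φ : Vec (∃ (IsRootOfUnity (q ℕ.^ i ℕ.∸ 1))) N → CommutativeRing.Carrier ℤ[ q ]) →
      (∀ z → CommutativeRing._≈_ Ω (proj₁ (toΩ q) (Φ z)) (Ops.sum Ω λ k → CommutativeRing._*_ Ω (ℚ→Ω (firstRow 1≤l P⁻¹ k))
        (Polynomials.eval Ω (mapCoeffs (proj₁ (toΩ q)) (Polynomials.quasiNorm ℤ[ q ] q i
          (Polynomials._^ₚ_ ℤ[ q ] F (ℤ.∣ b ℤ.+ + (2 ℕ.* toℕ k) ∣ ℕ.* ((q ℕ.∸ 1) DivMod./ 2))))) (Vec.map proj₁ z)))) ×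
      IsEulerianFunction ℤ[ q ] (Ops._^_ ℤ[ q ] (p# q) l) (Quotient ℤ[ q ℕ.^ i ] (p# (q ℕ.^ i)))
        (λ z → Polynomials.eval (Quotient ℤ[ q ℕ.^ i ] (p# (q ℕ.^ i))) (mapCoeffs (proj₁ (include𝔽 q i)) f) (Vec.map embed z)) Φ
  theorem 2∤p q (zero , () , _)
  theorem 2∤p q (suc r , _ , q≡) zero i () 1≤i
  theorem 2∤p q _ (suc l) i _ _ _ _ f F lift ℤ.-[1+ n ] _ l≤ P⁻¹ inverse =
    contradiction l≤ (ℤₚᵣ.<⇒≱ (ℤₚᵣ.≤-<-trans negative (ℤ.+<+ (ℕ.s≤s ℕ.z≤n))))
    where
    negative : ℤ.-[1+ n ] ℤ.* + ((q ℕ.∸ 1) DivMod./ 2) ℤ.≤ + 0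
    negative = ℤₚᵣ.*-monoʳ-≤-nonNeg (+ ((q ℕ.∸ 1) DivMod./ 2)) {ℤ.-[1+ n ]} {+ 0} ℤ.-≤+
  theorem 2∤p q (suc r , _ , q≡p^) (suc l) i 1≤l@(ℕ.s≤s _) 1≤i embed embed-value f F lift (+ n) 2∤n l≤ P⁻¹ inverse =
    Norms.eulerian q (q ℕ.∸ 2) r i (q ℕ.^ i ℕ.∸ 2) (ℕ.pred i ℕ.+ r ℕ.* i) q≡ (≡.trans (≡.sym q≡) q≡p^) Q≡
      (≡.trans (≡.sym Q≡) (≡.trans (≡.cong (ℕ._^ i) q≡p^) (≡.trans (ℕₚ.^-*-assoc p (suc r) i)
        (≡.cong (λ j → p ℕ.^ (j ℕ.+ r ℕ.* i)) (≡.sym (ℕₚ.suc-pred i {{ℕ.>-nonZero 1≤i}}))))))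
      n (odd n (λ d → 2∤n (ℤ∣.∣ᵤ⇒∣ d))) 1≤i p-odd
      (≡.trans (DivMod.m/n*n≡m (ℕ∣.divides (proj₁ q-odd) (≡.cong (ℕ._∸ 1) (≡.trans q≡p^ (proj₂ q-odd))))) (≡.cong (ℕ._∸ 1) q≡))
      embed embed-value f F lift l≤ P⁻¹ inverse (firstRow 1≤l P⁻¹) (λ _ → ≡.refl)
      (λ k → ℤ.∣ + n ℤ.+ + (2 ℕ.* toℕ k) ∣ ℕ.* ((q ℕ.∸ 1) DivMod./ 2)) (λ _ → ≡.refl)
    where
    p-odd : ∃ λ k → p ≡ suc (k ℕ.* 2)
    p-odd = odd p 2∤p
    q-odd : ∃ λ k → p ℕ.^ suc r ≡ suc (k ℕ.* 2)
    q-odd = odd-^ p-odd (suc r)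
    1<p : 1 ℕ.< p
    1<p = ℕ.nonTrivial⇒n>1 p {{prime⇒nonTrivial p-prime}}
    1<p^ : ∀ m → 1 ℕ.≤ m → 1 ℕ.< p ℕ.^ m
    1<p^ m 1≤m = ℕₚ.^-monoʳ-< p 1<p 1≤m
    q≡ : q ≡ suc (suc (q ℕ.∸ 2))
    q≡ = ≡.sym (ℕₚ.m+[n∸m]≡n (≡.subst (2 ℕ.≤_) (≡.sym q≡p^) (1<p^ (suc r) (ℕ.s≤s ℕ.z≤n))))
    Q≡ : q ℕ.^ i ≡ suc (suc (q ℕ.^ i ℕ.∸ 2))
    Q≡ = ≡.sym (ℕₚ.m+[n∸m]≡n (ℕₚ.^-monoʳ-< q (≡.subst (1 ℕ.<_) (≡.sym q≡p^) (1<p^ (suc r) (ℕ.s≤s ℕ.z≤n))) 1≤i))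

module EulerianFunctionsℚₚ {c ℓ ℓ′} (p : ℕ) (p-prime : Prime p) (ℚ̅ₚ : AlgebraicClosure (PAdic.ℚₚ-ring p p-prime) c ℓ ℓ′) where

  abstract
    setting : Setting p (PAdic.ℤₚ-ring p p-prime) (AlgebraicClosure.commutativeRing ℚ̅ₚ)
      (compose {A = PAdic.ℤₚ-ring p p-prime} {PAdic.ℚₚ-ring p p-prime} {AlgebraicClosure.commutativeRing ℚ̅ₚ} (PAdic.ℤₚ→ℚₚ p p-prime) (AlgebraicClosure.embedding ℚ̅ₚ))
    setting = Closure.setting p-prime (PAdicLemmas.isPAdic p p-prime) (ℚₚLemmas.hasFractions p p-prime) ℚ̅ₚ

  abstract
    rationalValues : HasRationalValues (PAdic.ℤₚ-ring p p-prime) (AlgebraicClosure.commutativeRing ℚ̅ₚ)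
      (compose {A = PAdic.ℤₚ-ring p p-prime} {PAdic.ℚₚ-ring p p-prime} {AlgebraicClosure.commutativeRing ℚ̅ₚ} (PAdic.ℤₚ→ℚₚ p p-prime) (AlgebraicClosure.embedding ℚ̅ₚ))
      (ℚₚLemmas.fromℤ-hom p p-prime) (λ a → proj₁ (AlgebraicClosure.embedding ℚ̅ₚ) (PAdic.ℚ→ℚₚ p p-prime a))
    rationalValues = Closure.rationalValues p-prime (PAdicLemmas.isPAdic p p-prime) (ℚₚLemmas.hasFractions p p-prime) ℚ̅ₚ

  abstract
    denominators : HasDenominators (PAdic.ℤₚ-ring p p-prime) (PAdic.ℚₚ-ring p p-prime) (PAdic.ℤₚ→ℚₚ p p-prime)
    denominators = FractionLemmas.denominators (ℚₚLemmas.hasFractions p p-prime)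

  toΩ : ∀ Q → RingHom (Unramified.ℤ[_] p p-prime ℚ̅ₚ Q) (AlgebraicClosure.commutativeRing ℚ̅ₚ)
  toΩ Q = (λ x → proj₁ x) , isSubringHom
    where
    module Ω = CommutativeRing (AlgebraicClosure.commutativeRing ℚ̅ₚ)
    isSubringHom : IsRingHomomorphism (CommutativeRing.rawRing (Unramified.ℤ[_] p p-prime ℚ̅ₚ Q)) Ω.rawRing (λ x → proj₁ x)
    isSubringHom = record { isSemiringHomomorphism = record { isNearSemiringHomomorphism = record
      { +-isMonoidHomomorphism = record { isMagmaHomomorphism = record { isRelHomomorphism = record { cong = λ e → e } ; homo = λ _ _ → Ω.refl } ; ε-homo = Ω.refl }
      ; *-homo = λ _ _ → Ω.refl } ; 1#-homo = Ω.refl } ; -‿homo = λ _ → Ω.refl }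

  isIntegers : IsIntegers p (PAdic.ℤₚ→ℚₚ p p-prime) (AlgebraicClosure.embedding ℚ̅ₚ) (Unramified.ℤ[_] p p-prime ℚ̅ₚ) toΩ (Unramified.p# p p-prime ℚ̅ₚ)
  isIntegers = record
    { injective = λ e → e
    ; adjoin    = λ x → proj₁ (proj₂ x)
    ; integral  = λ x → proj₂ (proj₂ x)
    ; element   = λ a b → (_ , a , b) , CommutativeRing.refl (AlgebraicClosure.commutativeRing ℚ̅ₚ)
    ; p#≡       = λ _ → ≡.refl }

  module Generic = EulerianFunctions {Z = PAdic.ℤₚ-ring p p-prime} {K = PAdic.ℚₚ-ring p p-prime} {Ω = AlgebraicClosure.commutativeRing ℚ̅ₚ}
    (PAdic.ℤₚ→ℚₚ p p-prime) (AlgebraicClosure.embedding ℚ̅ₚ) setting denominators (ℚₚLemmas.fromℤ-hom p p-prime)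
    (λ a → proj₁ (AlgebraicClosure.embedding ℚ̅ₚ) (PAdic.ℚ→ℚₚ p p-prime a)) rationalValues
    (Unramified.ℤ[_] p p-prime ℚ̅ₚ) toΩ (Unramified.p# p p-prime ℚ̅ₚ) isIntegers
    (Unramified.includeℤ p p-prime ℚ̅ₚ) (λ _ _ _ → CommutativeRing.refl (AlgebraicClosure.commutativeRing ℚ̅ₚ))
    (Unramified.include𝔽 p p-prime ℚ̅ₚ) (λ _ _ _ → ≡.refl)

theorem4p4 : ∀ {c ℓ ℓ′} (p : ℕ) (p-prime : Prime p) → ¬ (2 ℕ∣.∣ p) →
    (ℚ̅ₚ : AlgebraicClosure (PAdic.ℚₚ-ring p p-prime) c ℓ ℓ′) →
    let open Unramified p p-prime ℚ̅ₚ in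
    (q : ℕ) (q-power : IsPower q)
    (N l i : ℕ) → 1 ℕ.≤ N → (1≤l : 1 ℕ.≤ l) (1≤i : 1 ℕ.≤ i) →
    (f : Polynomials.Poly 𝔽[ q ] N) (F : Polynomials.Poly ℤ[ q ] N) → IsLift {q} {N} F f →
    (b : ℤ) → ¬ (+ 2 ℤ∣.∣ b) → + l ℤ.≤ b ℤ.* + ((q ℕ.∸ 1) DivMod./ 2) →
    (P⁻¹ : Matrix l) → IsInverse (P b l) P⁻¹ →
    ∃ λ (Φ : Vec (μ (q ℕ.^ i ℕ.∸ 1)) N → ∣ℤ[ q ]∣) →
    (∀ z → CommutativeRing._≈_ Ω (proj₁ (Φ z)) (eulerianSum q N i b (firstRow 1≤l P⁻¹) F z)) ×
    IsEulerian {q} {N} l i (power>1 {q} {i} q-power 1≤i) f Φ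
theorem4p4 p p-prime 2∤p ℚ̅ₚ q q-power N l i _ 1≤l 1≤i f F lift b 2∤b l≤ P⁻¹ inverse =
  EulerianFunctionsℚₚ.Generic.theorem p p-prime ℚ̅ₚ 2∤p q q-power l i 1≤l 1≤i
    (Unramified.unity p p-prime ℚ̅ₚ (Unramified.power>1 p p-prime ℚ̅ₚ {q} {i} q-power 1≤i)) (λ _ → ≡.refl)
    f F lift b 2∤b l≤ P⁻¹ inverse
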